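{- The problem $F_m||\sum_{J_j\in E} w_j$ (just-in-time flow-shop scheduling on $m$ machines) with $n$ jobs and $\#d$ different due dates is solvable in $O(n^{\#d+1}(\#d!)^{m-2})$ time, and thus, when $m$ is fixed, belongs to XP with respect to the number $\#d$ of different due dates.
   Context: JIT flow-shop problem $F_m||\sum_{J_j\in E}w_j$: an instance consists of $n$ independent, non-preemptive jobs $\mathcal J=\{J_1,\dots,J_n\}$, all available at time $0$, and $m$ machines $M_1,\dots,M_m$. Job $J_j$ has a processing time $p^{(i)}_j$ on each machine $M_i$, a due date $d_j$ and a weight $w_j$; all these numbers are positive integers. Every scheduled job must be processed first on $M_1$, then on $M_2$, and so on up to $M_m$; its processing on $M_i$ cannot start before its processing on $M_{i-1}$ is completed; each machine processes at most one job at a time; idle time and waiting between machines are allowed, and the processing orders on different machines may differ. A job is scheduled in JIT mode if its processing on $M_m$ is completed exactly at time $d_j$. A partition of $\mathcal J$ into two disjoint subsets $E$ and $T$ is feasible if the jobs of $E$ can be scheduled so that all of them are completed in JIT mode (jobs of $T$ are rejected and are not processed). The goal is to find a feasible partition maximizing $\sum_{J_j\in E}w_j$. $\#d$ is the number of distinct values among the due dates $d_1,\dots,d_n$. A problem belongs to XP with respect to a parameter $k$ if there is an algorithm that solves every instance of size $N$ in $N^{f(k)}$ time, for some computable function $f$ depending only on $k$. -}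

module Defs where

open import Data.Bool using (if_then_else_; _∧_)
open import Data.Fin using (Fin; zero; suc; toℕ)
open import Data.Fin.Subset using (Subset; _∈_)
open import Data.Integer using (+_)
open import Data.List using (length; tabulate; deduplicate)
open import Data.Nat using (ℕ; zero; suc; _+_; _∸_; _*_; _^_; _≤_; _<_; _≡ᵇ_; _≟_)
open import Data.Nat.ListAction using (sum)
open import Data.Nat.Logarithm using (⌊log₂_⌋)
open import Data.Product using (Σ-syntax; ∃; _×_)
open import Data.Rational using (ℚ; 0ℚ)
import Data.Rational as ℚ
open import Data.Sum using (_⊎_)
open import Data.Vec using (lookup)
open import Relation.Binary.PropositionalEquality using (_≡_; _≢_)

------------------------------------------------------------------------
-- Machine model: a random access machine, presented as a structured
-- while-language.  A program addresses a fixed finite number of arrays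
-- (named by literals) of natural numbers.  Every arithmetic operation,
-- constant, memory access, assignment and test costs one unit.  There is
-- no multiplication, so a cell's bit length grows by at most a constant
-- per unit of time and unit-cost time is polynomially related to
-- Turing-machine time.

-- σ a i is the content of cell i of array a.
State : Set
State = ℕ → ℕ → ℕ

_[_,_↦_] : State → ℕ → ℕ → ℕ → State
(σ [ a , i ↦ v ]) b j = if (a ≡ᵇ b) ∧ (i ≡ᵇ j) then v else σ b j

infixl 6 _⊕_ _⊖_
infix  8 _⟦_⟧

data Expr : Set where
  con     : ℕ → Expr
  _⟦_⟧    : ℕ → Expr → Expr
  _⊕_ _⊖_ : Expr → Expr → Expr

eval : State → Expr → ℕ
eval σ (con c)   = c
eval σ (a ⟦ e ⟧) = σ a (eval σ e)
eval σ (e ⊕ e′)  = eval σ e + eval σ e′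
eval σ (e ⊖ e′)  = eval σ e ∸ eval σ e′

cost : Expr → ℕ
cost (con c)   = 1
cost (a ⟦ e ⟧) = 1 + cost e
cost (e ⊕ e′)  = 1 + (cost e + cost e′)
cost (e ⊖ e′)  = 1 + (cost e + cost e′)

infix  5 _⟦_⟧≔_
infixr 4 _⨾_

-- A test succeeds when the value of its expression is nonzero.
data Program : Set where
  skip             : Program
  _⟦_⟧≔_           : ℕ → Expr → Expr → Program
  _⨾_              : Program → Program → Program
  ifnz_then_else_  : Expr → Program → Program → Program
  whilenz_loop_    : Expr → Program → Program

infix 3 ⟨_,_⟩⇓⟨_,_⟩

-- ⟨ P , σ ⟩⇓⟨ t , τ ⟩ : started in σ, P halts after exactly t units of
-- time in state τ.
data ⟨_,_⟩⇓⟨_,_⟩ : Program → State → ℕ → State → Set where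

  skip : ∀ {σ} → ⟨ skip , σ ⟩⇓⟨ 1 , σ ⟩

  assign : ∀ {σ a e e′} →
    ⟨ a ⟦ e ⟧≔ e′ , σ ⟩⇓⟨ 1 + (cost e + cost e′)
                        , σ [ a , eval σ e ↦ eval σ e′ ] ⟩

  seq : ∀ {P Q σ τ υ s t} →
    ⟨ P , σ ⟩⇓⟨ s , τ ⟩ → ⟨ Q , τ ⟩⇓⟨ t , υ ⟩ →
    ⟨ P ⨾ Q , σ ⟩⇓⟨ s + t , υ ⟩

  if-true : ∀ {e P Q σ τ t} → eval σ e ≢ 0 →
    ⟨ P , σ ⟩⇓⟨ t , τ ⟩ →
    ⟨ ifnz e then P else Q , σ ⟩⇓⟨ 1 + (cost e + t) , τ ⟩

  if-false : ∀ {e P Q σ τ t} → eval σ e ≡ 0 →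
    ⟨ Q , σ ⟩⇓⟨ t , τ ⟩ →
    ⟨ ifnz e then P else Q , σ ⟩⇓⟨ 1 + (cost e + t) , τ ⟩

  while-stop : ∀ {e P σ} → eval σ e ≡ 0 →
    ⟨ whilenz e loop P , σ ⟩⇓⟨ 1 + cost e , σ ⟩

  while-step : ∀ {e P σ τ υ s t} → eval σ e ≢ 0 →
    ⟨ P , σ ⟩⇓⟨ s , τ ⟩ →
    ⟨ whilenz e loop P , τ ⟩⇓⟨ t , υ ⟩ →
    ⟨ whilenz e loop P , σ ⟩⇓⟨ 1 + (cost e + (s + t)) , υ ⟩

------------------------------------------------------------------------
-- Parameterized problems and complexity

record Problem : Set₁ where
  field
    Instance  : Set
    size      : Instance → ℕ
    parameter : Instance → ℕ
    encode    : Instance → State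
    -- The final states that exhibit a correct answer.
    Correct   : Instance → State → Set

open Problem

SolvesWithin : (Π : Problem) → Program → Instance Π → ℕ → Set
SolvesWithin Π P I b =
  ∃ λ t → ∃ λ τ → ⟨ P , encode Π I ⟩⇓⟨ t , τ ⟩ × Correct Π I τ × t ≤ b

-- One program solves every instance I in O(T I) time.
SolvableInO : (Π : Problem) → (Instance Π → ℕ) → Set
SolvableInO Π T =
  Σ[ P ∈ Program ] Σ[ C ∈ ℕ ] (∀ I → SolvesWithin Π P I (C * T I))

-- Argument and result are passed in cell 0 of array 0.
Computable : (ℕ → ℕ) → Set
Computable f = Σ[ P ∈ Program ] (∀ k →
  ∃ λ t → ∃ λ τ →
    ⟨ P , (λ _ _ → 0) [ 0 , 0 ↦ k ] ⟩⇓⟨ t , τ ⟩ × τ 0 0 ≡ f k)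

XP : Problem → Set
XP Π = Σ[ f ∈ (ℕ → ℕ) ] Computable f × (Σ[ P ∈ Program ]
  (∀ I → SolvesWithin Π P I (size Π I ^ f (parameter Π I))))

------------------------------------------------------------------------
-- Just-in-time flow shop

record FlowShop (m : ℕ) : Set where
  field
    n   : ℕ
    p   : Fin m → Fin n → ℕ
    d   : Fin n → ℕ
    w   : Fin n → ℕ
    n>0 : 0 < n
    p>0 : ∀ i j → 0 < p i j
    d>0 : ∀ j → 0 < d j
    w>0 : ∀ j → 0 < w j

∑ : ∀ {n} → (Fin n → ℕ) → ℕ
∑ f = sum (tabulate f)

module _ {m : ℕ} (I : FlowShop m) where
  open FlowShop I

  #d : ℕ
  #d = length (deduplicate _≟_ (tabulate d))

  -- The partition (E , T) is represented by E; T is its complement.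
  weight : Subset n → ℕ
  weight E = ∑ λ j → if lookup E j then w j else 0

  toℚ : ℕ → ℚ
  toℚ k = + k ℚ./ 1

  -- Start times are not assumed to be integral.
  record JITSchedule (E : Subset n) : Set where
    field
      start : Fin m → Fin n → ℚ

    completion : Fin m → Fin n → ℚ
    completion i j = start i j ℚ.+ toℚ (p i j)

    field
      nonneg   : ∀ i j → j ∈ E → 0ℚ ℚ.≤ start i j
      flow     : ∀ i i′ j → j ∈ E → toℕ i′ ≡ suc (toℕ i) →
                 completion i j ℚ.≤ start i′ j
      disjoint : ∀ i j k → j ∈ E → k ∈ E → j ≢ k →
                 completion i j ℚ.≤ start i k ⊎ completion i k ℚ.≤ start i j
      jit      : ∀ i j → j ∈ E → suc (toℕ i) ≡ m →
                 completion i j ≡ toℚ (d j)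

  Feasible : Subset n → Set
  Feasible E = JITSchedule E

  Optimal : Subset n → Set
  Optimal E = Feasible E × (∀ E′ → Feasible E′ → weight E′ ≤ weight E)

-- Length of the binary representation (one digit for 0).
bits : ℕ → ℕ
bits k = suc ⌊log₂ k ⌋

totalBits : ∀ {m} → FlowShop m → ℕ
totalBits I = bits n + ∑ λ j → (∑ λ i → bits (p i j)) + bits (d j) + bits (w j)
  where open FlowShop I

extend : ∀ {A : Set} {n} → A → (Fin n → A) → ℕ → A
extend {n = zero}  z f i       = z
extend {n = suc n} z f zero    = f zero
extend {n = suc n} z f (suc i) = extend z (λ j → f (suc j)) i

-- Input: n in cell 0 of array 0, due dates in array 1, weights in array 2,
-- processing times on the successive machines in arrays 3, …, m + 2; job
-- number j occupies cell j, and all remaining cells are 0.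
encodeFlowShop : ∀ {m} → FlowShop m → State
encodeFlowShop I = λ where
    0                   → extend 0 λ (_ : Fin 1) → n
    1                   → extend 0 d
    2                   → extend 0 w
    (suc (suc (suc i))) → extend 0 (extend (λ _ → 0) p i)
  where open FlowShop I

-- Output: the characteristic vector of E in array 0.
JITFlowShop : ℕ → Problem
JITFlowShop m = record
  { Instance  = FlowShop m
  ; size      = totalBits
  ; parameter = #d
  ; encode    = encodeFlowShop
  ; Correct   = λ I τ → Σ[ E ∈ Subset (FlowShop.n I) ]
      Optimal I E × (∀ j → τ 0 (toℕ j) ≡ (if lookup E j then 1 else 0))
  }

{-# OPTIONS --safe #-}

-- Enumerate all candidate solutions with an odometer.  Let L = #d.  A feasible
-- E has at most one job per due date, so E together with its processing order
-- on the first machine is a word of length L over {blank} ∪ {jobs}; there are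
-- (n+1)^L ≤ 4 n^L words.  The orders on M₂, …, M_{m-1} are given by m - 2
-- Fisher–Yates codes, L! of them for each machine, and on the last machine the
-- due dates dictate the order.  For fixed orders, starting every operation as
-- early as possible is optimal: sorting the jobs of a feasible schedule by
-- their start times on each machine yields codes whose earliest completion
-- times are no later than those of the schedule.  Each candidate is checked in
-- O(n) time, because the ranks of the due dates are computed beforehand.

module Submission where

open import Defs
import Algebra.Properties.Group as GroupProperties
open import Data.Bool using (true; false; if_then_else_; T)
open import Data.Fin using (Fin; zero; suc; toℕ; fromℕ<)
open import Data.Fin.Properties using (toℕ-fromℕ<; toℕ<n; toℕ-injective)
open import Data.Fin.Subset using (Subset) renaming (_∈_ to _∈ₛ_)
open import Data.Integer as ℤ using (-[1+_]; +≤+) renaming (+_ to pos)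
import Data.Integer.Properties as ℤ
open import Data.List using (List; []; _∷_; length; map; tabulate; _++_)
open import Data.List.Membership.Propositional using (_∈_)
open import Data.List.Membership.Propositional.Properties
  using (∈-∃++; ∈-map⁻; ∈-++⁻; ∈-++⁺ˡ; ∈-++⁺ʳ; ∈-deduplicate⁺; ∈-deduplicate⁻; ∈-tabulate⁺; ∈-tabulate⁻)
open import Data.List.Properties using (length-++; length-map)
open import Data.List.Relation.Unary.All as All using (All; []; _∷_)
open import Data.List.Relation.Unary.All.Properties using (map⁺)
open import Data.List.Relation.Unary.AllPairs using ([]; _∷_)
open import Data.List.Relation.Unary.Any using (here; there)
open import Data.List.Relation.Unary.Unique.Propositional using (Unique)
open import Data.Nat
open import Data.List.Relation.Unary.Unique.DecPropositional.Properties Data.Nat._≟_ using (deduplicate-!)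
open import Data.Nat.Coprimality using (1-coprimeTo) renaming (sym to coprime-sym)
open import Data.Nat.DivMod
  using (m<n⇒m/n≡0; m<n⇒m%n≡m; [m+kn]%n≡m%n; m*n/n≡m; +-distrib-/-∣ˡ; m≡m%n+[m/n]*n; m%n<n; m<n*o⇒m/o<n;
         /-monoˡ-≤; m/n*n≤m)
open import Data.Nat.Divisibility using (n∣m*n)
open import Data.Nat.Logarithm using (⌊log₂_⌋)
open import Data.Nat.Properties
open import Data.Product using (Σ-syntax; ∃-syntax; ∃₂; _×_; _,_; proj₁; proj₂)
open import Data.Rational as ℚ using (ℚ; mkℚ; 0ℚ; *≤*)
import Data.Rational.Properties as ℚ
import Data.Rational.Unnormalised as ℚᵘ
import Data.Rational.Unnormalised.Properties as ℚᵘ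
open import Data.Sum using (_⊎_; inj₁; inj₂; [_,_]′)
open import Data.Unit using (⊤; tt)
open import Data.Vec as Vec using (lookup)
open import Data.Vec.Properties using (lookup∘tabulate; lookup⇒[]=; []=⇒lookup)
open import Function using (_∘_; const; id)
open import Relation.Binary.Definitions using (tri<; tri≈; tri>)
open import Relation.Binary.PropositionalEquality
open import Relation.Nullary using (¬_; yes; no; contradiction)

-- The bound leaves only `O(n)` for one candidate, which rules out sorting inside the search:
-- writing each accepted job to the slot given by its rank is a bucket sort by due date. A word that
-- uses a due date twice is repaired, by blanking the later entry, instead of being excluded, so the
-- candidates are all digit vectors of a fixed mixed radix and their number is a plain product.
-- Soundness is therefore proved for every vector of valid digits, completeness only for vectors
-- built from a schedule. Each code permutes the order of the preceding machine, so a single array,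
-- exchanged in place, passes through all machines; selection sort works from any initial
-- arrangement and so still supplies the code. The machine computes with natural numbers while start
-- times may be rational, so a feasible schedule is first rounded down. Program states are explicit
-- tuples on which reads and writes compute, so most execution steps are checked by evaluation. Read
-- as a numeral, the digit vector orders the search: the invariant is that the best weight dominates
-- all vectors of smaller value.

-- Pointwise updates and fixed-size tuples

upd : (ℕ → ℕ) → ℕ → ℕ → ℕ → ℕ
upd f i v j = if i ≡ᵇ j then v else f j

≡ᵇ-refl : ∀ i → (i ≡ᵇ i) ≡ true
≡ᵇ-refl zero    = refl
≡ᵇ-refl (suc i) = ≡ᵇ-refl i

≢⇒≡ᵇ-false : ∀ {i j} → i ≢ j → (i ≡ᵇ j) ≡ false
≢⇒≡ᵇ-false {i} {j} i≢j with i ≡ᵇ j in eq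
... | false = refl
... | true  = contradiction (≡ᵇ⇒≡ i j (subst T (sym eq) tt)) i≢j

+-cancelˡ-≡ᵇ : ∀ c i j → (c + i ≡ᵇ c + j) ≡ (i ≡ᵇ j)
+-cancelˡ-≡ᵇ zero    i j = refl
+-cancelˡ-≡ᵇ (suc c) i j = +-cancelˡ-≡ᵇ c i j

upd-same : ∀ f i v → upd f i v i ≡ v
upd-same f i v rewrite ≡ᵇ-refl i = refl

upd-other : ∀ f {i j} v → i ≢ j → upd f i v j ≡ f j
upd-other f v i≢j rewrite ≢⇒≡ᵇ-false i≢j = refl

-- Nested pairs rather than functions on `Fin k`: at a literal index `get` and `put` reduce, so
-- stores before and after an instruction are compared by computation, without function
-- extensionality.
Tup : Set → ℕ → Set
Tup A zero    = ⊤
Tup A (suc k) = A × Tup A k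

get : ∀ {A k} → Fin k → Tup A k → A
get zero    t = proj₁ t
get (suc i) t = get i (proj₂ t)

put : ∀ {A k} → Fin k → A → Tup A k → Tup A k
put zero    a t = a , proj₂ t
put (suc i) a t = proj₁ t , put i a (proj₂ t)

get-put : ∀ {A k} (i j : Fin k) a (t : Tup A k) →
  get j (put i a t) ≡ (if toℕ i ≡ᵇ toℕ j then a else get j t)
get-put zero    zero    a t = refl
get-put zero    (suc j) a t = refl
get-put (suc i) zero    a t = refl
get-put (suc i) (suc j) a t = get-put i j a (proj₂ t)

get-put-same : ∀ {A k} (i : Fin k) a (t : Tup A k) → get i (put i a t) ≡ a
get-put-same zero    a t = refl
get-put-same (suc i) a t = get-put-same i a (proj₂ t)

put-put : ∀ {A k} (i : Fin k) a b (t : Tup A k) → put i b (put i a t) ≡ put i b t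
put-put zero    a b t = refl
put-put (suc i) a b t = cong (proj₁ t ,_) (put-put i a b (proj₂ t))

-- Stores and a verified translation into machine programs

Var Arr : Set
Var = Fin 12
Arr = Fin 8

record Store : Set where
  constructor store
  field
    scalars : Tup ℕ 12
    arrays  : Tup (ℕ → ℕ) 8
open Store

getV : Var → Store → ℕ
getV v S = get v (scalars S)

setV : Var → ℕ → Store → Store
setV v c S = store (put v c (scalars S)) (arrays S)

getA : Arr → Store → ℕ → ℕ
getA a S = get a (arrays S)

setA : Arr → (ℕ → ℕ) → Store → Store
setA a f S = store (scalars S) (put a f (arrays S))

-- The scalars live in array m + 3, the first array not used by the input;
-- array 0 of the store is the output array.
module Compile (m : ℕ) where

  infixl 6 _⊞_ _⊟_
  infix  8 _∙_
  infix  5 _≔_ _[_]≔_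

  -- `inp k` reads array `suc k` of the encoding. `Code` has no assignment to these arrays, so the
  -- semantics can treat the input as a fixed function outside the store.
  data Term : Set where
    con     : ℕ → Term
    var     : Var → Term
    _∙_     : Arr → Term → Term
    inp     : ∀ k → k < 2 + m → Term → Term
    _⊞_ _⊟_ : Term → Term → Term

  base : ℕ
  base = 3 + m

  name : Arr → ℕ
  name zero    = 0
  name (suc a) = suc (base + toℕ a)

  compile : Term → Expr
  compile (con c)     = con c
  compile (var v)     = base ⟦ con (toℕ v) ⟧
  compile (a ∙ e)     = name a ⟦ compile e ⟧
  compile (inp k _ e) = suc k ⟦ compile e ⟧
  compile (e ⊞ e′)    = compile e ⊕ compile e′
  compile (e ⊟ e′)    = compile e ⊖ compile e′

  tcost : Term → ℕ
  tcost e = cost (compile e)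

  infixr 4 _⨟_

  data Code : Set where
    _≔_           : Var → Term → Code
    _[_]≔_        : Arr → Term → Term → Code
    nop           : Code
    _⨟_           : Code → Code → Code
    If_then_else_ : Term → Code → Code → Code
    While_loop_   : Term → Code → Code

  program : Code → Program
  program (v ≔ e)            = base ⟦ con (toℕ v) ⟧≔ compile e
  program (a [ e ]≔ e′)      = name a ⟦ compile e ⟧≔ compile e′
  program nop                = skip
  program (P ⨟ Q)            = program P ⨾ program Q
  program (If e then P else Q) = ifnz compile e then program P else program Q
  program (While e loop P)   = whilenz compile e loop program P

  -- The loop expects its counter to be 0 on entry, and the closing reset restores this, so that
  -- loops can follow one another on the same counter.
  For_<_loop_ : Var → Var → Code → Code
  For x < e loop P = (While (var e ⊟ var x) loop (P ⨟ x ≔ var x ⊞ con 1)) ⨟ x ≔ con 0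

  module Semantics (input : ℕ → ℕ → ℕ) where

    ⟦_⟧ₜ : Term → Store → ℕ
    ⟦ con c ⟧ₜ     S = c
    ⟦ var v ⟧ₜ     S = getV v S
    ⟦ a ∙ e ⟧ₜ     S = getA a S (⟦ e ⟧ₜ S)
    ⟦ inp k _ e ⟧ₜ S = input k (⟦ e ⟧ₜ S)
    ⟦ e ⊞ e′ ⟧ₜ    S = ⟦ e ⟧ₜ S + ⟦ e′ ⟧ₜ S
    ⟦ e ⊟ e′ ⟧ₜ    S = ⟦ e ⟧ₜ S ∸ ⟦ e′ ⟧ₜ S

    infix 3 _∼_
    record _∼_ (σ : State) (S : Store) : Set where
      field
        ∼V : ∀ v → σ base (toℕ v) ≡ getV v S
        ∼A : ∀ a i → σ (name a) i ≡ getA a S i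
        ∼I : ∀ k → k < 2 + m → ∀ i → σ (suc k) i ≡ input k i
    open _∼_

    eval-compile : ∀ {σ S} → σ ∼ S → ∀ e → eval σ (compile e) ≡ ⟦ e ⟧ₜ S
    eval-compile r (con c) = refl
    eval-compile r (var v) = ∼V r v
    eval-compile {S = S} r (a ∙ e) =
      trans (∼A r a _) (cong (getA a S) (eval-compile r e))
    eval-compile r (inp k k< e) =
      trans (∼I r k k< _) (cong (input k) (eval-compile r e))
    eval-compile r (e ⊞ e′) = cong₂ _+_ (eval-compile r e) (eval-compile r e′)
    eval-compile r (e ⊟ e′) = cong₂ _∸_ (eval-compile r e) (eval-compile r e′)

    write-same : ∀ σ a i v j → (σ [ a , i ↦ v ]) a j ≡ upd (σ a) i v j
    write-same σ a i v j rewrite ≡ᵇ-refl a = refl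

    write-other : ∀ σ {a b} i v j → a ≢ b → (σ [ a , i ↦ v ]) b j ≡ σ b j
    write-other σ i v j a≢b rewrite ≢⇒≡ᵇ-false a≢b = refl

    name≢base : ∀ a → name a ≢ base
    name≢base (suc a) eq = <-irrefl (sym eq) (s≤s (m≤m+n base (toℕ a)))

    name≢input : ∀ a k → k < 2 + m → name a ≢ suc k
    name≢input (suc a) k k< eq =
      <-irrefl (sym eq) (s≤s (≤-trans (m≤n⇒m≤1+n k<) (m≤m+n base (toℕ a))))

    base≢input : ∀ k → k < 2 + m → base ≢ suc k
    base≢input k k< eq = <-irrefl (sym eq) (s≤s k<)

    ∼-setV : ∀ {σ S} v c → σ ∼ S → (σ [ base , toℕ v ↦ c ]) ∼ setV v c S
    ∼-setV {σ} {S} v c r = record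
      { ∼V = λ u → trans (write-same σ base (toℕ v) c (toℕ u))
               (trans (cong (if toℕ v ≡ᵇ toℕ u then c else_) (∼V r u))
                      (sym (get-put v u c (scalars S))))
      ; ∼A = λ a i → trans (write-other σ (toℕ v) c i (≢-sym (name≢base a))) (∼A r a i)
      ; ∼I = λ k k< i → trans (write-other σ (toℕ v) c i (base≢input k k<)) (∼I r k k< i)
      }

    write-array : ∀ {σ S} → σ ∼ S → ∀ a i c b j →
      (σ [ name a , i ↦ c ]) (name b) j ≡
      (if toℕ a ≡ᵇ toℕ b then upd (getA a S) i c else getA b S) j
    write-array {σ} r zero i c zero j =
      trans (write-same σ 0 i c j) (cong (if i ≡ᵇ j then c else_) (∼A r zero j))
    write-array r zero i c (suc b) j = ∼A r (suc b) j
    write-array r (suc a) i c zero j = ∼A r zero j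
    write-array {σ} r (suc a) i c (suc b) j
      rewrite +-cancelˡ-≡ᵇ m (toℕ a) (toℕ b) with toℕ a ≡ᵇ toℕ b in eq
    ... | false = ∼A r (suc b) j
    ... | true with i ≡ᵇ j
    ...   | true  = refl
    ...   | false = trans (cong (λ z → σ (suc (base + z)) j)
                     (sym (≡ᵇ⇒≡ (toℕ a) (toℕ b) (subst T (sym eq) tt)))) (∼A r (suc a) j)

    ∼-setA : ∀ {σ S} a i c → σ ∼ S →
      (σ [ name a , i ↦ c ]) ∼ setA a (upd (getA a S) i c) S
    ∼-setA {σ} {S} a i c r = record
      { ∼V = λ u → trans (write-other σ i c (toℕ u) (name≢base a)) (∼V r u)
      ; ∼A = λ b j → trans (write-array r a i c b j)
               (cong (λ f → f j) (sym (get-put a b (upd (getA a S) i c) (arrays S))))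
      ; ∼I = λ k k< j → trans (write-other σ i c j (name≢input a k k<)) (∼I r k k< j)
      }

    -- A Hoare triple with exact stores but only an upper bound on time, so that branches of
    -- different length can be given a common cost. Wrapping it in a record lets unification recover
    -- the code and the stores.
    record Exec (P : Code) (S S′ : Store) (c : ℕ) : Set where
      constructor exec
      field
        run : ∀ σ → σ ∼ S → ∃₂ λ t τ → ⟨ program P , σ ⟩⇓⟨ t , τ ⟩ × t ≤ c × τ ∼ S′
    open Exec public

    Exec-nop : ∀ {S} → Exec nop S S 1
    run Exec-nop σ r = 1 , σ , skip , ≤-refl , r

    Exec-≔ : ∀ {S v e} → Exec (v ≔ e) S (setV v (⟦ e ⟧ₜ S) S) (2 + tcost e)
    run (Exec-≔ {S} {v} {e}) σ r =
      _ , _ , assign , ≤-refl ,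
      subst (λ z → (σ [ base , toℕ v ↦ eval σ (compile e) ]) ∼ setV v z S)
            (eval-compile r e) (∼-setV v _ r)

    Exec-[]≔ : ∀ {S a e e′} →
      Exec (a [ e ]≔ e′) S (setA a (upd (getA a S) (⟦ e ⟧ₜ S) (⟦ e′ ⟧ₜ S)) S)
           (1 + (tcost e + tcost e′))
    run (Exec-[]≔ {S} {a} {e} {e′}) σ r =
      _ , _ , assign , ≤-refl ,
      subst₂ (λ y z → (σ [ name a , eval σ (compile e) ↦ eval σ (compile e′) ]) ∼
                      setA a (upd (getA a S) y z) S)
             (eval-compile r e) (eval-compile r e′) (∼-setA a (eval σ (compile e)) _ r)

    infixr 4 _▷_
    _▷_ : ∀ {P Q S S′ S″ c c′} → Exec P S S′ c → Exec Q S′ S″ c′ → Exec (P ⨟ Q) S S″ (c + c′)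
    run (p ▷ q) σ r with run p σ r
    ... | s , τ , π , s≤ , r′ with run q τ r′
    ...   | t , υ , ρ , t≤ , r″ = _ , υ , seq π ρ , +-mono-≤ s≤ t≤ , r″

    Exec-true : ∀ {e P Q S S′ c k} → ⟦ e ⟧ₜ S ≡ suc k → Exec P S S′ c →
      Exec (If e then P else Q) S S′ (1 + (tcost e + c))
    run (Exec-true {e} eq p) σ r with run p σ r
    ... | t , τ , π , t≤ , r′ =
      _ , τ , if-true (λ z → 0≢1+n (trans (sym z) (trans (eval-compile r e) eq))) π ,
      +-monoʳ-≤ 1 (+-monoʳ-≤ (tcost e) t≤) , r′

    Exec-false : ∀ {e P Q S S′ c} → ⟦ e ⟧ₜ S ≡ 0 → Exec Q S S′ c →
      Exec (If e then P else Q) S S′ (1 + (tcost e + c))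
    run (Exec-false {e} eq q) σ r with run q σ r
    ... | t , τ , π , t≤ , r′ =
      _ , τ , if-false (trans (eval-compile r e) eq) π ,
      +-monoʳ-≤ 1 (+-monoʳ-≤ (tcost e) t≤) , r′

    Exec-stop : ∀ {e P S} → ⟦ e ⟧ₜ S ≡ 0 → Exec (While e loop P) S S (1 + tcost e)
    run (Exec-stop {e} eq) σ r =
      _ , σ , while-stop (trans (eval-compile r e) eq) , ≤-refl , r

    Exec-step : ∀ {e P S S′ S″ c c′ k} → ⟦ e ⟧ₜ S ≡ suc k →
      Exec P S S′ c → Exec (While e loop P) S′ S″ c′ →
      Exec (While e loop P) S S″ (1 + (tcost e + (c + c′)))
    run (Exec-step {e} eq p q) σ r with run p σ r
    ... | s , τ , π , s≤ , r′ with run q τ r′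
    ...   | t , υ , ρ , t≤ , r″ =
      _ , υ , while-step (λ z → 0≢1+n (trans (sym z) (trans (eval-compile r e) eq))) π ρ ,
      +-monoʳ-≤ 1 (+-monoʳ-≤ (tcost e) (+-mono-≤ s≤ t≤)) , r″

    weaken : ∀ {P S S′ c c′} → c ≤ c′ → Exec P S S′ c → Exec P S S′ c′
    run (weaken c≤ p) σ r with run p σ r
    ... | t , τ , π , t≤ , r′ = t , τ , π , ≤-trans t≤ c≤ , r′

    -- The implicit test evaluates to the unit type for closed numerals, so concrete costs are
    -- rounded up without a written proof.
    within : ∀ c′ {P S S′ c} {_ : T (c ≤ᵇ c′)} → Exec P S S′ c → Exec P S S′ c′
    within c′ {c = c} {c≤} = weaken (≤ᵇ⇒≤ c c′ c≤)

    to : ∀ {P S S′ S″ c} → S′ ≡ S″ → Exec P S S′ c → Exec P S S″ c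
    to refl p = p

    -- `g i` is the store before round `i`, onto which the counter is overlaid. A round costs 6 for
    -- the test and 6 for the increment besides the body; the final 9 is the failing test plus the
    -- reset.
    For-rule : ∀ {x e P N c} (g : ℕ → Store) →
      (∀ i k → getV e (setV x k (g i)) ≡ N) →
      (∀ i → i < N → Exec P (setV x i (g i)) (setV x i (g (suc i))) c) →
      Exec (For x < e loop P) (setV x 0 (g 0)) (setV x 0 (g N)) (N * (12 + c) + 9)
    For-rule {x} {e} {P} {N} {c} g bound body =
      weaken (≤-reflexive (+-assoc (N * (12 + c)) 6 3))
        (to (reset 0 (g N)) (iterate N 0 refl ▷ Exec-≔))
      where
      reset : ∀ k S → setV x k (setV x N S) ≡ setV x k S
      reset k S = cong (λ s → store s (arrays S)) (put-put x N k (scalars S))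

      increment : ∀ i S → setV x (getV x (setV x i S) + 1) (setV x i S) ≡ setV x (suc i) S
      increment i S = trans
        (cong (λ z → store (put x z (put x i (scalars S))) (arrays S))
              (trans (cong (_+ 1) (get-put-same x i (scalars S))) (+-comm i 1)))
        (cong (λ s → store s (arrays S)) (put-put x i (suc i) (scalars S)))

      test : ∀ i → getV e (setV x i (g i)) ∸ getV x (setV x i (g i)) ≡ N ∸ i
      test i = cong₂ _∸_ (bound i i) (get-put-same x i (scalars (g i)))

      iterate : ∀ k i → i + k ≡ N →
        Exec (While (var e ⊟ var x) loop (P ⨟ x ≔ var x ⊞ con 1))
             (setV x i (g i)) (setV x N (g N)) (k * (12 + c) + 6)
      iterate zero i eq rewrite trans (sym (+-identityʳ i)) eq =
        Exec-stop (trans (test N) (n∸n≡0 N))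
      iterate (suc k) i eq =
        weaken (≤-reflexive arith)
          (Exec-step (trans (test i) N∸i)
            (to (increment i (g (suc i))) (body i i<N ▷ Exec-≔))
            (iterate k (suc i) (trans (sym (+-suc i k)) eq)))
        where
        i<N : i < N
        i<N = subst (i <_) eq (m<m+n i z<s)
        N∸i : N ∸ i ≡ suc k
        N∸i = trans (cong (_∸ i) (sym eq)) (m+n∸m≡n i (suc k))
        arith : 6 + (c + 6 + (k * (12 + c) + 6)) ≡ suc k * (12 + c) + 6
        arith = trans (sym (+-assoc 6 (c + 6) _))
                  (trans (cong (_+ (k * (12 + c) + 6)) (cong (6 +_) (+-comm c 6)))
                         (sym (+-assoc (12 + c) (k * (12 + c)) 6)))

≤∧≢0⇒pred : ∀ {m n} → m < suc n → m ≢ n → m < n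
≤∧≢0⇒pred m<1+n m≢n = ≤∧≢⇒< (s≤s⁻¹ m<1+n) m≢n

-- Finite sums

Σ< : ℕ → (ℕ → ℕ) → ℕ
Σ< zero    f = 0
Σ< (suc n) f = Σ< n f + f n

Σ<-cong : ∀ n {f g : ℕ → ℕ} → (∀ k → k < n → f k ≡ g k) → Σ< n f ≡ Σ< n g
Σ<-cong zero    eq = refl
Σ<-cong (suc n) eq = cong₂ _+_ (Σ<-cong n (λ k k<n → eq k (m<n⇒m<1+n k<n))) (eq n ≤-refl)

Σ<-mono : ∀ n {f g : ℕ → ℕ} → (∀ k → f k ≤ g k) → Σ< n f ≤ Σ< n g
Σ<-mono zero    le = z≤n
Σ<-mono (suc n) le = +-mono-≤ (Σ<-mono n le) (le n)

Σ<-mono-< : ∀ n {f g : ℕ → ℕ} → (∀ k → f k ≤ g k) → ∀ {j} → j < n → f j < g j → Σ< n f < Σ< n g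
Σ<-mono-< (suc n) le {j} j< lt with j ≟ n
... | yes refl = +-mono-≤-< (Σ<-mono n le) lt
... | no  j≢n  = +-mono-<-≤ (Σ<-mono-< n le (≤∧≢0⇒pred j< j≢n) lt) (le n)

Σ<-const : ∀ n c → Σ< n (const c) ≡ n * c
Σ<-const zero    c = refl
Σ<-const (suc n) c = trans (cong (_+ c) (Σ<-const n c)) (+-comm (n * c) c)

-- Indicators of a < b and a ≡ b, written in the operations of the machine.
lt : ℕ → ℕ → ℕ
lt a b = 1 ∸ (1 ∸ (b ∸ a))

eqᵢ : ℕ → ℕ → ℕ
eqᵢ a b = 1 ∸ ((a ∸ b) + (b ∸ a))

lt≤1 : ∀ a b → lt a b ≤ 1
lt≤1 a b = m∸n≤m 1 (1 ∸ (b ∸ a))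

lt-true : ∀ {a b} → a < b → lt a b ≡ 1
lt-true {a} {b} a<b with b ∸ a in eq
... | zero  = contradiction (m∸n≡0⇒m≤n eq) (<⇒≱ a<b)
... | suc k = cong (1 ∸_) (0∸n≡0 k)

lt-false : ∀ {a b} → b ≤ a → lt a b ≡ 0
lt-false b≤a rewrite m≤n⇒m∸n≡0 b≤a = refl

eqᵢ-true : ∀ a → eqᵢ a a ≡ 1
eqᵢ-true a rewrite n∸n≡0 a = refl

eqᵢ-false : ∀ {a b} → a ≢ b → eqᵢ a b ≡ 0
eqᵢ-false {a} {b} a≢b with (a ∸ b) + (b ∸ a) in eq
... | zero  = contradiction (≤-antisym (m∸n≡0⇒m≤n (m+n≡0⇒m≡0 (a ∸ b) eq))
                                       (m∸n≡0⇒m≤n (m+n≡0⇒n≡0 (a ∸ b) eq))) a≢b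
... | suc k = 0∸n≡0 k

lt-mono : ∀ {a b} → a ≤ b → ∀ c → lt c a ≤ lt c b
lt-mono {a} {b} a≤b c with <-≤-connex c a
... | inj₁ c<a = ≤-reflexive (trans (lt-true c<a) (sym (lt-true (<-≤-trans c<a a≤b))))
... | inj₂ a≤c = ≤-trans (≤-reflexive (lt-false a≤c)) z≤n

module Rank (n : ℕ) (d : ℕ → ℕ) where

  -- A bucket index obtained without sorting: it respects the order of the due dates, and jobs with
  -- one due date collide. Counting jobs instead of values leaves gaps, but the range stays below
  -- `n`, which a check can afford to scan.
  rank : ℕ → ℕ
  rank j = Σ< n λ k → lt (d k) (d j)

  rank-mono-< : ∀ {j k} → j < n → d j < d k → rank j < rank k
  rank-mono-< {j} {k} j<n dj<dk = Σ<-mono-< n (λ i → lt-mono (<⇒≤ dj<dk) (d i)) j<n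
    (subst₂ _<_ (sym (lt-false {d j} ≤-refl)) (sym (lt-true dj<dk)) z<s)

  rank-cong : ∀ {j k} → d j ≡ d k → rank j ≡ rank k
  rank-cong = cong (λ x → Σ< n λ k → lt (d k) x)

  rank<n : ∀ {j} → j < n → rank j < n
  rank<n {j} j<n = <-≤-trans
    -- Job `j` itself contributes 0, which makes the sum strictly smaller than `n` ones.
    (Σ<-mono-< n (λ i → lt≤1 (d i) (d j)) j<n (subst (_< 1) (sym (lt-false {d j} ≤-refl)) z<s))
    (≤-reflexive (trans (Σ<-const n 1) (*-identityʳ n)))

  rank-cancel-< : ∀ {j k} → k < n → rank j < rank k → d j < d k
  rank-cancel-< {j} {k} k<n lt′ with <-cmp (d j) (d k)
  ... | tri< a _ _ = a
  ... | tri≈ _ b _ = contradiction (rank-cong b) (<⇒≢ lt′)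
  ... | tri> _ _ c = contradiction lt′ (<-asym (rank-mono-< k<n c))

  rank-cancel-≡ : ∀ {j k} → j < n → k < n → rank j ≡ rank k → d j ≡ d k
  rank-cancel-≡ {j} {k} j<n k<n eq with <-cmp (d j) (d k)
  ... | tri< a _ _ = contradiction eq (<⇒≢ (rank-mono-< j<n a))
  ... | tri≈ _ b _ = b
  ... | tri> _ _ c = contradiction eq (>⇒≢ (rank-mono-< k<n c))

-- Fisher–Yates codes

swap : ℕ → ℕ → (ℕ → ℕ) → ℕ → ℕ
swap i j a = upd (upd a j (a i)) i (a j)

perm : (ℕ → ℕ) → (ℕ → ℕ) → ℕ → ℕ → ℕ
perm c a zero    = a
perm c a (suc s) = swap s (s + c s) (perm c a s)

-- The exchange as a map of positions, independent of the contents of the array; permutations can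
-- then be composed and inverted as functions on positions.
swap-index : ℕ → ℕ → ℕ → ℕ
swap-index i j k = if i ≡ᵇ k then j else if j ≡ᵇ k then i else k

swap-at : ∀ i j a k → swap i j a k ≡ a (swap-index i j k)
swap-at i j a k with i ≡ᵇ k
... | true = refl
... | false with j ≡ᵇ k
...   | true  = refl
...   | false = refl

data SwapView (i j k : ℕ) : ℕ → Set where
  fst   : k ≡ i → SwapView i j k j
  snd   : k ≡ j → k ≢ i → SwapView i j k i
  other : k ≢ i → k ≢ j → SwapView i j k k

swap-view : ∀ i j k → SwapView i j k (swap-index i j k)
swap-view i j k with i ≟ k
... | yes refl rewrite ≡ᵇ-refl i = fst refl
... | no i≢k rewrite ≢⇒≡ᵇ-false i≢k with j ≟ k
...   | yes refl rewrite ≡ᵇ-refl j = snd refl (≢-sym i≢k)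
...   | no j≢k rewrite ≢⇒≡ᵇ-false j≢k = other (≢-sym i≢k) (≢-sym j≢k)

swap-index-involutive : ∀ i j k → swap-index i j (swap-index i j k) ≡ k
swap-index-involutive i j k with swap-index i j k | swap-view i j k
... | _ | fst refl with swap-index i j j | swap-view i j j
...   | _ | fst p     = p
...   | _ | snd _ _   = refl
...   | _ | other _ q = contradiction refl q
swap-index-involutive i j k | _ | snd refl _ with swap-index i j i | swap-view i j i
... | _ | fst _     = refl
... | _ | snd _ q   = contradiction refl q
... | _ | other q _ = contradiction refl q
swap-index-involutive i j k | _ | other p q with swap-index i j k | swap-view i j k
... | _ | fst r     = contradiction r p
... | _ | snd r _   = contradiction r q
... | _ | other _ _ = refl

swap-index-< : ∀ {i j k L} → i < L → j < L → k < L → swap-index i j k < L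
swap-index-< {i} {j} {k} i< j< k< with swap-index i j k | swap-view i j k
... | _ | fst _     = j<
... | _ | snd _ _   = i<
... | _ | other _ _ = k<

-- Traces a position back to where its content came from, so the last exchange is undone first. The
-- inverse follows the exchanges forward.
perm-index : (ℕ → ℕ) → ℕ → ℕ → ℕ
perm-index c zero    k = k
perm-index c (suc s) k = perm-index c s (swap-index s (s + c s) k)

perm-index⁻¹ : (ℕ → ℕ) → ℕ → ℕ → ℕ
perm-index⁻¹ c zero    k = k
perm-index⁻¹ c (suc s) k = swap-index s (s + c s) (perm-index⁻¹ c s k)

perm-at : ∀ c a s k → perm c a s k ≡ a (perm-index c s k)
perm-at c a zero    k = refl
perm-at c a (suc s) k =
  trans (swap-at s (s + c s) (perm c a s) k) (perm-at c a s (swap-index s (s + c s) k))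

perm-index-inverseʳ : ∀ c s k → perm-index c s (perm-index⁻¹ c s k) ≡ k
perm-index-inverseʳ c zero    k = refl
perm-index-inverseʳ c (suc s) k = trans
  (cong (perm-index c s) (swap-index-involutive s (s + c s) (perm-index⁻¹ c s k)))
  (perm-index-inverseʳ c s k)

perm-index-inverseˡ : ∀ c s k → perm-index⁻¹ c s (perm-index c s k) ≡ k
perm-index-inverseˡ c zero    k = refl
perm-index-inverseˡ c (suc s) k = trans
  (cong (swap-index s (s + c s)) (perm-index-inverseˡ c s (swap-index s (s + c s) k)))
  (swap-index-involutive s (s + c s) k)

-- An entry is the offset from `s` to its exchange partner, which leaves `L ∸ s` choices and hence
-- `L !` codes. The same numbers later serve as radices.
PermCode : ℕ → (ℕ → ℕ) → Set
PermCode L c = ∀ s → s < L → c s < L ∸ s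

code-bound : ∀ {L c s} → PermCode L c → s < L → s + c s < L
code-bound {L} {c} {s} code s<L =
  subst (s + c s <_) (m+[n∸m]≡n (<⇒≤ s<L)) (+-monoʳ-< s (code s s<L))

perm-index-< : ∀ {L c} → PermCode L c → ∀ s → s ≤ L → ∀ k → k < L → perm-index c s k < L
perm-index-< code zero    s≤ k k< = k<
perm-index-< code (suc s) s≤ k k< = perm-index-< code s (<⇒≤ s≤) _
  (swap-index-< s≤ (code-bound code s≤) k<)

perm-index⁻¹-< : ∀ {L c} → PermCode L c → ∀ s → s ≤ L → ∀ k → k < L → perm-index⁻¹ c s k < L
perm-index⁻¹-< code zero    s≤ k k< = k<
perm-index⁻¹-< code (suc s) s≤ k k< =
  swap-index-< s≤ (code-bound code s≤) (perm-index⁻¹-< code s (<⇒≤ s≤) k k<)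

perm-cong : ∀ {c c′} a s → (∀ k → k < s → c k ≡ c′ k) → perm c a s ≡ perm c′ a s
perm-cong a zero    eq = refl
perm-cong a (suc s) eq = cong₂ (λ x b → swap s (s + x) b) (eq s ≤-refl)
  (perm-cong a s (λ k k<s → eq k (m<n⇒m<1+n k<s)))

-- The exchanges of selection sort form a code, so codes reach every order.
argmin : ∀ (f : ℕ → ℕ) s k → ∃[ μ ] μ ≤ k × (∀ i → i ≤ k → f (s + μ) ≤ f (s + i))
argmin f s zero = 0 , z≤n , λ { zero z≤n → ≤-refl }
argmin f s (suc k) with argmin f s k
... | μ , μ≤ , least with ≤-total (f (s + suc k)) (f (s + μ))
...   | inj₁ le = suc k , ≤-refl , go
  where
  go : ∀ i → i ≤ suc k → f (s + suc k) ≤ f (s + i)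
  go i i≤ with i ≟ suc k
  ... | yes refl = ≤-refl
  ... | no  i≢   = ≤-trans le (least i (s≤s⁻¹ (≤∧≢⇒< i≤ i≢)))
...   | inj₂ ge = μ , m≤n⇒m≤1+n μ≤ , go
  where
  go : ∀ i → i ≤ suc k → f (s + μ) ≤ f (s + i)
  go i i≤ with i ≟ suc k
  ... | yes refl = ge
  ... | no  i≢   = least i (s≤s⁻¹ (≤∧≢⇒< i≤ i≢))

Sorted : (ℕ → ℕ) → ℕ → (ℕ → ℕ) → Set
Sorted key L a = ∀ i j → i ≤ j → j < L → key (a i) ≤ key (a j)

module Sort (key : ℕ → ℕ) (L : ℕ) (a : ℕ → ℕ) where

  stage : ℕ → ℕ → ℕ
  code  : ℕ → ℕ
  stage zero    = a
  stage (suc s) = swap s (s + code s) (stage s)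
  code s = proj₁ (argmin (key ∘ stage s) s (L ∸ suc s))

  perm-code : ∀ s → perm code a s ≡ stage s
  perm-code zero    = refl
  perm-code (suc s) = cong (swap s (s + code s)) (perm-code s)

  code-valid : PermCode L code
  code-valid s s<L = subst (code s <_) (sym (+-∸-assoc 1 s<L))
    (s≤s (proj₁ (proj₂ (argmin (key ∘ stage s) s (L ∸ suc s)))))

  minimal : ∀ s j → s ≤ j → j < L → key (stage s (s + code s)) ≤ key (stage s j)
  minimal s j s≤j j<L = subst (λ z → key (stage s (s + code s)) ≤ key (stage s z)) (m+[n∸m]≡n s≤j)
    (proj₂ (proj₂ (argmin (key ∘ stage s) s (L ∸ suc s))) (j ∸ s)
      (∸-monoˡ-≤ (suc s) j<L))

  -- The invariant of selection sort: since `j` may lie beyond `s`, the finished prefix is not only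
  -- sorted but also below the unfinished rest.
  stage-sorted : ∀ s → s ≤ L → ∀ i j → i < s → i ≤ j → j < L → key (stage s i) ≤ key (stage s j)
  stage-sorted (suc s) s<L i j i<1+s i≤j j<L
    rewrite swap-at s (s + code s) (stage s) i | swap-at s (s + code s) (stage s) j
    with swap-index s (s + code s) i | swap-view s (s + code s) i
       | swap-index s (s + code s) j | swap-view s (s + code s) j
  ... | _ | fst i≡s | _ | fst j≡s = ≤-refl
  ... | _ | fst i≡s | _ | snd _ _ = minimal s s ≤-refl s<L
  ... | _ | fst i≡s | _ | other _ _ = minimal s j (subst (_≤ j) i≡s i≤j) j<L
  ... | _ | snd i≡ i≢s | _ | _ = contradiction (≤-antisym (s≤s⁻¹ i<1+s) (subst (s ≤_) (sym i≡) (m≤m+n s _))) i≢s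
  ... | _ | other i≢s _ | _ | fst _ =
    stage-sorted s (<⇒≤ s<L) i (s + code s) (≤∧≢0⇒pred i<1+s i≢s)
      (≤-trans (s≤s⁻¹ i<1+s) (m≤m+n s _)) (code-bound code-valid s<L)
  ... | _ | other i≢s _ | _ | snd _ _ =
    stage-sorted s (<⇒≤ s<L) i s (≤∧≢0⇒pred i<1+s i≢s) (s≤s⁻¹ i<1+s) s<L
  ... | _ | other i≢s _ | _ | other _ _ =
    stage-sorted s (<⇒≤ s<L) i j (≤∧≢0⇒pred i<1+s i≢s) i≤j j<L

  sorted : Sorted key L (perm code a L)
  sorted i j i≤j j<L rewrite perm-code L = stage-sorted L ≤-refl i j (≤-<-trans i≤j j<L) i≤j j<L

-- Positions hold 0 (empty) or suc j (job j).

Occurs : ℕ → (ℕ → ℕ) → ℕ → Set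
Occurs L a j = ∃[ s ] s < L × a s ≡ suc j

-- Blank positions are unconstrained, so one length `L` serves sets of every size up to `L`.
record Listing (n : ℕ) (E : ℕ → Set) (L : ℕ) (a : ℕ → ℕ) : Set where
  field
    listed   : ∀ s → s < L → ∀ j → a s ≡ suc j → j < n × E j
    occurs   : ∀ j → j < n → E j → Occurs L a j
    distinct : ∀ s s′ → s < L → s′ < L → ∀ j → a s ≡ suc j → a s′ ≡ suc j → s ≡ s′
open Listing

Listing-reindex : ∀ {n E L a b} (π π⁻¹ : ℕ → ℕ) →
  (∀ k → k < L → π k < L) → (∀ k → k < L → π⁻¹ k < L) →
  (∀ k → π (π⁻¹ k) ≡ k) → (∀ k → π⁻¹ (π k) ≡ k) →
  (∀ k → k < L → b k ≡ a (π k)) → Listing n E L a → Listing n E L b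
Listing-reindex {a = a} π π⁻¹ π< π⁻¹< ππ⁻¹ π⁻¹π b≡ l = record
  { listed   = λ s s< j eq → listed l (π s) (π< s s<) j (trans (sym (b≡ s s<)) eq)
  ; occurs   = λ j j<n Ej → let s , s< , eq = occurs l j j<n Ej in
      π⁻¹ s , π⁻¹< s s< , trans (b≡ _ (π⁻¹< s s<)) (trans (cong a (ππ⁻¹ s)) eq)
  ; distinct = λ s s′ s< s′< j eq eq′ → trans (sym (π⁻¹π s)) (trans
      (cong π⁻¹ (distinct l (π s) (π s′) (π< s s<) (π< s′ s′<) j
        (trans (sym (b≡ s s<)) eq) (trans (sym (b≡ s′ s′<)) eq′)))
      (π⁻¹π s′))
  }

Listing-cong : ∀ {n E L a b} → (∀ k → k < L → b k ≡ a k) → Listing n E L a → Listing n E L b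
Listing-cong = Listing-reindex id id (λ _ k< → k<) (λ _ k< → k<) (λ _ → refl) (λ _ → refl)

Listing-perm : ∀ {n E L a c} → PermCode L c → Listing n E L a → Listing n E L (perm c a L)
Listing-perm {L = L} {a} {c} code = Listing-reindex (perm-index c L) (perm-index⁻¹ c L)
  (perm-index-< code L ≤-refl) (perm-index⁻¹-< code L ≤-refl)
  (perm-index-inverseʳ c L) (perm-index-inverseˡ c L) (λ k _ → perm-at c a L k)

Occurs-perm : ∀ {L a c j} → PermCode L c → Occurs L a j → Occurs L (perm c a L) j
Occurs-perm {L} {a} {c} code (s , s< , eq) =
  perm-index⁻¹ c L s , perm-index⁻¹-< code L ≤-refl s s< ,
  trans (perm-at c a L _) (trans (cong a (perm-index-inverseʳ c L s)) eq)

-- One machine carrying out the order a: C holds release times, then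
-- completion times, and t is the time at which the machine becomes free.
-- t + (c ∸ t) is the maximum of t and c.

pstep : (ℕ → ℕ) → ℕ → (ℕ → ℕ) × ℕ → (ℕ → ℕ) × ℕ
pstep p zero        (C , t) = C , t
pstep p u@(suc j)   (C , t) = upd C u ((t + (C u ∸ t)) + p j) , (t + (C u ∸ t)) + p j

proc : (ℕ → ℕ) → (ℕ → ℕ) → (ℕ → ℕ) → ℕ → (ℕ → ℕ) × ℕ
proc p a C zero    = C , 0
proc p a C (suc s) = pstep p (a s) (proc p a C s)

m+[n∸m]≤o : ∀ {m n o} → m ≤ o → n ≤ o → m + (n ∸ m) ≤ o
m+[n∸m]≤o {m} {n} {o} m≤o n≤o =
  ≤-trans (+-monoʳ-≤ m (∸-monoˡ-≤ m n≤o)) (≤-reflexive (m+[n∸m]≡n m≤o))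

<-suc-split : ∀ {i s} → i < suc s → i < s ⊎ i ≡ s
<-suc-split {i} {s} i< with i ≟ s
... | yes eq = inj₂ eq
... | no  ne = inj₁ (≤∧≢0⇒pred i< ne)

module Machine (p a C : ℕ → ℕ) where

  Cₛ : ℕ → ℕ → ℕ
  Cₛ s = proj₁ (proc p a C s)

  tₛ : ℕ → ℕ
  tₛ s = proj₂ (proc p a C s)

  -- The bound by `t′` yields disjointness when the next job is appended. `grows` handles a job met
  -- again in the array: its completion time is overwritten by a later one, so its release
  -- constraint survives.
  record Sound (s : ℕ) (C′ : ℕ → ℕ) (t′ : ℕ) : Set where
    field
      released : ∀ j → Occurs s a j → C (suc j) + p j ≤ C′ (suc j) × C′ (suc j) ≤ t′
      disjoint : ∀ j k → Occurs s a j → Occurs s a k → j ≢ k →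
                 C′ (suc j) + p k ≤ C′ (suc k) ⊎ C′ (suc k) + p j ≤ C′ (suc j)
      grows    : ∀ u → C u ≤ C′ u

  sound : ∀ s → Sound s (Cₛ s) (tₛ s)
  sound zero = record
    { released = λ { j (s , () , _) }
    ; disjoint = λ { j k (s , () , _) }
    ; grows    = λ u → ≤-refl
    }
  sound (suc s) with a s in eq | sound s
  ... | zero | ih = record
    { released = λ j o → Sound.released ih j (earlier o)
    ; disjoint = λ j k o o′ → Sound.disjoint ih j k (earlier o) (earlier o′)
    ; grows    = Sound.grows ih
    }
    where
    earlier : ∀ {j} → Occurs (suc s) a j → Occurs s a j
    earlier (i , i< , e) with <-suc-split i<
    ... | inj₁ i<s  = i , i<s , e
    ... | inj₂ refl with () ← trans (sym eq) e
  ... | suc l | ih = record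
    { released = released′
    ; disjoint = disjoint′
    ; grows    = grows′
    }
    where
    t t′ : ℕ
    t  = tₛ s
    t′ = (t + (Cₛ s (suc l) ∸ t)) + p l

    C′ : ℕ → ℕ
    C′ = upd (Cₛ s) (suc l) t′

    earlier : ∀ {j} → Occurs (suc s) a j → l ≢ j → Occurs s a j
    earlier (i , i< , e) l≢j with <-suc-split i<
    ... | inj₁ i<s  = i , i<s , e
    ... | inj₂ refl = contradiction (suc-injective (trans (sym eq) e)) l≢j

    old : ∀ {j} → l ≢ j → C′ (suc j) ≡ Cₛ s (suc j)
    old l≢j = upd-other (Cₛ s) t′ (λ e → l≢j (suc-injective e))

    new : C′ (suc l) ≡ t′
    new = upd-same (Cₛ s) (suc l) t′

    t+p≤t′ : t + p l ≤ t′
    t+p≤t′ = +-monoˡ-≤ (p l) (m≤m+n t _)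

    C+p≤t′ : Cₛ s (suc l) + p l ≤ t′
    C+p≤t′ = +-monoˡ-≤ (p l) (m≤n+m∸n (Cₛ s (suc l)) t)

    t≤t′ : t ≤ t′
    t≤t′ = ≤-trans (m≤m+n t (p l)) t+p≤t′

    released′ : ∀ j → Occurs (suc s) a j → C (suc j) + p j ≤ C′ (suc j) × C′ (suc j) ≤ t′
    released′ j o with l ≟ j
    ... | yes refl = subst (λ z → C (suc l) + p l ≤ z × z ≤ t′) (sym new)
                       (≤-trans (+-monoˡ-≤ (p l) (Sound.grows ih (suc l))) C+p≤t′ , ≤-refl)
    ... | no l≢j with Sound.released ih j (earlier o l≢j)
    ...   | r , q = subst (λ z → C (suc j) + p j ≤ z × z ≤ t′) (sym (old l≢j)) (r , ≤-trans q t≤t′)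

    last : ∀ {k} → Occurs (suc s) a k → l ≢ k → C′ (suc k) + p l ≤ C′ (suc l)
    last {k} o l≢k = subst₂ _≤_ (cong (_+ p l) (sym (old l≢k))) (sym new)
      (≤-trans (+-monoˡ-≤ (p l) (proj₂ (Sound.released ih k (earlier o l≢k)))) t+p≤t′)

    disjoint′ : ∀ j k → Occurs (suc s) a j → Occurs (suc s) a k → j ≢ k →
                C′ (suc j) + p k ≤ C′ (suc k) ⊎ C′ (suc k) + p j ≤ C′ (suc j)
    disjoint′ j k o o′ j≢k with l ≟ j | l ≟ k
    ... | yes refl | _        = inj₂ (last o′ j≢k)
    ... | no _     | yes refl = inj₁ (last o (≢-sym j≢k))
    ... | no l≢j   | no l≢k   = subst₂
      (λ y z → y + p k ≤ z ⊎ z + p j ≤ y) (sym (old l≢j)) (sym (old l≢k))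
      (Sound.disjoint ih j k (earlier o l≢j) (earlier o′ l≢k) j≢k)

    grows′ : ∀ u → C u ≤ C′ u
    grows′ u with suc l ≟ u
    ... | yes refl = ≤-trans (Sound.grows ih u) (≤-trans (≤-trans (m≤m+n _ (p l)) C+p≤t′)
                       (≤-reflexive (sym new)))
    ... | no ne    = ≤-trans (Sound.grows ih u) (≤-reflexive (sym (upd-other (Cₛ s) t′ ne)))

  module Complete (n : ℕ) (E : ℕ → Set) (L : ℕ) (x : ℕ → ℕ) (key : ℕ → ℕ)
    (key-suc  : ∀ j → key (suc j) ≡ x j)
    (listing  : Listing n E L a)
    (sorted   : Sorted key L a)
    (positive : ∀ j → j < n → 0 < p j)
    (disjoint : ∀ j k → j < n → k < n → E j → E k → j ≢ k → x j + p j ≤ x k ⊎ x k + p k ≤ x j)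
    (ready    : ∀ j → j < n → E j → C (suc j) ≤ x j) where

    -- Earliest starts dominate the schedule `x`: the machine is free by the scheduled start of
    -- every job still ahead, and those jobs still carry their release times. Both together bound
    -- the start chosen next.
    record Inv (s : ℕ) (C′ : ℕ → ℕ) (t′ : ℕ) : Set where
      field
        done    : ∀ j → Occurs s a j → C′ (suc j) ≤ x j + p j
        free    : ∀ i → s ≤ i → i < L → ∀ j → a i ≡ suc j → t′ ≤ x j
        waiting : ∀ i → s ≤ i → i < L → ∀ j → a i ≡ suc j → C′ (suc j) ≡ C (suc j)

    inv : ∀ s → s ≤ L → Inv s (Cₛ s) (tₛ s)
    inv zero    s≤ = record
      { done    = λ { j (s , () , _) }
      ; free    = λ _ _ _ _ _ → z≤n
      ; waiting = λ _ _ _ _ _ → refl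
      }
    inv (suc s) s<L with a s in eq | inv s (<⇒≤ s<L)
    ... | zero | ih = record
      { done    = λ j o → Inv.done ih j (earlier o)
      ; free    = λ i s<i → Inv.free ih i (<⇒≤ s<i)
      ; waiting = λ i s<i → Inv.waiting ih i (<⇒≤ s<i)
      }
      where
      earlier : ∀ {j} → Occurs (suc s) a j → Occurs s a j
      earlier (i , i< , e) with <-suc-split i<
      ... | inj₁ i<s  = i , i<s , e
      ... | inj₂ refl with () ← trans (sym eq) e
    ... | suc l | ih = record { done = done′ ; free = free′ ; waiting = waiting′ }
      where
      t t′ : ℕ
      t  = tₛ s
      t′ = (t + (Cₛ s (suc l) ∸ t)) + p l

      l<n : l < n
      l<n = proj₁ (listed listing s s<L l eq)

      El : E l
      El = proj₂ (listed listing s s<L l eq)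

      t′≤ : t′ ≤ x l + p l
      t′≤ = +-monoˡ-≤ (p l) (m+[n∸m]≤o (Inv.free ih s ≤-refl s<L l eq)
        (≤-trans (≤-reflexive (Inv.waiting ih s ≤-refl s<L l eq)) (ready l l<n El)))

      done′ : ∀ j → Occurs (suc s) a j → upd (Cₛ s) (suc l) t′ (suc j) ≤ x j + p j
      done′ j (i , i< , e) with l ≟ j
      ... | yes refl = ≤-trans (≤-reflexive (upd-same (Cₛ s) (suc l) t′)) t′≤
      ... | no l≢j with <-suc-split i<
      ...   | inj₁ i<s  = ≤-trans (≤-reflexive (upd-other (Cₛ s) t′ (λ q → l≢j (suc-injective q))))
                            (Inv.done ih j (i , i<s , e))
      ...   | inj₂ refl = contradiction (suc-injective (trans (sym eq) e)) l≢j

      later≢ : ∀ i → s < i → i < L → ∀ j → a i ≡ suc j → l ≢ j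
      later≢ i s<i i<L j e refl = <⇒≢ s<i (distinct listing s i s<L i<L l eq e)

      free′ : ∀ i → s < i → i < L → ∀ j → a i ≡ suc j → t′ ≤ x j
      free′ i s<i i<L j e with listed listing i i<L j e
      ... | j<n , Ej with disjoint l j l<n j<n El Ej (later≢ i s<i i<L j e)
      ...   | inj₁ le = ≤-trans t′≤ le
      -- If `j` came first, positivity of its processing time would make its start strictly earlier
      -- than that of `l`, against sortedness.
      ...   | inj₂ le = contradiction
        (subst₂ _≤_ (trans (cong key eq) (key-suc l)) (trans (cong key e) (key-suc j))
          (sorted s i (<⇒≤ s<i) i<L))
        (<⇒≱ (<-≤-trans (m<m+n (x j) (positive j j<n)) le))

      waiting′ : ∀ i → s < i → i < L → ∀ j → a i ≡ suc j →
        upd (Cₛ s) (suc l) t′ (suc j) ≡ C (suc j)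
      waiting′ i s<i i<L j e = trans
        (upd-other (Cₛ s) t′ (λ q → later≢ i s<i i<L j e (suc-injective q)))
        (Inv.waiting ih i (<⇒≤ s<i) i<L j e)

    completes : ∀ j → j < n → E j → Cₛ L (suc j) ≤ x j + p j
    completes j j<n Ej = Inv.done (inv L ≤-refl) j (occurs listing j j<n Ej)

-- The last machine: due dates fix the completion times.

fstep : (ℕ → ℕ) → (ℕ → ℕ) → (ℕ → ℕ) → ℕ → ℕ × ℕ → ℕ × ℕ
fstep d p C zero      (t , ok) = t , ok
fstep d p C u@(suc j) (t , ok) = d j , ok ∸ (((t + (C u ∸ t)) + p j) ∸ d j)

-- The flag starts at 1, and truncated subtraction of any lateness takes it to 0 for good. The time
-- is set to the due date, up to which the machine is occupied.
fin : (ℕ → ℕ) → (ℕ → ℕ) → (ℕ → ℕ) → (ℕ → ℕ) → ℕ → ℕ × ℕ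
fin d p slot C zero    = 0 , 1
fin d p slot C (suc k) = fstep d p C (slot k) (fin d p slot C k)

module LastMachine (d p slot C : ℕ → ℕ) where

  tₖ okₖ : ℕ → ℕ
  tₖ  k = proj₁ (fin d p slot C k)
  okₖ k = proj₂ (fin d p slot C k)

  record Sound (k t : ℕ) : Set where
    field
      inTime : ∀ i j → i < k → slot i ≡ suc j → C (suc j) + p j ≤ d j × d j ≤ t
      apart  : ∀ i i′ j j′ → i < i′ → i′ < k → slot i ≡ suc j → slot i′ ≡ suc j′ → d j + p j′ ≤ d j′

  -- With the flag at most 1, a lateness of a single unit suffices to clear it.
  ok≤1 : ∀ k → okₖ k ≤ 1
  ok≤1 zero = ≤-refl
  ok≤1 (suc k) with slot k
  ... | zero  = ok≤1 k
  ... | suc j = ≤-trans (m∸n≤m (okₖ k) (((tₖ k + (C (suc j) ∸ tₖ k)) + p j) ∸ d j)) (ok≤1 k)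

  sound : ∀ k → okₖ k ≢ 0 → Sound k (tₖ k)
  sound zero ok = record { inTime = λ _ _ () ; apart = λ _ _ _ _ _ () }
  sound (suc k) ok with slot k in eq
  ... | zero = record
    { inTime = λ i j i< e → Sound.inTime ih i j (earlier i< e) e
    ; apart  = λ i i′ j j′ i<i′ i′< e e′ → Sound.apart ih i i′ j j′ i<i′ (earlier i′< e′) e e′
    }
    where
    ih = sound k ok
    earlier : ∀ {i j} → i < suc k → slot i ≡ suc j → i < k
    earlier i< e with <-suc-split i<
    ... | inj₁ i<k  = i<k
    ... | inj₂ refl with () ← trans (sym eq) e
  ... | suc l = record { inTime = inTime′ ; apart = apart′ }
    where
    t t′ : ℕ
    t  = tₖ k
    t′ = (t + (C (suc l) ∸ t)) + p l

    ih : Sound k (tₖ k)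
    ih = sound k (λ z → ok (trans (cong (_∸ (t′ ∸ d l)) z) (0∸n≡0 (t′ ∸ d l))))

    t′≤d : t′ ≤ d l
    t′≤d with t′ ∸ d l in e
    ... | zero  = m∸n≡0⇒m≤n e
    ... | suc x = contradiction (m≤n⇒m∸n≡0 (≤-trans (ok≤1 k) (s≤s z≤n))) ok

    t+p≤d : t + p l ≤ d l
    t+p≤d = ≤-trans (+-monoˡ-≤ (p l) (m≤m+n t _)) t′≤d

    inTime′ : ∀ i j → i < suc k → slot i ≡ suc j → C (suc j) + p j ≤ d j × d j ≤ d l
    inTime′ i j i< e with <-suc-split i<
    ... | inj₁ i<k with Sound.inTime ih i j i<k e
    ...   | r , q = r , ≤-trans q (≤-trans (m≤m+n t (p l)) t+p≤d)
    inTime′ i j i< e | inj₂ refl with refl ← suc-injective (trans (sym eq) e) =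
      ≤-trans (+-monoˡ-≤ (p l) (m≤n+m∸n (C (suc l)) t)) t′≤d , ≤-refl

    apart′ : ∀ i i′ j j′ → i < i′ → i′ < suc k → slot i ≡ suc j → slot i′ ≡ suc j′ → d j + p j′ ≤ d j′
    apart′ i i′ j j′ i<i′ i′< e e′ with <-suc-split i′<
    ... | inj₁ i′<k = Sound.apart ih i i′ j j′ i<i′ i′<k e e′
    ... | inj₂ refl with refl ← suc-injective (trans (sym eq) e′) =
      ≤-trans (+-monoˡ-≤ (p l) (proj₂ (Sound.inTime ih i j i<i′ e))) t+p≤d

  module Complete (n : ℕ) (x : ℕ → ℕ)
    (jit   : ∀ k j → k < n → slot k ≡ suc j → x j + p j ≡ d j)
    (next  : ∀ k k′ j j′ → k < k′ → k′ < n → slot k ≡ suc j → slot k′ ≡ suc j′ → d j ≤ x j′)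
    (ready : ∀ k j → k < n → slot k ≡ suc j → C (suc j) ≤ x j) where

    inv : ∀ k → k ≤ n → okₖ k ≡ 1 × (∀ i j → k ≤ i → i < n → slot i ≡ suc j → tₖ k ≤ x j)
    inv zero k≤ = refl , λ _ _ _ _ _ → z≤n
    inv (suc k) k<n with slot k in eq | inv k (<⇒≤ k<n)
    ... | zero  | ok , free = ok , λ i j k<i → free i j (<⇒≤ k<i)
    ... | suc l | ok , free =
      trans (cong₂ _∸_ ok (m≤n⇒m∸n≡0 (≤-trans
              (+-monoˡ-≤ (p l) (m+[n∸m]≤o (free k l ≤-refl k<n eq) (ready k l k<n eq)))
              (≤-reflexive (jit k l k<n eq))))) refl ,
      λ i j k<i i<n e → next k i l j k<i i<n eq e

-- Reading the word: slot (rank j) ≡ suc j and sel j ≡ 1 record that job j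
-- is accepted; an entry whose due date is already taken becomes 0.

Triple : Set
Triple = (ℕ → ℕ) × (ℕ → ℕ) × (ℕ → ℕ)

waccept : (ℕ → ℕ) → ℕ → ℕ → ℕ → Triple → Triple
waccept r s j zero    (slot , sel , q) = upd slot (r j) (suc j) , upd sel j 1 , upd q s (suc j)
waccept r s j (suc _) (slot , sel , q) = slot , sel , upd q s 0

wstep : (ℕ → ℕ) → ℕ → ℕ → Triple → Triple
wstep r s zero    (slot , sel , q) = slot , sel , upd q s 0
wstep r s (suc j) (slot , sel , q) = waccept r s j (slot (r j)) (slot , sel , q)

word : (ℕ → ℕ) → (ℕ → ℕ) → Triple → ℕ → Triple
word r δ W₀ zero    = W₀
word r δ W₀ (suc s) = wstep r s (δ s) (word r δ W₀ s)

module Word (n : ℕ) (r δ : ℕ → ℕ) (W₀ : Triple) where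

  slotₛ selₛ qₛ : ℕ → ℕ → ℕ
  slotₛ s = proj₁ (word r δ W₀ s)
  selₛ  s = proj₁ (proj₂ (word r δ W₀ s))
  qₛ    s = proj₂ (proj₂ (word r δ W₀ s))

  Occurs-upd : ∀ {s q j} v → Occurs s q j → Occurs (suc s) (upd q s v) j
  Occurs-upd {q = q} v (i , i<s , e) =
    i , m<n⇒m<1+n i<s , trans (upd-other q v (>⇒≢ i<s)) e

  Occurs-suc : ∀ {s q j} → Occurs s q j → Occurs (suc s) q j
  Occurs-suc (i , i<s , e) = i , m<n⇒m<1+n i<s , e

  Accepted : ℕ → Triple → Set
  Accepted s (slot , sel , q) = ∀ j → j < n →
    sel j ≡ 0 ⊎ (sel j ≡ 1 × slot (r j) ≡ suc j × Occurs s q j)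

  later : ∀ {s slot sel q} v → Accepted s (slot , sel , q) → Accepted (suc s) (slot , sel , upd q s v)
  later v acc j j<n with acc j j<n
  ... | inj₁ e           = inj₁ e
  ... | inj₂ (e , f , o) = inj₂ (e , f , Occurs-upd v o)

  -- A slot is written only while it holds 0, so an accepted job is never displaced, whatever the
  -- digits are.
  accepted : (∀ j → j < n → proj₁ (proj₂ W₀) j ≡ 0) → ∀ s → Accepted s (word r δ W₀ s)
  accepted z zero = λ j j<n → inj₁ (z j j<n)
  accepted z (suc s) with δ s
  ... | zero = later {slot = slotₛ s} 0 (accepted z s)
  ... | suc l with slotₛ s (r l) in eq
  ...   | suc _ = later {slot = slotₛ s} 0 (accepted z s)
  ...   | zero  = go
    where
    go : Accepted (suc s) (upd (slotₛ s) (r l) (suc l) , upd (selₛ s) l 1 , upd (qₛ s) s (suc l))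
    go j j<n with l ≟ j
    ... | yes refl = inj₂ (upd-same (selₛ s) l 1 , upd-same (slotₛ s) (r l) (suc l) ,
                           s , ≤-refl , upd-same (qₛ s) s (suc l))
    ... | no l≢j with accepted z s j j<n
    ...   | inj₁ e = inj₁ (trans (upd-other (selₛ s) 1 l≢j) e)
    ...   | inj₂ (e , f , o) = inj₂ (trans (upd-other (selₛ s) 1 l≢j) e ,
              trans (upd-other (slotₛ s) (suc l)
                (λ rl≡rj → 0≢1+n (trans (sym eq) (trans (cong (slotₛ s) rl≡rj) f)))) f ,
              Occurs-upd (suc l) o)

  module Complete (E : ℕ → Set) (L : ℕ)
    (r<n     : ∀ j → j < n → r j < n)
    (r-inj   : ∀ j k → j < n → k < n → E j → E k → r j ≡ r k → j ≡ k)
    (listing : Listing n E L δ)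
    (slot≡0  : ∀ k → k < n → proj₁ W₀ k ≡ 0)
    (sel≡0   : ∀ j → j < n → proj₁ (proj₂ W₀) j ≡ 0) where

    record Inv (s : ℕ) (W : Triple) : Set where
      field
        copies : ∀ i → i < s → proj₂ (proj₂ W) i ≡ δ i
        slots  : ∀ k → k < n → ∀ j → proj₁ W k ≡ suc j → k ≡ r j × Occurs s δ j
        sels   : ∀ j → j < n → (proj₁ (proj₂ W) j ≡ 0 × ¬ Occurs s δ j) ⊎
                               (proj₁ (proj₂ W) j ≡ 1 × Occurs s δ j)

    copies′ : ∀ {s q} v → δ s ≡ v → (∀ i → i < s → q i ≡ δ i) → ∀ i → i < suc s → upd q s v i ≡ δ i
    copies′ {s} {q} v e c i i< with <-suc-split i<
    ... | inj₁ i<s  = trans (upd-other q v (>⇒≢ i<s)) (c i i<s)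
    ... | inj₂ refl = trans (upd-same q s v) (sym e)

    inv : ∀ s → s ≤ L → Inv s (word r δ W₀ s)
    inv zero s≤ = record
      { copies = λ _ ()
      ; slots  = λ k k<n j e → contradiction (trans (sym (slot≡0 k k<n)) e) 0≢1+n
      ; sels   = λ j j<n → inj₁ (sel≡0 j j<n , λ { (_ , () , _) })
      }
    inv (suc s) s<L with δ s in eq | inv s (<⇒≤ s<L)
    ... | zero  | ih = record
      { copies = copies′ 0 eq (Inv.copies ih)
      ; slots  = λ k k<n j e → let p , o = Inv.slots ih k k<n j e in p , Occurs-suc o
      ; sels   = sels′
      }
      where
      sels′ : ∀ j → j < n → (selₛ s j ≡ 0 × ¬ Occurs (suc s) δ j) ⊎ (selₛ s j ≡ 1 × Occurs (suc s) δ j)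
      sels′ j j<n with Inv.sels ih j j<n
      ... | inj₂ (e , o) = inj₂ (e , Occurs-suc o)
      ... | inj₁ (e , ¬o) = inj₁ (e , λ { (i , i< , f) → [ (λ i<s → ¬o (i , i<s , f)) ,
              (λ { refl → 0≢1+n (trans (sym eq) f) }) ]′ (<-suc-split i<) })
    ... | suc l | ih with listed listing s s<L l eq | slotₛ s (r l) in eq′
    -- An occupied slot belongs to a listed job of the same rank. By `r-inj` that job is `l` itself,
    -- which would then be listed twice.
    ...   | l<n , El | suc l′ = contradiction l-again (λ { (i , i<s , e) →
              <⇒≢ i<s (distinct listing i s (<-trans i<s s<L) s<L l e eq) })
      where
      l-again : Occurs s δ l
      l-again with Inv.slots ih (r l) (r<n l l<n) l′ eq′
      ... | rl≡ , o@(i , i<s , e) with listed listing i (<-trans i<s s<L) l′ e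
      ...   | l′<n , El′ = subst (Occurs s δ) (sym (r-inj l l′ l<n l′<n El El′ rl≡)) o
    ...   | l<n , El | zero = record
      { copies = copies′ (suc l) eq (Inv.copies ih)
      ; slots  = slots′
      ; sels   = sels′
      }
      where
      slots′ : ∀ k → k < n → ∀ j → upd (slotₛ s) (r l) (suc l) k ≡ suc j → k ≡ r j × Occurs (suc s) δ j
      slots′ k k<n j e with r l ≟ k
      ... | yes refl with refl ← suc-injective (trans (sym e) (upd-same (slotₛ s) (r l) (suc l))) =
        refl , s , ≤-refl , eq
      ... | no rl≢k with Inv.slots ih k k<n j (trans (sym (upd-other (slotₛ s) (suc l) rl≢k)) e)
      ...   | p , o = p , Occurs-suc o
      sels′ : ∀ j → j < n → (upd (selₛ s) l 1 j ≡ 0 × ¬ Occurs (suc s) δ j) ⊎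
                            (upd (selₛ s) l 1 j ≡ 1 × Occurs (suc s) δ j)
      sels′ j j<n with l ≟ j
      ... | yes refl = inj₂ (upd-same (selₛ s) l 1 , s , ≤-refl , eq)
      ... | no l≢j with Inv.sels ih j j<n
      ...   | inj₂ (e , o) = inj₂ (trans (upd-other (selₛ s) 1 l≢j) e , Occurs-suc o)
      ...   | inj₁ (e , ¬o) = inj₁ (trans (upd-other (selₛ s) 1 l≢j) e ,
              λ { (i , i< , f) → [ (λ i<s → ¬o (i , i<s , f)) ,
              (λ { refl → l≢j (suc-injective (trans (sym eq) f)) }) ]′ (<-suc-split i<) })

-- Machine orders encoded in digit vectors

-- Machines are counted from 0. Block 0 of the vector is the word; a later block `i` is the code
-- that turns the order on machine `i - 1` into the order on machine `i`.
section : ℕ → (ℕ → ℕ) → ℕ → ℕ → ℕ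
section L δ i s = δ (i * L + s)

order : ℕ → (ℕ → ℕ) → (ℕ → ℕ) → ℕ → ℕ → ℕ
order L δ q zero    = q
order L δ q (suc i) = perm (section L δ (suc i)) (order L δ q i) L

-- The arrays agree only below `L`; validity of the codes keeps every exchange inside that range.
order-cong : ∀ {L δ M a b} → (∀ i → suc i < M → PermCode L (section L δ (suc i))) →
  (∀ k → k < L → a k ≡ b k) → ∀ i → i < M → ∀ k → k < L → order L δ a i k ≡ order L δ b i k
order-cong codes eq zero    i<M k k<L = eq k k<L
order-cong {L} {δ} {a = a} {b} codes eq (suc i) i<M k k<L = begin
  perm c (order L δ a i) L k           ≡⟨ perm-at c (order L δ a i) L k ⟩
  order L δ a i (perm-index c L k)     ≡⟨ order-cong codes eq i (<⇒≤ i<M) _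
                                            (perm-index-< (codes i i<M) L ≤-refl k k<L) ⟩
  order L δ b i (perm-index c L k)     ≡⟨ perm-at c (order L δ b i) L k ⟨
  perm c (order L δ b i) L k           ∎
  where
  open ≡-Reasoning
  c = section L δ (suc i)

-- A blank gets key 0, so sorting moves blanks towards the front, where processing skips them.
key : (ℕ → ℕ) → ℕ → ℕ
key x zero    = 0
key x (suc j) = x j

Sorted-cong : ∀ {κ L a b} → (∀ k → k < L → a k ≡ b k) → Sorted κ L b → Sorted κ L a
Sorted-cong {κ} eq s i j i≤j j<L = subst₂ _≤_
  (cong κ (sym (eq i (≤-<-trans i≤j j<L)))) (cong κ (sym (eq j j<L))) (s i j i≤j j<L)

-- The index counts machines already passed, so the value at `i` holds the release times for machine
-- `i`.
completions : (ℕ → ℕ → ℕ) → ℕ → (ℕ → ℕ) → (ℕ → ℕ) → (ℕ → ℕ) → ℕ → ℕ → ℕ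
completions p L δ q C₀ zero    = C₀
completions p L δ q C₀ (suc i) = proj₁ (proc (p i) (order L δ q i) (completions p L δ q C₀ i) L)

record IsRank (n : ℕ) (d rank : ℕ → ℕ) : Set where
  field
    rank<n        : ∀ j → j < n → rank j < n
    rank-cancel-< : ∀ j k → j < n → k < n → rank j < rank k → d j < d k
    rank-cancel-≡ : ∀ j k → j < n → k < n → rank j ≡ rank k → d j ≡ d k

isRank : ∀ n d {r} → (∀ j → j < n → r j ≡ Rank.rank n d j) → IsRank n d r
isRank n d r≡ = record
  { rank<n        = λ j j<n → subst (_< n) (sym (r≡ j j<n)) (Rank.rank<n n d j<n)
  ; rank-cancel-< = λ j k j<n k<n h →
      Rank.rank-cancel-< n d {j} k<n (subst₂ _<_ (r≡ j j<n) (r≡ k k<n) h)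
  ; rank-cancel-≡ = λ j k j<n k<n h →
      Rank.rank-cancel-≡ n d j<n k<n (trans (sym (r≡ j j<n)) (trans h (r≡ k k<n)))
  }

-- Soundness and completeness of checking one vector

module Check (n L M : ℕ) (d : ℕ → ℕ) (p : ℕ → ℕ → ℕ) where

  -- Integral start times on machines 0 to `M`, the last one being `M`; nonnegativity is built into
  -- the natural numbers.
  record Schedule (E : ℕ → Set) (x : ℕ → ℕ → ℕ) : Set where
    field
      flow     : ∀ i j → i < M → j < n → E j → x i j + p i j ≤ x (suc i) j
      disjoint : ∀ i j k → i ≤ M → j < n → k < n → E j → E k → j ≢ k →
                 x i j + p i j ≤ x i k ⊎ x i k + p i k ≤ x i j
      jit      : ∀ j → j < n → E j → x M j + p M j ≡ d j

  Codes : (ℕ → ℕ) → Set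
  Codes δ = ∀ i → suc i < M → PermCode L (section L δ (suc i))

  record Good (E : ℕ → Set) (x : ℕ → ℕ → ℕ) (δ : ℕ → ℕ) : Set where
    field
      listing : Listing n E L δ
      codes   : Codes δ
      sorted  : ∀ i → i < M → Sorted (key (x i)) L (order L δ δ i)

  module Due {E : ℕ → Set} {x : ℕ → ℕ → ℕ}
    (positive : ∀ i j → i ≤ M → j < n → 0 < p i j) (S : Schedule E x) where
    open Schedule S

    x<d : ∀ j → j < n → E j → x M j < d j
    x<d j j<n Ej = <-≤-trans (m<m+n (x M j) (positive M j ≤-refl j<n)) (≤-reflexive (jit j j<n Ej))

    d-next : ∀ j k → j < n → k < n → E j → E k → d j ≤ d k → j ≢ k → d j ≤ x M k
    d-next j k j<n k<n Ej Ek le j≢k with disjoint M j k ≤-refl j<n k<n Ej Ek j≢k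
    ... | inj₁ h = ≤-trans (≤-reflexive (sym (jit j j<n Ej))) h
    ... | inj₂ h = contradiction le (<⇒≱ (≤-<-trans
                     (≤-trans (≤-reflexive (sym (jit k k<n Ek))) h) (x<d j j<n Ej)))

    -- Two jobs with one due date would both occupy the last machine immediately before it. This is
    -- why words of length `#d` suffice.
    d-injective : ∀ j k → j < n → k < n → E j → E k → d j ≡ d k → j ≡ k
    d-injective j k j<n k<n Ej Ek eq with j ≟ k
    ... | yes j≡k = j≡k
    ... | no  j≢k = contradiction (d-next j k j<n k<n Ej Ek (≤-reflexive eq) j≢k)
      (<⇒≱ (<-≤-trans (x<d k k<n Ek) (≤-reflexive (sym eq))))

  -- `W₀` and `C₀` are the arrays as clearing leaves them. They are parameters because cells outside
  -- the cleared range may hold remains of earlier candidates.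
  module Run (rank : ℕ → ℕ) (isRank : IsRank n d rank) (δ : ℕ → ℕ) (W₀ : Triple) (C₀ : ℕ → ℕ) where
    open IsRank isRank
    open Word n rank δ W₀

    slot sel q : ℕ → ℕ
    slot = slotₛ L
    sel  = selₛ L
    q    = qₛ L

    C : ℕ → ℕ → ℕ
    C = completions p L δ q C₀

    ok : ℕ
    ok = proj₂ (fin d (p M) slot (C M) n)

    module Soundness (sel≡0 : ∀ j → j < n → proj₁ (proj₂ W₀) j ≡ 0) (codes : Codes δ) (ok≢0 : ok ≢ 0) where

      E : ℕ → Set
      E j = sel j ≡ 1

      taken : ∀ j → j < n → E j → slot (rank j) ≡ suc j × Occurs L q j
      taken j j<n e with accepted sel≡0 L j j<n
      ... | inj₁ z           = contradiction (trans (sym z) e) 0≢1+n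
      ... | inj₂ (_ , f , o) = f , o

      occurs-order : ∀ i → i < M → ∀ j → Occurs L q j → Occurs L (order L δ q i) j
      occurs-order zero    i<M j o = o
      occurs-order (suc i) i<M j o = Occurs-perm (codes i i<M) (occurs-order i (<⇒≤ i<M) j o)

      machine : ∀ i → Machine.Sound (p i) (order L δ q i) (C i) L (C (suc i)) (proj₂ (proc (p i) (order L δ q i) (C i) L))
      machine i = Machine.sound (p i) (order L δ q i) (C i) L

      last : LastMachine.Sound d (p M) slot (C M) n (proj₁ (fin d (p M) slot (C M) n))
      last = LastMachine.sound d (p M) slot (C M) n ok≢0

      x : ℕ → ℕ → ℕ
      -- The test separates the last machine, where the due date and not the computed time is the
      -- completion. The subtractions are exact for selected jobs, by `ends` and `ends-last`.
      x i j = if i <ᵇ M then C (suc i) (suc j) ∸ p i j else d j ∸ p M j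

      x-inner : ∀ i j → i < M → x i j ≡ C (suc i) (suc j) ∸ p i j
      x-inner i j i<M with i <ᵇ M in eq
      ... | true  = refl
      ... | false = contradiction (<⇒<ᵇ i<M) (subst (λ b → ¬ T b) (sym eq) (λ ()))

      x-last : ∀ j → x M j ≡ d j ∸ p M j
      x-last j with M <ᵇ M in eq
      ... | false = refl
      ... | true  = contradiction (<ᵇ⇒< M M (subst T (sym eq) _)) (<-irrefl refl)

      released : ∀ i j → i < M → j < n → E j → C i (suc j) + p i j ≤ C (suc i) (suc j)
      released i j i<M j<n e = proj₁ (Machine.Sound.released (machine i) j
        (occurs-order i i<M j (proj₂ (taken j j<n e))))

      inTime : ∀ j → j < n → E j → C M (suc j) + p M j ≤ d j
      inTime j j<n e = proj₁ (LastMachine.Sound.inTime last (rank j) j (rank<n j j<n)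
        (proj₁ (taken j j<n e)))

      ends : ∀ i j → i < M → j < n → E j → x i j + p i j ≡ C (suc i) (suc j)
      ends i j i<M j<n e = trans (cong (_+ p i j) (x-inner i j i<M))
        (m∸n+n≡m (≤-trans (m≤n+m (p i j) _) (released i j i<M j<n e)))

      ends-last : ∀ j → j < n → E j → x M j + p M j ≡ d j
      ends-last j j<n e = trans (cong (_+ p M j) (x-last j))
        (m∸n+n≡m (≤-trans (m≤n+m (p M j) _) (inTime j j<n e)))

      starts : ∀ i j → i ≤ M → j < n → E j → C i (suc j) ≤ x i j
      starts i j i≤M j<n e with m≤n⇒m<n∨m≡n i≤M
      ... | inj₁ i<M  = ≤-trans (m+n≤o⇒m≤o∸n _ (released i j i<M j<n e)) (≤-reflexive (sym (x-inner i j i<M)))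
      ... | inj₂ refl = ≤-trans (m+n≤o⇒m≤o∸n _ (inTime j j<n e)) (≤-reflexive (sym (x-last j)))

      flow : ∀ i j → i < M → j < n → E j → x i j + p i j ≤ x (suc i) j
      flow i j i<M j<n e = ≤-trans (≤-reflexive (ends i j i<M j<n e)) (starts (suc i) j i<M j<n e)

      disjoint : ∀ i j k → i ≤ M → j < n → k < n → E j → E k → j ≢ k →
                 x i j + p i j ≤ x i k ⊎ x i k + p i k ≤ x i j
      disjoint i j k i≤M j<n k<n e f j≢k with m≤n⇒m<n∨m≡n i≤M
      ... | inj₁ i<M  = [ inj₁ ∘ before j k j<n k<n e f , inj₂ ∘ before k j k<n j<n f e ]′
        (Machine.Sound.disjoint (machine i) j k (occurs-order i i<M j (proj₂ (taken j j<n e)))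
          (occurs-order i i<M k (proj₂ (taken k k<n f))) j≢k)
        where
        before : ∀ j k → j < n → k < n → E j → E k →
          C (suc i) (suc j) + p i k ≤ C (suc i) (suc k) → x i j + p i j ≤ x i k
        before j k j<n k<n e f le = subst₂ _≤_ (sym (ends i j i<M j<n e)) (sym (x-inner i k i<M))
          (m+n≤o⇒m≤o∸n _ le)
      ... | inj₂ refl with <-cmp (rank j) (rank k)
      ...   | tri≈ _ b _ = contradiction (suc-injective (trans (sym (proj₁ (taken j j<n e)))
                (trans (cong slot b) (proj₁ (taken k k<n f))))) j≢k
      ...   | tri< a _ _ = inj₁ (after j k j<n k<n e f a)
        where
        after : ∀ j k → j < n → k < n → E j → E k → rank j < rank k → x M j + p M j ≤ x M k
        after j k j<n k<n e f lt′ = subst₂ _≤_ (sym (ends-last j j<n e)) (sym (x-last k))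
          (m+n≤o⇒m≤o∸n (d j) (LastMachine.Sound.apart last (rank j) (rank k) j k lt′ (rank<n k k<n)
            (proj₁ (taken j j<n e)) (proj₁ (taken k k<n f))))
      ...   | tri> _ _ c = inj₂ (after k j k<n j<n f e c)
        where
        after : ∀ j k → j < n → k < n → E j → E k → rank j < rank k → x M j + p M j ≤ x M k
        after j k j<n k<n e f lt′ = subst₂ _≤_ (sym (ends-last j j<n e)) (sym (x-last k))
          (m+n≤o⇒m≤o∸n (d j) (LastMachine.Sound.apart last (rank j) (rank k) j k lt′ (rank<n k k<n)
            (proj₁ (taken j j<n e)) (proj₁ (taken k k<n f))))

      schedule : Schedule E x
      schedule = record { flow = flow ; disjoint = disjoint ; jit = ends-last }

    module Completeness {E : ℕ → Set} {x : ℕ → ℕ → ℕ}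
      (positive : ∀ i j → i ≤ M → j < n → 0 < p i j)
      (S : Schedule E x) (good : Good E x δ)
      (slot≡0 : ∀ k → k < n → proj₁ W₀ k ≡ 0)
      (sel≡0 : ∀ j → j < n → proj₁ (proj₂ W₀) j ≡ 0)
      (C≡0 : ∀ j → j < n → C₀ (suc j) ≡ 0) where
      open Schedule S
      open Good good

      open Due positive S

      rank-inj : ∀ j k → j < n → k < n → E j → E k → rank j ≡ rank k → j ≡ k
      rank-inj j k j<n k<n Ej Ek eq = d-injective j k j<n k<n Ej Ek (rank-cancel-≡ j k j<n k<n eq)

      module W = Word.Complete n rank δ W₀ E L rank<n rank-inj listing slot≡0 sel≡0

      read : W.Inv L _
      read = W.inv L ≤-refl

      q≡δ : ∀ i → i < L → q i ≡ δ i
      q≡δ = W.Inv.copies read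

      selected : ∀ j → j < n → (sel j ≡ 0 × ¬ E j) ⊎ (sel j ≡ 1 × E j)
      selected j j<n with W.Inv.sels read j j<n
      ... | inj₁ (e , ¬o) = inj₁ (e , λ Ej → ¬o (Listing.occurs listing j j<n Ej))
      ... | inj₂ (e , s , s<L , f) = inj₂ (e , proj₂ (Listing.listed listing s s<L j f))

      order-listing : ∀ i → i < M → Listing n E L (order L δ δ i)
      order-listing zero    i<M = listing
      order-listing (suc i) i<M = Listing-perm (codes i i<M) (order-listing i (<⇒≤ i<M))

      order≡ : ∀ i → i < M → ∀ k → k < L → order L δ q i k ≡ order L δ δ i k
      order≡ = order-cong codes q≡δ

      -- Induction over the machines: the computed completion on machine `i` is no later than the
      -- scheduled one, and `flow` puts the latter before the scheduled start on the next machine.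
      ready : ∀ i → i ≤ M → ∀ j → j < n → E j → C i (suc j) ≤ x i j
      ready zero    i≤M j j<n Ej = ≤-trans (≤-reflexive (C≡0 j j<n)) z≤n
      ready (suc i) i<M j j<n Ej = ≤-trans
        (Machine.Complete.completes (p i) (order L δ q i) (C i) n E L (x i) (key (x i)) (λ _ → refl)
          (Listing-cong (order≡ i i<M) (order-listing i i<M))
          (Sorted-cong {κ = key (x i)} (order≡ i i<M) (sorted i i<M))
          (λ k → positive i k (<⇒≤ i<M))
          (λ k l → disjoint i k l (<⇒≤ i<M))
          (ready i (<⇒≤ i<M)) j j<n Ej)
        (flow i j i<M j<n Ej)

      in-slot : ∀ k j → k < n → slot k ≡ suc j → k ≡ rank j × j < n × E j
      in-slot k j k<n e with W.Inv.slots read k k<n j e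
      ... | k≡ , s , s<L , f = k≡ , Listing.listed listing s s<L j f

      accepts : ok ≡ 1
      accepts = proj₁ (LastMachine.Complete.inv d (p M) slot (C M) n (x M)
        (λ k j k<n e → let _ , j<n , Ej = in-slot k j k<n e in jit j j<n Ej)
        (λ k k′ j j′ k<k′ k′<n e e′ →
          let k≡  , j<n  , Ej  = in-slot k j (<-trans k<k′ k′<n) e
              k′≡ , j′<n , Ej′ = in-slot k′ j′ k′<n e′
              r<r = subst₂ _<_ k≡ k′≡ k<k′
          in d-next j j′ j<n j′<n Ej Ej′ (<⇒≤ (rank-cancel-< j j′ j<n j′<n r<r)) (λ { refl → <-irrefl refl r<r }))
        (λ k j k<n e → let _ , j<n , Ej = in-slot k j k<n e in ready M ≤-refl j j<n Ej)
        n ≤-refl)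

  module Existence {E : ℕ → Set} (x : ℕ → ℕ → ℕ) (0<L : 0 < L) (a : ℕ → ℕ) (listing₀ : Listing n E L a) where

    instance
      L≢0 : NonZero L
      L≢0 = >-nonZero 0<L

    -- The word itself is written in the order of the first machine, which therefore costs no code.
    -- From the second machine on, the exchanges of selection sort become the digits.
    arrangement : ℕ → ℕ → ℕ
    arrangement zero    = perm (Sort.code (key (x 0)) L a) a L
    arrangement (suc i) = perm (Sort.code (key (x (suc i))) L (arrangement i)) (arrangement i) L

    digit : ℕ → ℕ → ℕ
    digit zero    = arrangement zero
    digit (suc i) = Sort.code (key (x (suc i))) L (arrangement i)

    δ : ℕ → ℕ
    δ k = digit (k / L) (k % L)

    section-δ : ∀ i s → s < L → section L δ i s ≡ digit i s
    section-δ i s s<L = cong₂ digit quotient remainder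
      where
      quotient : (i * L + s) / L ≡ i
      quotient = trans (+-distrib-/-∣ˡ {i * L} s (n∣m*n i))
        (trans (cong₂ _+_ (m*n/n≡m i L) (m<n⇒m/n≡0 s<L)) (+-identityʳ i))
      remainder : (i * L + s) % L ≡ s
      remainder = trans (cong (_% L) (+-comm (i * L) s)) (trans ([m+kn]%n≡m%n s i L) (m<n⇒m%n≡m s<L))

    order-δ : ∀ i → order L δ (arrangement 0) i ≡ arrangement i
    order-δ zero    = refl
    order-δ (suc i) = trans (cong (λ b → perm (section L δ (suc i)) b L) (order-δ i))
      (perm-cong (arrangement i) L (λ s s<L → section-δ (suc i) s s<L))

    δ-codes : Codes δ
    δ-codes i _ s s<L = subst (_< L ∸ s) (sym (section-δ (suc i) s s<L))
      (Sort.code-valid (key (x (suc i))) L (arrangement i) s s<L)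

    arrangement-sorted : ∀ i → Sorted (key (x i)) L (arrangement i)
    arrangement-sorted zero    = Sort.sorted (key (x 0)) L a
    arrangement-sorted (suc i) = Sort.sorted (key (x (suc i))) L (arrangement i)

    listing : Listing n E L δ
    listing = Listing-cong (section-δ 0) (Listing-perm (Sort.code-valid (key (x 0)) L a) listing₀)

    good : Good E x δ
    good = record
      { listing = listing
      ; codes   = δ-codes
      ; sorted  = λ i i<M → Sorted-cong {κ = key (x i)}
          (λ k k<L → trans (order-cong δ-codes (section-δ 0) i i<M k k<L)
                           (cong (λ b → b k) (order-δ i)))
          (arrangement-sorted i)
      }

    δ≤n : ∀ s → s < L → δ s ≤ n
    δ≤n s s<L with δ s in eq
    ... | zero  = z≤n
    ... | suc j = proj₁ (Listing.listed listing s s<L j eq)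

-- Variables, arrays and memory snapshots

vn vL vx vy vt vW vok vbest vptr vK vgo va : Var
vn    = zero
vL    = suc zero
vx    = suc (suc zero)
vy    = suc (suc (suc zero))
vt    = suc (suc (suc (suc zero)))
vW    = suc (suc (suc (suc (suc zero))))
vok   = suc (suc (suc (suc (suc (suc zero)))))
vbest = suc (suc (suc (suc (suc (suc (suc zero))))))
vptr  = suc (suc (suc (suc (suc (suc (suc (suc zero)))))))
vK    = suc (suc (suc (suc (suc (suc (suc (suc (suc zero))))))))
vgo   = suc (suc (suc (suc (suc (suc (suc (suc (suc (suc zero)))))))))
va    = suc (suc (suc (suc (suc (suc (suc (suc (suc (suc (suc zero))))))))))

aout arank aslot asel aq aC adig arad : Arr
aout  = zero
arank = suc zero
aslot = suc (suc zero)
asel  = suc (suc (suc zero))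
aq    = suc (suc (suc (suc zero)))
aC    = suc (suc (suc (suc (suc zero))))
adig  = suc (suc (suc (suc (suc (suc zero)))))
arad  = suc (suc (suc (suc (suc (suc (suc zero))))))

-- The memory between two phases of the program, when vx, vy, vt and va are 0.
record Mem : Set where
  field
    n L W ok best ptr K go : ℕ
    out rank slot sel q C dig rad : ℕ → ℕ

⟪_⟫ : Mem → Store
⟪ s ⟫ = store (n , L , 0 , 0 , 0 , W , ok , best , ptr , K , go , 0 , tt)
              (out , rank , slot , sel , q , C , dig , rad , tt)
  where open Mem s

-- Describes an array in the middle of a filling loop. As a nest of `upd` it agrees by computation
-- with what one more assignment produces.
fill : (ℕ → ℕ) → ℕ → (ℕ → ℕ) → ℕ → ℕ → ℕ
fill a b v zero    = a
fill a b v (suc k) = upd (fill a b v k) (b + k) (v k)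

fill-in : ∀ a b v k {x} → x < k → fill a b v k (b + x) ≡ v x
fill-in a b v (suc k) {x} x< with <-suc-split x<
... | inj₁ x<k  = trans (upd-other (fill a b v k) (v k) (λ e → <⇒≢ x<k (sym (+-cancelˡ-≡ b k x e)))) (fill-in a b v k x<k)
... | inj₂ refl = upd-same (fill a b v k) (b + k) (v k)

fill-out : ∀ a b v k {x} → x < b → fill a b v k x ≡ a x
fill-out a b v zero    x<b = refl
fill-out a b v (suc k) x<b =
  trans (upd-other (fill a b v k) (v k) (>⇒≢ (<-≤-trans x<b (m≤m+n b k)))) (fill-out a b v k x<b)

weightIf : ℕ → ℕ → ℕ
weightIf zero    w = 0
weightIf (suc _) w = w

-- The second argument is the value tested by the program, `(r x ∸ D x) ∸ 1`, which is 0 when a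
-- valid digit is at its maximum. Passing it as a number lets the model branch by matching where the
-- program branches by testing.
icase : ℕ → ℕ → (ℕ → ℕ) × ℕ → (ℕ → ℕ) × ℕ
icase x zero    (D , g) = upd D x 0 , g
icase x (suc _) (D , g) = upd D x (D x + 1) , 0

istep : (ℕ → ℕ) → ℕ → ℕ → (ℕ → ℕ) × ℕ → (ℕ → ℕ) × ℕ
istep r x zero    (D , g) = D , g
istep r x (suc _) (D , g) = icase x ((r x ∸ D x) ∸ 1) (D , g)

-- The digits after adding 1 with carry, and the carry.
inc : (ℕ → ℕ) → (ℕ → ℕ) → ℕ → (ℕ → ℕ) × ℕ
inc r D zero    = D , 1
inc r D (suc x) = istep r x (proj₂ (inc r D x)) (inc r D x)

-- The 21 merges the 12 per round of `For-rule` with its final 9, charged to `n ≥ 1`.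
linear : ∀ {N n} c → N ≤ n → 1 ≤ n → N * (12 + c) + 9 ≤ (21 + c) * n
linear {N} {n} c N≤n 1≤n = begin
  N * (12 + c) + 9     ≤⟨ +-mono-≤ (*-monoˡ-≤ (12 + c) N≤n) (≤-trans (≤-reflexive (sym (*-identityʳ 9))) (*-monoʳ-≤ 9 1≤n)) ⟩
  n * (12 + c) + 9 * n ≡⟨ cong (_+ 9 * n) (*-comm n (12 + c)) ⟩
  (12 + c) * n + 9 * n ≡⟨ *-distribʳ-+ n (12 + c) 9 ⟨
  (12 + c + 9) * n     ≡⟨ cong (_* n) (+-comm (12 + c) 9) ⟩
  (21 + c) * n         ∎
  where open ≤-Reasoning

-- The program and the execution of its phases

module Algorithm (M : ℕ) where
  open Compile (suc M) public

  D[_] W[_] : Term → Term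
  D[ e ] = inp 0 z<s e
  W[ e ] = inp 1 (s<s z<s) e

  P[_∣_] : ∀ {i} → i ≤ M → Term → Term
  P[_∣_] {i} i≤M e = inp (2 + i) (s<s (s<s (s≤s i≤M))) e

  x y : Term
  x = var vx
  y = var vy

  max : Term → Term
  max e = var vt ⊞ (e ⊟ var vt)

  clear readWord shuffle finish weigh keepBest advance increment check ranks countValues radices : Code

  clear = For vx < vn loop
    -- `aC` is addressed by the stored entry `suc j`, hence the shift by 1.
    (aslot [ x ]≔ con 0 ⨟ asel [ x ]≔ con 0 ⨟ aC [ con 1 ⊞ x ]≔ con 0)

  readWord = For vx < vL loop
    (If adig ∙ x
      then (If aslot ∙ (arank ∙ (adig ∙ x ⊟ con 1))
        then aq [ x ]≔ con 0
        else (aslot [ arank ∙ (adig ∙ x ⊟ con 1) ]≔ adig ∙ x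
            ⨟ asel [ adig ∙ x ⊟ con 1 ]≔ con 1
            ⨟ aq [ x ]≔ adig ∙ x))
      else (aq [ x ]≔ con 0))

  process : ∀ {i} → i ≤ M → Code
  process i≤M = (For vx < vL loop
    (If aq ∙ x
      then (vt ≔ max (aC ∙ (aq ∙ x)) ⊞ P[ i≤M ∣ aq ∙ x ⊟ con 1 ]
          ⨟ aC [ aq ∙ x ]≔ var vt)
      else nop)) ⨟ vt ≔ con 0

  shuffle = (For vx < vL loop
    (va ≔ aq ∙ (x ⊞ adig ∙ (var vptr ⊞ x))
      ⨟ aq [ x ⊞ adig ∙ (var vptr ⊞ x) ]≔ aq ∙ x
      ⨟ aq [ x ]≔ var va
      ⨟ va ≔ con 0)) ⨟ vptr ≔ var vptr ⊞ var vL

  -- Machine 0 takes the word as its order, so the first code is read before machine 1.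
  before : ℕ → Code
  before zero    = nop
  before (suc _) = shuffle

  stages : ∀ i → i ≤ M → Code
  stages zero    _   = nop
  stages (suc i) i<M = stages i (<⇒≤ i<M) ⨟ before i ⨟ process (<⇒≤ i<M)

  finish = vok ≔ con 1 ⨟ (For vx < vn loop
    (If aslot ∙ x
      then (vok ≔ var vok ⊟ (max (aC ∙ (aslot ∙ x)) ⊞ P[ ≤-refl ∣ aslot ∙ x ⊟ con 1 ] ⊟ D[ aslot ∙ x ⊟ con 1 ])
          ⨟ vt ≔ D[ aslot ∙ x ⊟ con 1 ])
      else nop)) ⨟ vt ≔ con 0

  weigh = vW ≔ con 0 ⨟ (For vx < vn loop
    (If asel ∙ x then vW ≔ var vW ⊞ W[ x ] else nop))

  keepBest =
    If var vok
      then (If var vW ⊟ var vbest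
        then (vbest ≔ var vW ⨟ (For vx < vn loop (aout [ x ]≔ asel ∙ x)))
        else nop)
      else nop

  advance = If var vgo
    then (If (arad ∙ x ⊟ adig ∙ x) ⊟ con 1
      then (adig [ x ]≔ adig ∙ x ⊞ con 1 ⨟ vgo ≔ con 0)
      else (adig [ x ]≔ con 0))
    else nop

  -- During the loop `vgo` is the carry. A carry out of the last digit means that all vectors have
  -- been seen, so the flag is complemented before it controls the search.
  increment = vgo ≔ con 1 ⨟ (For vx < vK loop advance) ⨟ vgo ≔ con 1 ⊟ var vgo

  check = clear ⨟ vptr ≔ var vL ⨟ readWord ⨟ stages M ≤-refl ⨟ finish ⨟ weigh ⨟ keepBest

  ranks = For vx < vn loop
    ((For vy < vn loop (va ≔ var va ⊞ (con 1 ⊟ (con 1 ⊟ (D[ x ] ⊟ D[ y ])))))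
      ⨟ arank [ x ]≔ var va ⨟ va ≔ con 0)

  countValues = For vx < vn loop
    ((For vy < vx loop (va ≔ var va ⊞ (con 1 ⊟ ((D[ x ] ⊟ D[ y ]) ⊞ (D[ y ] ⊟ D[ x ])))))
      ⨟ vL ≔ var vL ⊞ (con 1 ⊟ var va) ⨟ va ≔ con 0)

  codeRadices : ℕ → Code
  codeRadices zero    = nop
  codeRadices (suc r) = codeRadices r
    ⨟ (For vx < vL loop (arad [ var vptr ⊞ x ]≔ var vL ⊟ x))
    ⨟ vptr ≔ var vptr ⊞ var vL

  radices = (For vx < vL loop (arad [ var vptr ⊞ x ]≔ var vn ⊞ con 1))
    ⨟ vptr ≔ var vptr ⊞ var vL
    ⨟ codeRadices (M ∸ 1)

  search : Code
  search = vgo ≔ con 1 ⨟ (While var vgo loop (check ⨟ increment))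

  prepare : Code
  prepare = vn ≔ aout ∙ con 0 ⨟ aout [ con 0 ]≔ con 0 ⨟ ranks ⨟ countValues ⨟ radices ⨟ vK ≔ var vptr

  algorithm : Code
  algorithm = prepare ⨟ search

  module Phases (input : ℕ → ℕ → ℕ) where
    open Semantics input public
    open Mem

    d w : ℕ → ℕ
    d = input 0
    w = input 1

    p : ℕ → ℕ → ℕ
    p i = input (2 + i)

    For-linear : ∀ {x e P N c n} (g : ℕ → Store) →
      N ≤ n → 1 ≤ n →
      (∀ i k → getV e (setV x k (g i)) ≡ N) →
      (∀ i → i < N → Exec P (setV x i (g i)) (setV x i (g (suc i))) c) →
      Exec (For x < e loop P) (setV x 0 (g 0)) (setV x 0 (g N)) ((21 + c) * n)
    For-linear {c = c} g N≤n 1≤n bound body = weaken (linear c N≤n 1≤n) (For-rule g bound body)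

    module _ {n′ : ℕ} (1≤n : 1 ≤ n′) where

      scale : ∀ {P S S′ c} → Exec P S S′ c → Exec P S S′ (c * n′)
      scale {c = c} = weaken (≤-trans (≤-reflexive (sym (*-identityʳ c))) (*-monoʳ-≤ c 1≤n))

      infixr 4 _▸_
      _▸_ : ∀ {P Q S S′ S″ c c′} → Exec P S S′ (c * n′) → Exec Q S′ S″ (c′ * n′) →
        Exec (P ⨟ Q) S S″ ((c + c′) * n′)
      _▸_ {c = c} {c′} e f = weaken (≤-reflexive (sym (*-distribʳ-+ n′ c c′))) (e ▷ f)

    module _ (s : Mem) (1≤n : 1 ≤ n s) where

      -- 100 is a round bound that covers the body of every innermost loop; with the overhead 21
      -- each such loop is charged 121 per unit of `n`.
      run-clear : Exec clear ⟪ s ⟫ ⟪ record s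
        { slot = fill (slot s) 0 (const 0) (n s)
        ; sel  = fill (sel s) 0 (const 0) (n s)
        ; C    = fill (C s) 1 (const 0) (n s) } ⟫ (121 * n s)
      run-clear = For-linear g ≤-refl 1≤n (λ _ _ → refl)
        (λ i _ → within 100 (Exec-[]≔ ▷ Exec-[]≔ ▷ Exec-[]≔))
        where
        g : ℕ → Store
        g i = ⟪ record s
          { slot = fill (slot s) 0 (const 0) i
          ; sel  = fill (sel s) 0 (const 0) i
          ; C    = fill (C s) 1 (const 0) i } ⟫

      run-weigh : Exec weigh ⟪ s ⟫ ⟪ record s { W = Σ< (n s) (λ j → weightIf (sel s j) (w j)) } ⟫ (221 * n s)
      run-weigh = weaken (*-monoˡ-≤ (n s) (≤ᵇ⇒≤ 124 221 tt)) (_▸_ 1≤n {c = 3} {121} (scale 1≤n Exec-≔)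
        (For-linear g ≤-refl 1≤n (λ _ _ → refl) body))
        where
        g : ℕ → Store
        g i = ⟪ record s { W = Σ< i (λ j → weightIf (sel s j) (w j)) } ⟫
        body : ∀ i → i < n s → Exec (If asel ∙ x then vW ≔ var vW ⊞ W[ x ] else nop)
          (setV vx i (g i)) (setV vx i (g (suc i))) 100
        body i _ with sel s i in eq
        ... | suc _ = within 100 (Exec-true eq Exec-≔)
        ... | zero  = within 100 (Exec-false eq (to
          (cong (λ z → setV vx i ⟪ record s { W = z } ⟫) (sym (+-identityʳ _))) Exec-nop))

      finₛ : ℕ → ℕ × ℕ
      finₛ = fin d (p M) (slot s) (C s)

      run-finish : Exec finish ⟪ s ⟫ ⟪ record s { ok = proj₂ (finₛ (n s)) } ⟫ (221 * n s)
      run-finish = weaken (*-monoˡ-≤ (n s) (≤ᵇ⇒≤ 127 221 tt)) (_▸_ 1≤n {c = 3} {124} (scale 1≤n Exec-≔)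
        (_▸_ 1≤n {c = 121} {3} (For-linear g ≤-refl 1≤n (λ _ _ → refl) body) (scale 1≤n Exec-≔)))
        where
        g : ℕ → Store
        g k = setV vt (proj₁ (finₛ k)) ⟪ record s { ok = proj₂ (finₛ k) } ⟫
        body : ∀ k → k < n s → Exec _ (setV vx k (g k)) (setV vx k (g (suc k))) 100
        body k _ with slot s k in eq
        ... | zero  = within 100 (Exec-false eq Exec-nop)
        -- Execution yields a store phrased with the array entry. `F` abstracts that store over the
        -- entry, so one congruence puts `suc j` in its place.
        ... | suc j = within 100 (Exec-true eq (to (cong F eq) (Exec-≔ ▷ Exec-≔)))
          where
          t = proj₁ (finₛ k)
          F : ℕ → Store
          F u = setV vx k (setV vt (d (u ∸ 1)) ⟪ record s
            { ok = proj₂ (finₛ k) ∸ (((t + (C s u ∸ t)) + p M (u ∸ 1)) ∸ d (u ∸ 1)) } ⟫)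

      module _ (L≤n : L s ≤ n s) where

        wordₛ : ℕ → Triple
        wordₛ = word (rank s) (dig s) (slot s , sel s , q s)

        after-word : ℕ → Mem
        after-word i = record s
          { slot = proj₁ (wordₛ i) ; sel = proj₁ (proj₂ (wordₛ i)) ; q = proj₂ (proj₂ (wordₛ i)) }

        run-readWord : Exec readWord ⟪ s ⟫ ⟪ after-word (L s) ⟫ (121 * n s)
        run-readWord = For-linear (λ i → ⟪ after-word i ⟫) L≤n 1≤n (λ _ _ → refl) body
          where
          body : ∀ i → i < L s → Exec _ (setV vx i ⟪ after-word i ⟫) (setV vx i ⟪ after-word (suc i) ⟫) 100
          body i _ with dig s i in eq
          ... | zero  = within 100 (Exec-false eq Exec-[]≔)
          ... | suc j with proj₁ (wordₛ i) (rank s j) in eq′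
          ...   | suc _ = within 100 (Exec-true eq
                  (Exec-true (trans (cong (λ u → proj₁ (wordₛ i) (rank s (u ∸ 1))) eq) eq′) Exec-[]≔))
          ...   | zero  = within 100 (Exec-true eq
                  (Exec-false (trans (cong (λ u → proj₁ (wordₛ i) (rank s (u ∸ 1))) eq) eq′)
                    (to (cong F eq) (Exec-[]≔ ▷ Exec-[]≔ ▷ Exec-[]≔))))
            where
            F : ℕ → Store
            F u = setV vx i ⟪ record s
              { slot = upd (proj₁ (wordₛ i)) (rank s (u ∸ 1)) u
              ; sel  = upd (proj₁ (proj₂ (wordₛ i))) (u ∸ 1) 1
              ; q    = upd (proj₂ (proj₂ (wordₛ i))) i u } ⟫

        run-process : ∀ {i} (i≤M : i ≤ M) → Exec (process i≤M) ⟪ s ⟫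
          ⟪ record s { C = proj₁ (proc (p i) (q s) (C s) (L s)) } ⟫ (124 * n s)
        run-process {i} i≤M = _▸_ 1≤n {c = 121} {3} (For-linear g L≤n 1≤n (λ _ _ → refl) body) (scale 1≤n Exec-≔)
          where
          procₛ : ℕ → (ℕ → ℕ) × ℕ
          procₛ = proc (p i) (q s) (C s)
          g : ℕ → Store
          g k = setV vt (proj₂ (procₛ k)) ⟪ record s { C = proj₁ (procₛ k) } ⟫
          body : ∀ k → k < L s → Exec _ (setV vx k (g k)) (setV vx k (g (suc k))) 100
          body k _ with q s k in eq
          ... | zero  = within 100 (Exec-false eq Exec-nop)
          ... | suc j = within 100 (Exec-true eq (to (cong F eq) (Exec-≔ ▷ Exec-[]≔)))
            where
            t = proj₂ (procₛ k)
            F : ℕ → Store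
            F u = setV vx k (setV vt ((t + (proj₁ (procₛ k) u ∸ t)) + p i (u ∸ 1)) ⟪ record s
              { C = upd (proj₁ (procₛ k)) u ((t + (proj₁ (procₛ k) u ∸ t)) + p i (u ∸ 1)) } ⟫)

        run-shuffle : Exec shuffle ⟪ s ⟫
          ⟪ record s { q = perm (λ k → dig s (ptr s + k)) (q s) (L s) ; ptr = ptr s + L s } ⟫ (131 * n s)
        -- The assignments to `aq` occur in the order of the two updates in `swap`, so each round
        -- matches `perm` by computation.
        run-shuffle = _▸_ 1≤n {c = 121} {10} (For-linear g L≤n 1≤n (λ _ _ → refl)
            (λ k _ → within 100 (Exec-≔ ▷ Exec-[]≔ ▷ Exec-[]≔ ▷ Exec-≔))) (scale 1≤n (within 10 Exec-≔))
          where
          g : ℕ → Store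
          g k = ⟪ record s { q = perm (λ k → dig s (ptr s + k)) (q s) k } ⟫

stageCost : ℕ → ℕ
stageCost zero    = 1
stageCost (suc i) = stageCost i + (131 + 124)

radixCost : ℕ → ℕ
radixCost zero    = 1
radixCost (suc r) = radixCost r + (121 + 10)

radicesFrom : ℕ → ℕ → (ℕ → ℕ) → ℕ → ℕ → ℕ
radicesFrom L at a zero    = a
radicesFrom L at a (suc r) = fill (radicesFrom L at a r) (at + r * L) (λ k → L ∸ k) L

-- The costs below are per n units of time, prepareCost per n² units.

checkCost : ℕ → ℕ
checkCost M = 121 + (4 + (121 + (stageCost M + (221 + (221 + 200)))))

prepareCost : ℕ → ℕ
prepareCost M = 4 + (4 + (200 + (200 + ((121 + (10 + radixCost (M ∸ 1))) + 4))))

-- Specifications and costs of the composed phases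

module Specifications (M : ℕ) (input : ℕ → ℕ → ℕ) where
  open Algorithm M
  open Phases input
  open Mem

  -- Counts first occurrences of due dates; truncation turns any positive number of earlier
  -- repetitions into a contribution of 0.
  distinctUpTo : ℕ → ℕ
  distinctUpTo i = Σ< i λ j → 1 ∸ Σ< j λ k → eqᵢ (d j) (d k)

  distinctUpTo≤ : ∀ i → distinctUpTo i ≤ i
  distinctUpTo≤ i = ≤-trans (Σ<-mono i (λ j → m∸n≤m 1 (Σ< j λ k → eqᵢ (d j) (d k)))) (≤-reflexive (trans (Σ<-const i 1) (*-identityʳ i)))

  module _ (s : Mem) (1≤n : 1 ≤ n s) where

    improved : Mem
    improved = record s { best = W s ; out = fill (out s) 0 (sel s) (n s) }

    -- The resulting store depends on the outcome, so each case comes with the fact the search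
    -- needs: the candidate cannot improve on the best weight, or it passed the check and is at
    -- least as good.
    RecordRun : Set
    RecordRun = (Exec keepBest ⟪ s ⟫ ⟪ s ⟫ (200 * n s) × (ok s ≡ 0 ⊎ W s ≤ best s)) ⊎
                (Exec keepBest ⟪ s ⟫ ⟪ improved ⟫ (200 * n s) × ok s ≢ 0 × best s ≤ W s)

    run-record : RecordRun
    run-record = by-ok (ok s) refl
      where
      arith : 13 + 121 * n s ≤ 200 * n s
      arith = ≤-trans (+-monoˡ-≤ (121 * n s) (≤-trans (≤-reflexive (sym (*-identityʳ 13))) (*-monoʳ-≤ 13 1≤n)))
        (≤-trans (≤-reflexive (sym (*-distribʳ-+ (n s) 13 121))) (*-monoˡ-≤ (n s) (≤ᵇ⇒≤ 134 200 tt)))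
      by-weight : ∀ {k} → ok s ≡ suc k → ∀ l → W s ∸ best s ≡ l → RecordRun
      by-weight eq zero eq′ = inj₁ (weaken (*-monoˡ-≤ (n s) (≤ᵇ⇒≤ 10 200 tt))
              (scale 1≤n (Exec-true eq (Exec-false eq′ Exec-nop))) , inj₂ (m∸n≡0⇒m≤n eq′))
      by-weight eq (suc _) eq′ = inj₂ (weaken arith (Exec-true eq (Exec-true eq′
              (Exec-≔ ▷ For-linear {c = 100} (λ i → ⟪ record s { best = W s ; out = fill (out s) 0 (sel s) i } ⟫)
                 ≤-refl 1≤n (λ _ _ → refl) (λ i _ → within 100 Exec-[]≔)))) ,
              (λ z → 0≢1+n (trans (sym z) eq)) ,
              <⇒≤ (m∸n≢0⇒n<m (λ z → 0≢1+n (trans (sym z) eq′))))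
      by-ok : ∀ k → ok s ≡ k → RecordRun
      by-ok zero    eq = inj₁ (weaken (*-monoˡ-≤ (n s) (≤ᵇ⇒≤ 4 200 tt)) (scale 1≤n (Exec-false eq Exec-nop)) , inj₁ eq)
      by-ok (suc k) eq = by-weight eq (W s ∸ best s) refl

    module _ (L≤n : L s ≤ n s) where

      -- After `i` machines only `i ∸ 1` codes have been consumed. The truncation at `i = 0` is why
      -- the execution proof treats 0, 1 and larger values separately.
      staged : ℕ → Mem
      staged i = record s
        { q   = order (L s) (dig s) (q s) (i ∸ 1)
        ; C   = completions p (L s) (dig s) (q s) (C s) i
        ; ptr = L s + (i ∸ 1) * L s }

      run-stages : ptr s ≡ L s → ∀ i (i≤M : i ≤ M) →
        Exec (stages i i≤M) ⟪ s ⟫ ⟪ staged i ⟫ (stageCost i * n s)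
      run-stages eq zero i≤M = scale 1≤n (to
        (cong (λ z → ⟪ record s { ptr = z } ⟫) (trans eq (sym (+-identityʳ (L s))))) Exec-nop)
      run-stages eq (suc zero) i<M = _▸_ 1≤n {c = 1} {131 + 124} (run-stages eq 0 (<⇒≤ i<M))
        (_▸_ 1≤n {c = 131} {124} (weaken (*-monoˡ-≤ (n s) (≤ᵇ⇒≤ 1 131 tt)) (scale 1≤n Exec-nop))
          (run-process (staged 0) 1≤n L≤n (<⇒≤ i<M)))
      run-stages eq (suc (suc i)) i<M = _▸_ 1≤n {c = stageCost (suc i)} {131 + 124} (run-stages eq (suc i) (<⇒≤ i<M))
        (_▸_ 1≤n {c = 131} {124}
          (to (cong (λ z → ⟪ record (staged (suc i)) { q = order (L s) (dig s) (q s) (suc i) ; ptr = z } ⟫)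
                (trans (+-assoc (L s) (i * L s) (L s)) (cong (L s +_) (+-comm (i * L s) (L s)))))
              (run-shuffle (staged (suc i)) 1≤n L≤n))
          (run-process (record (staged (suc i)) { q = order (L s) (dig s) (q s) (suc i) ; ptr = L s + suc i * L s })
            1≤n L≤n (<⇒≤ i<M)))

  module _ (s : Mem) (1≤n : 1 ≤ n s) (L≤n : L s ≤ n s) where

    cleared wordRead staged′ checked : Mem
    cleared = record s
      { slot = fill (slot s) 0 (const 0) (n s)
      ; sel  = fill (sel s) 0 (const 0) (n s)
      ; C    = fill (C s) 1 (const 0) (n s)
      ; ptr  = L s }
    wordRead = after-word cleared 1≤n L≤n (L s)
    staged′  = staged wordRead 1≤n L≤n M
    checked  = record staged′
      { ok = proj₂ (fin d (p M) (slot staged′) (C staged′) (n s))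
      ; W  = Σ< (n s) (λ j → weightIf (sel staged′ j) (w j)) }

    run-check : ∀ {S} → Exec keepBest ⟪ checked ⟫ S (200 * n s) → Exec check ⟪ s ⟫ S (checkCost M * n s)
    run-check {S} r =
      _▸_ 1≤n {c = 121} {4 + (121 + (stageCost M + (221 + (221 + 200))))} (run-clear s 1≤n)
      (_▸_ 1≤n {c = 4} {121 + (stageCost M + (221 + (221 + 200)))} (scale 1≤n Exec-≔)
      (_▸_ 1≤n {c = 121} {stageCost M + (221 + (221 + 200))} (run-readWord cleared 1≤n L≤n)
      (_▸_ 1≤n {c = stageCost M} {221 + (221 + 200)} (run-stages wordRead 1≤n L≤n refl M ≤-refl)
      (_▸_ 1≤n {c = 221} {221 + 200} (run-finish staged′ 1≤n)
      (_▸_ 1≤n {c = 221} {200} (run-weigh (record staged′ { ok = ok checked }) 1≤n) r)))))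

  module _ (s : Mem) {b : ℕ} (1≤b : 1 ≤ b) (K≤b : K s ≤ b) where

    run-increment : Exec increment ⟪ s ⟫
      ⟪ record s { dig = proj₁ (inc (rad s) (dig s) (K s)) ; go = 1 ∸ proj₂ (inc (rad s) (dig s) (K s)) } ⟫ (150 * b)
    run-increment = weaken (*-monoˡ-≤ b (≤ᵇ⇒≤ 130 150 tt)) (_▸_ 1≤b {c = 3} {127} (scale 1≤b Exec-≔)
      (_▸_ 1≤b {c = 121} {6} (For-linear {c = 100} g K≤b 1≤b (λ _ _ → refl) (λ i _ → body i)) (scale 1≤b Exec-≔)))
      where
      incₛ : ℕ → (ℕ → ℕ) × ℕ
      incₛ = inc (rad s) (dig s)
      g : ℕ → Store
      g i = ⟪ record s { dig = proj₁ (incₛ i) ; go = proj₂ (incₛ i) } ⟫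
      g′ : (ℕ → ℕ) × ℕ → Store
      g′ (D , c) = ⟪ record s { dig = D ; go = c } ⟫
      by-digit : ∀ i {c} → proj₂ (incₛ i) ≡ suc c → ∀ e → (rad s i ∸ proj₁ (incₛ i) i) ∸ 1 ≡ e →
        Exec advance (setV vx i (g i)) (setV vx i (g′ (icase i e (incₛ i)))) 100
      by-digit i eq zero    eq′ = within 100 (Exec-true eq (Exec-false eq′ Exec-[]≔))
      by-digit i eq (suc _) eq′ = within 100 (Exec-true eq (Exec-true eq′ (Exec-[]≔ ▷ Exec-≔)))
      by-carry : ∀ i c → proj₂ (incₛ i) ≡ c →
        Exec advance (setV vx i (g i)) (setV vx i (g′ (istep (rad s) i c (incₛ i)))) 100
      by-carry i zero    eq = within 100 (Exec-false eq Exec-nop)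
      by-carry i (suc _) eq = by-digit i eq _ refl
      body : ∀ i → Exec advance (setV vx i (g i)) (setV vx i (g (suc i))) 100
      body i = by-carry i (proj₂ (incₛ i)) refl

  module _ (s : Mem) (1≤n : 1 ≤ n s) where

    quadratic : ∀ c → n s * (12 + c * n s) + 9 ≤ (21 + c) * (n s * n s)
    quadratic c = begin
      n s * (12 + c * n s) + 9            ≤⟨ linear (c * n s) ≤-refl 1≤n ⟩
      (21 + c * n s) * n s                ≤⟨ *-monoˡ-≤ (n s) (+-monoˡ-≤ (c * n s) (≤-trans (≤-reflexive (sym (*-identityʳ 21))) (*-monoʳ-≤ 21 1≤n))) ⟩
      (21 * n s + c * n s) * n s          ≡⟨ cong (_* n s) (*-distribʳ-+ (n s) 21 c) ⟨
      (21 + c) * n s * n s                ≡⟨ *-assoc (21 + c) (n s) (n s) ⟩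
      (21 + c) * (n s * n s)              ∎
      where open ≤-Reasoning

    run-ranks : Exec ranks ⟪ s ⟫ ⟪ record s { rank = fill (rank s) 0 (Rank.rank (n s) d) (n s) } ⟫ (200 * (n s * n s))
    run-ranks = weaken (≤-trans (quadratic 130) (*-monoˡ-≤ (n s * n s) (≤ᵇ⇒≤ 151 200 tt)))
      (For-rule h (λ _ _ → refl) body)
      where
      h : ℕ → Store
      h i = ⟪ record s { rank = fill (rank s) 0 (Rank.rank (n s) d) i } ⟫
      g : ℕ → ℕ → Store
      g i k = setV vx i (setV va (Σ< k λ l → lt (d l) (d i)) ⟪ record s { rank = fill (rank s) 0 (Rank.rank (n s) d) i } ⟫)
      body : ∀ i → i < n s → Exec _ (setV vx i (h i)) (setV vx i (h (suc i))) (130 * n s)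
      body i _ = weaken (*-monoˡ-≤ (n s) (≤ᵇ⇒≤ 129 130 tt)) (_▸_ 1≤n {c = 121} {8}
        (For-linear {c = 100} (g i) ≤-refl 1≤n (λ _ _ → refl) (λ k _ → within 100 Exec-≔))
        (scale 1≤n (Exec-[]≔ ▷ Exec-≔)))

    run-distinct : L s ≡ 0 → Exec countValues ⟪ s ⟫ ⟪ record s { L = distinctUpTo (n s) } ⟫ (200 * (n s * n s))
    run-distinct L≡0 = from L≡0 (weaken (≤-trans (quadratic 140) (*-monoˡ-≤ (n s * n s) (≤ᵇ⇒≤ 161 200 tt)))
      (For-rule h (λ _ _ → refl) body))
      where
      h : ℕ → Store
      h i = ⟪ record s { L = distinctUpTo i } ⟫
      from : ∀ {z S c} → z ≡ 0 → Exec countValues ⟪ record s { L = 0 } ⟫ S c → Exec countValues ⟪ record s { L = z } ⟫ S c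
      from refl e = e
      g : ℕ → ℕ → Store
      g i k = setV vx i (setV va (Σ< k λ l → eqᵢ (d i) (d l)) ⟪ record s { L = distinctUpTo i } ⟫)
      body : ∀ i → i < n s → Exec _ (setV vx i (h i)) (setV vx i (h (suc i))) (140 * n s)
      body i i<n = weaken (*-monoˡ-≤ (n s) (≤ᵇ⇒≤ 134 140 tt)) (_▸_ 1≤n {c = 121} {13}
        (For-linear {c = 100} (g i) (<⇒≤ i<n) 1≤n (λ _ _ → refl) (λ k _ → within 100 Exec-≔))
        (scale 1≤n (within 13 (Exec-≔ ▷ Exec-≔))))

    module _ (L≤n : L s ≤ n s) where

      run-codeRadices : ∀ r → Exec (codeRadices r) ⟪ s ⟫
        ⟪ record s { rad = radicesFrom (L s) (ptr s) (rad s) r ; ptr = ptr s + r * L s } ⟫ (radixCost r * n s)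
      run-codeRadices zero = scale 1≤n (to
        (cong (λ z → ⟪ record s { ptr = z } ⟫) (sym (+-identityʳ (ptr s)))) Exec-nop)
      run-codeRadices (suc r) = _▸_ 1≤n {c = radixCost r} {131} (run-codeRadices r)
        (to (cong (λ z → ⟪ record s { rad = radicesFrom (L s) (ptr s) (rad s) (suc r) ; ptr = z } ⟫)
              (trans (+-assoc (ptr s) (r * L s) (L s)) (cong (ptr s +_) (+-comm (r * L s) (L s)))))
        (_▸_ 1≤n {c = 121} {10} (For-linear {c = 100}
          (λ i → ⟪ record s { rad = fill (radicesFrom (L s) (ptr s) (rad s) r) (ptr s + r * L s) (λ k → L s ∸ k) i
                            ; ptr = ptr s + r * L s } ⟫)
          L≤n 1≤n (λ _ _ → refl) (λ i _ → within 100 Exec-[]≔)) (scale 1≤n (within 10 Exec-≔))))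

-- Mixed radix numerals

Π< : ℕ → (ℕ → ℕ) → ℕ
Π< zero    f = 1
Π< (suc n) f = Π< n f * f n

val : (ℕ → ℕ) → ℕ → (ℕ → ℕ) → ℕ
val r zero    D = 0
val r (suc k) D = val r k D + D k * Π< k r

Valid : (ℕ → ℕ) → ℕ → (ℕ → ℕ) → Set
Valid r K D = ∀ i → i < K → D i < r i

val-cong : ∀ r k {D D′} → (∀ i → i < k → D i ≡ D′ i) → val r k D ≡ val r k D′
val-cong r zero    eq = refl
val-cong r (suc k) eq = cong₂ (λ a b → a + b * Π< k r)
  (val-cong r k (λ i i<k → eq i (m<n⇒m<1+n i<k))) (eq k ≤-refl)

Valid-pred : ∀ {r k D} → Valid r (suc k) D → Valid r k D
Valid-pred v i i<k = v i (m<n⇒m<1+n i<k)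

val< : ∀ r k {D} → Valid r k D → val r k D < Π< k r
val< r zero    v = s≤s z≤n
val< r (suc k) {D} v = begin-strict
  val r k D + D k * Π< k r   <⟨ +-monoˡ-< (D k * Π< k r) (val< r k (Valid-pred {r} {k} {D} v)) ⟩
  Π< k r + D k * Π< k r      ≤⟨ *-monoˡ-≤ (Π< k r) (v k ≤-refl) ⟩
  r k * Π< k r               ≡⟨ *-comm (r k) (Π< k r) ⟩
  Π< k r * r k               ∎
  where open ≤-Reasoning

digit-unique : ∀ {P a b x y} → a < P → b < P → a + x * P ≡ b + y * P → a ≡ b × x ≡ y
digit-unique {P} {a} {b} {zero} {zero} a< b< eq =
  trans (sym (+-identityʳ a)) (trans eq (+-identityʳ b)) , refl
digit-unique {P} {a} {b} {zero} {suc y} a< b< eq =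
  contradiction (≤-trans (m≤m+n P (y * P)) (≤-trans (m≤n+m (P + y * P) b)
    (≤-reflexive (trans (sym eq) (+-identityʳ a))))) (<⇒≱ a<)
digit-unique {P} {a} {b} {suc x} {zero} a< b< eq =
  contradiction (≤-trans (m≤m+n P (x * P)) (≤-trans (m≤n+m (P + x * P) a)
    (≤-reflexive (trans eq (+-identityʳ b))))) (<⇒≱ b<)
digit-unique {P} {a} {b} {suc x} {suc y} a< b< eq
  with digit-unique {P} {a} {b} {x} {y} a< b< (+-cancelˡ-≡ P _ _
         (trans (shift a x) (trans eq (sym (shift b y)))))
  where
  shift : ∀ a x → P + (a + x * P) ≡ a + (P + x * P)
  shift a x = trans (sym (+-assoc P a (x * P))) (trans (cong (_+ x * P) (+-comm P a)) (+-assoc a P (x * P)))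
... | a≡b , x≡y = a≡b , cong suc x≡y

val-injective : ∀ r k {D D′} → Valid r k D → Valid r k D′ → val r k D ≡ val r k D′ →
  ∀ i → i < k → D i ≡ D′ i
val-injective r (suc k) {D} {D′} v v′ eq i i<
  with digit-unique {Π< k r} {val r k D} {val r k D′} {D k} {D′ k}
         (val< r k (Valid-pred {r} {k} {D} v)) (val< r k (Valid-pred {r} {k} {D′} v′)) eq
... | eq₁ , eq₂ with <-suc-split i<
...   | inj₁ i<k  = val-injective r k (Valid-pred {r} {k} {D} v) (Valid-pred {r} {k} {D′} v′) eq₁ i i<k
...   | inj₂ refl = eq₂

-- The carry is worth one unit of the place `Π< x r`. For the whole vector it is therefore worth the
-- total number of vectors, which makes it the signal for overflow.
record Inc (r D : ℕ → ℕ) (x : ℕ) (R : (ℕ → ℕ) × ℕ) : Set where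
  field
    value  : val r x (proj₁ R) + proj₂ R * Π< x r ≡ suc (val r x D)
    carry≤ : proj₂ R ≤ 1
    valid  : Valid r x (proj₁ R)
    rest   : ∀ i → x ≤ i → proj₁ R i ≡ D i

inc-spec : ∀ r D K → Valid r K D → ∀ x → x ≤ K → Inc r D x (inc r D x)
inc-spec r D K v zero    x≤K = record { value = refl ; carry≤ = ≤-refl ; valid = λ _ () ; rest = λ _ _ → refl }
inc-spec r D K v (suc x) x<K with inc r D x | inc-spec r D K v x (<⇒≤ x<K)
... | D′ , zero | ih = record
  { value  = begin
      val r x D′ + D′ x * Π< x r + 0     ≡⟨ +-identityʳ _ ⟩
      val r x D′ + D′ x * Π< x r         ≡⟨ cong₂ (λ a b → a + b * Π< x r) (sym (+-identityʳ _)) (rest x ≤-refl) ⟩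
      val r x D′ + 0 + D x * Π< x r      ≡⟨ cong (_+ D x * Π< x r) value ⟩
      suc (val r x D + D x * Π< x r)     ∎
  ; carry≤ = z≤n
  ; valid  = λ i i< → valid′ i (<-suc-split i<)
  ; rest   = λ i x<i → rest i (<⇒≤ x<i)
  }
  where
  open Inc ih
  open ≡-Reasoning
  valid′ : ∀ i → i < x ⊎ i ≡ x → D′ i < r i
  valid′ i (inj₁ i<x)  = valid i i<x
  valid′ i (inj₂ refl) = subst (_< r x) (sym (rest x ≤-refl)) (v x x<K)
... | D′ , suc (suc _) | ih = contradiction (Inc.carry≤ ih) (λ { (s≤s ()) })
... | D′ , suc zero | ih with (r x ∸ D′ x) ∸ 1 in eq
...   | zero = record
  { value  = begin
      val r x (upd D′ x 0) + upd D′ x 0 x * P + 1 * (P * r x)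
        ≡⟨ cong₂ (λ a b → a + b * P + 1 * (P * r x)) (below 0) (upd-same D′ x 0) ⟩
      val r x D′ + 0 + 1 * (P * r x)     ≡⟨ cong₂ _+_ (+-identityʳ _) (trans (*-identityˡ _) (*-comm P (r x))) ⟩
      val r x D′ + r x * P               ≡⟨ cong (λ z → val r x D′ + z * P) rx ⟩
      val r x D′ + (P + D x * P)         ≡⟨ cong (λ z → val r x D′ + (z + D x * P)) (*-identityˡ P) ⟨
      val r x D′ + (1 * P + D x * P)     ≡⟨ +-assoc (val r x D′) (1 * P) (D x * P) ⟨
      val r x D′ + 1 * P + D x * P       ≡⟨ cong (_+ D x * P) value ⟩
      suc (val r x D + D x * P)          ∎
  ; carry≤ = ≤-refl
  ; valid  = λ i i< → valid′ i (<-suc-split i<)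
  ; rest   = λ i x<i → trans (upd-other D′ 0 (<⇒≢ x<i)) (rest i (<⇒≤ x<i))
  }
  where
  open Inc ih
  open ≡-Reasoning
  P = Π< x r
  below : ∀ c → val r x (upd D′ x c) ≡ val r x D′
  below c = val-cong r x (λ i i<x → upd-other D′ c (>⇒≢ i<x))
  rx : r x ≡ suc (D x)
  rx = ≤-antisym
    (≤-trans (m∸n≡0⇒m≤n (trans (sym (∸-+-assoc (r x) (D′ x) 1)) eq))
             (≤-reflexive (trans (+-comm (D′ x) 1) (cong suc (rest x ≤-refl)))))
    (v x x<K)
  valid′ : ∀ i → i < x ⊎ i ≡ x → upd D′ x 0 i < r i
  valid′ i (inj₁ i<x)  = subst (_< r i) (sym (upd-other D′ 0 (>⇒≢ i<x))) (valid i i<x)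
  valid′ i (inj₂ refl) = subst (_< r x) (sym (upd-same D′ x 0)) (≤-<-trans z≤n (v x x<K))
...   | suc e = record
  { value  = begin
      val r x (upd D′ x c) + upd D′ x c x * P + 0
        ≡⟨ +-identityʳ _ ⟩
      val r x (upd D′ x c) + upd D′ x c x * P
        ≡⟨ cong₂ (λ a b → a + b * P) (below c) (trans (upd-same D′ x c) c≡) ⟩
      val r x D′ + (P + D x * P)         ≡⟨ cong (λ z → val r x D′ + (z + D x * P)) (*-identityˡ P) ⟨
      val r x D′ + (1 * P + D x * P)     ≡⟨ +-assoc (val r x D′) (1 * P) (D x * P) ⟨
      val r x D′ + 1 * P + D x * P       ≡⟨ cong (_+ D x * P) value ⟩
      suc (val r x D + D x * P)          ∎
  ; carry≤ = z≤n
  ; valid  = λ i i< → valid′ i (<-suc-split i<)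
  ; rest   = λ i x<i → trans (upd-other D′ c (<⇒≢ x<i)) (rest i (<⇒≤ x<i))
  }
  where
  open Inc ih
  open ≡-Reasoning
  P = Π< x r
  c = D′ x + 1
  c≡ : c ≡ suc (D x)
  c≡ = trans (+-comm (D′ x) 1) (cong suc (rest x ≤-refl))
  below : ∀ c → val r x (upd D′ x c) ≡ val r x D′
  below c = val-cong r x (λ i i<x → upd-other D′ c (>⇒≢ i<x))
  c<r : c < r x
  c<r = ≰⇒> (λ r≤c → 0≢1+n (trans (sym (m≤n⇒m∸n≡0 r≤c)) (trans (sym (∸-+-assoc (r x) (D′ x) 1)) eq)))
  valid′ : ∀ i → i < x ⊎ i ≡ x → upd D′ x c i < r i
  valid′ i (inj₁ i<x)  = subst (_< r i) (sym (upd-other D′ c (>⇒≢ i<x))) (valid i i<x)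
  valid′ i (inj₂ refl) = subst (_< r x) (sym (upd-same D′ x c)) c<r

Π<-cong : ∀ n {f g : ℕ → ℕ} → (∀ k → k < n → f k ≡ g k) → Π< n f ≡ Π< n g
Π<-cong zero    eq = refl
Π<-cong (suc n) eq = cong₂ _*_ (Π<-cong n (λ k k<n → eq k (m<n⇒m<1+n k<n))) (eq n ≤-refl)

Π<-+ : ∀ a b f → Π< (a + b) f ≡ Π< a f * Π< b (λ k → f (a + k))
Π<-+ a zero    f rewrite +-identityʳ a = sym (*-identityʳ _)
Π<-+ a (suc b) f rewrite +-suc a b | Π<-+ a b f = *-assoc (Π< a f) _ (f (a + b))

Π<-front : ∀ n f → Π< (suc n) f ≡ f 0 * Π< n (f ∘ suc)
Π<-front n f = trans (Π<-+ 1 n f) (cong (_* Π< n (f ∘ suc)) (*-identityˡ (f 0)))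

Π<-const : ∀ n c → Π< n (const c) ≡ c ^ n
Π<-const zero    c = refl
Π<-const (suc n) c = trans (cong (_* c) (Π<-const n c)) (*-comm (c ^ n) c)

Π<-falling : ∀ L → Π< L (λ s → L ∸ s) ≡ L !
Π<-falling zero    = refl
Π<-falling (suc L) = trans (Π<-front L (λ s → suc L ∸ s)) (cong (suc L *_) (Π<-falling L))

Π<-sections : ∀ L (c : ℕ → ℕ) r g → (∀ i s → i < r → s < L → g (i * L + s) ≡ c s) →
  Π< (r * L) g ≡ Π< L c ^ r
Π<-sections L c zero    g eq = refl
Π<-sections L c (suc r) g eq = trans (Π<-+ L (r * L) g) (cong₂ _*_
  (Π<-cong L (λ k → eq 0 k z<s))
  (Π<-sections L c r (λ k → g (L + k))
    (λ i s i<r s<L → trans (cong g (sym (+-assoc L (i * L) s))) (eq (suc i) s (s<s i<r) s<L))))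

order-digits-cong : ∀ {L M δ δ′} a →
  (∀ i → suc i < M → ∀ s → s < L → section L δ (suc i) s ≡ section L δ′ (suc i) s) →
  ∀ i → i < M → order L δ a i ≡ order L δ′ a i
order-digits-cong a eq zero    i<M = refl
order-digits-cong {L} {M} {δ} {δ′} a eq (suc i) i<M = trans
  (cong (λ b → perm (section L δ (suc i)) b L) (order-digits-cong {L} {M} {δ} {δ′} a eq i (<⇒≤ i<M)))
  (perm-cong (order L δ′ a i) L (eq i i<M))

-- Exhaustive search over the digit vectors

module Searching (M : ℕ) (input : ℕ → ℕ → ℕ) where
  open Algorithm M
  open Phases input
  open Specifications M input
  open Mem

  -- n, L, K, rank and rad are constant during the search.
  module Loop (b : Mem) (1≤n : 1 ≤ n b) (L≤n : L b ≤ n b) (1≤L : 1 ≤ L b)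
    (ranked : IsRank (n b) d (rank b))
    (K≡ : K b ≡ suc (M ∸ 1) * L b)
    (rad-word : ∀ s → s < L b → rad b s ≡ suc (n b))
    (rad-code : ∀ i s → suc i < M → s < L b → rad b (suc i * L b + s) ≡ L b ∸ s)
    (positive : ∀ i j → i ≤ M → j < n b → 0 < p i j) where

    open Check (n b) (L b) M d p public

    -- Constancy is imposed by overwriting the fields instead of being carried as equations, so it
    -- holds by computation.
    pin : Mem → Mem
    pin v = record v { n = n b ; L = L b ; K = K b ; rank = rank b ; rad = rad b }

    total : (ℕ → ℕ) → ℕ
    total e = Σ< (n b) λ j → weightIf (e j) (w j)

    Indicates : (ℕ → ℕ) → (ℕ → Set) → Set
    Indicates e E = ∀ j → j < n b → (e j ≡ 0 × ¬ E j) ⊎ (e j ≡ 1 × E j)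

    record Achieved (β : ℕ) (o : ℕ → ℕ) : Set where
      field
        binary   : ∀ j → j < n b → o j ≡ 0 ⊎ o j ≡ 1
        times    : ℕ → ℕ → ℕ
        schedule : Schedule (λ j → o j ≡ 1) times
        value    : β ≡ total o

    -- The upper half of the loop invariant: schedules whose vector has a numeral below `N` are
    -- dominated. Together with `Achieved`, which says that the best weight is attained, it gives
    -- optimality once `N` reaches `vectors`.
    Covered : ℕ → ℕ → Set₁
    Covered N β = ∀ E x δ e → Schedule E x → Good E x δ → Valid (rad b) (K b) δ →
      val (rad b) (K b) δ < N → Indicates e E → total e ≤ β

    Indicates-unique : ∀ {e e′ E} → Indicates e E → Indicates e′ E → ∀ j → j < n b → e j ≡ e′ j
    Indicates-unique f g j j<n with f j j<n | g j j<n
    ... | inj₁ (p , _)  | inj₁ (q , _)  = trans p (sym q)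
    ... | inj₂ (p , _)  | inj₂ (q , _)  = trans p (sym q)
    ... | inj₁ (_ , ¬E) | inj₂ (_ , E)  = contradiction E ¬E
    ... | inj₂ (_ , E)  | inj₁ (_ , ¬E) = contradiction E ¬E

    total-cong : ∀ {e e′} → (∀ j → j < n b → e j ≡ e′ j) → total e ≡ total e′
    total-cong eq = Σ<-cong (n b) (λ j j<n → cong (λ z → weightIf z (w j)) (eq j j<n))

    Schedule-anti : ∀ {E E′ x} → (∀ j → j < n b → E′ j → E j) → Schedule E x → Schedule E′ x
    Schedule-anti f S = record
      { flow     = λ i j i<M j<n e → flow i j i<M j<n (f j j<n e)
      ; disjoint = λ i j k i≤M j<n k<n e e′ → disjoint i j k i≤M j<n k<n (f j j<n e) (f k k<n e′)
      ; jit      = λ j j<n e → jit j j<n (f j j<n e)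
      }
      where open Schedule S

    section<K : ∀ i s → suc i < M → s < L b → suc i * L b + s < K b
    section<K i s i<M s<L = begin-strict
      suc i * L b + s         <⟨ +-monoʳ-< (suc i * L b) s<L ⟩
      suc i * L b + L b       ≡⟨ +-comm (suc i * L b) (L b) ⟩
      suc (suc i) * L b       ≤⟨ *-monoˡ-≤ (L b) (s≤s (∸-monoˡ-≤ 1 i<M)) ⟩
      suc (M ∸ 1) * L b       ≡⟨ K≡ ⟨
      K b                     ∎
      where open ≤-Reasoning

    L≤K : L b ≤ K b
    L≤K = subst (L b ≤_) (sym K≡) (m≤m+n (L b) _)

    valid-codes : ∀ {δ} → Valid (rad b) (K b) δ → Codes δ
    valid-codes v i i<M s s<L = subst (_ <_) (rad-code i s i<M s<L) (v _ (section<K i s i<M s<L))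

    -- Division by `L` locates the block of a digit: the radix `suc n` of the first block admits a
    -- blank and every job, and the radix in a later block is the range of an offset.
    codes-valid : ∀ {δ} → (∀ s → s < L b → δ s ≤ n b) → Codes δ → Valid (rad b) (K b) δ
    codes-valid {δ} δ≤n codes k k<K = subst (λ z → δ z < rad b z) (sym k≡) (by-section (k / L b) refl)
      where
      instance
        L≢0 : NonZero (L b)
        L≢0 = >-nonZero 1≤L
      k≡ : k ≡ (k / L b) * L b + k % L b
      k≡ = trans (m≡m%n+[m/n]*n k (L b)) (+-comm (k % L b) _)
      s<L : k % L b < L b
      s<L = m%n<n k (L b)
      i< : k / L b < suc (M ∸ 1)
      i< = m<n*o⇒m/o<n (subst (k <_) K≡ k<K)
      by-section : ∀ i → k / L b ≡ i → δ (k / L b * L b + k % L b) < rad b (k / L b * L b + k % L b)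
      by-section zero eq rewrite eq = subst (δ (k % L b) <_) (sym (rad-word _ s<L)) (s≤s (δ≤n _ s<L))
      by-section (suc i) eq rewrite eq =
        subst (δ (suc i * L b + k % L b) <_) (sym (rad-code i _ i<M s<L)) (codes i i<M _ s<L)
        where
        i<M : suc i < M
        i<M = pred-cancel M (subst (_< suc (M ∸ 1)) eq i<)
          where
          -- `suc (M ∸ 1)` is `M` only for positive `M`; for `M = 0` the word is the single block.
          pred-cancel : ∀ M → suc i < suc (M ∸ 1) → suc i < M
          pred-cancel zero    (s≤s ())
          pred-cancel (suc M) h = h

    -- Equal numerals give equal digits only below `K`. These digits determine the listing and all
    -- orders, so the vector in memory can stand in for the one built from a schedule.
    Good-cong : ∀ {E x δ δ′} → (∀ k → k < K b → δ k ≡ δ′ k) → Good E x δ′ → Good E x δ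
    Good-cong {x = x} {δ} {δ′} eq g = record
      { listing = Listing-cong start (Good.listing g)
      ; codes   = λ i i<M s s<L → subst (_< L b ∸ s) (sym (later i i<M s s<L)) (Good.codes g i i<M s s<L)
      ; sorted  = λ i i<M → Sorted-cong {κ = key (x i)}
          (λ k k<L → trans (cong (λ a → a k) (order-digits-cong {L b} {M} {δ} {δ′} δ later i i<M))
                           (order-cong (Good.codes g) start i i<M k k<L))
          (Good.sorted g i i<M)
      }
      where
      start : ∀ k → k < L b → δ k ≡ δ′ k
      start k k<L = eq k (<-≤-trans k<L L≤K)
      later : ∀ i → suc i < M → ∀ s → s < L b → section (L b) δ (suc i) s ≡ section (L b) δ′ (suc i) s
      later i i<M s s<L = eq _ (section<K i s i<M s<L)

    record CheckResult (v v′ : Mem) : Set₁ where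
      field
        ran      : Exec check ⟪ pin v ⟫ ⟪ pin v′ ⟫ (checkCost M * n b)
        same     : dig v′ ≡ dig v
        better   : best v ≤ best v′
        achieved : Achieved (best v′) (out v′)
        covers   : ∀ E x e → Schedule E x → Good E x (dig v) → Indicates e E → total e ≤ best v′

    check-result : ∀ v → Codes (dig v) → Achieved (best v) (out v) → ∃[ v′ ] CheckResult v v′
    check-result v codes ach = by-case (run-record cs 1≤n)
      where
      s cs : Mem
      s  = pin v
      cs = checked s 1≤n L≤n

      W₀ : Triple
      W₀ = fill (slot v) 0 (const 0) (n b) , fill (sel v) 0 (const 0) (n b) , q v

      C₀ : ℕ → ℕ
      C₀ = fill (C v) 1 (const 0) (n b)

      module R = Run (rank b) ranked (dig v) W₀ C₀

      zeroed : ∀ a j → j < n b → fill a 0 (const 0) (n b) j ≡ 0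
      zeroed a j j<n = fill-in a 0 (const 0) (n b) j<n

      module Complete {E} {x} (S : Schedule E x) (good : Good E x (dig v)) =
        R.Completeness positive S good (zeroed (slot v)) (zeroed (sel v))
          (λ j j<n → fill-in (C v) 1 (const 0) (n b) j<n)

      -- A good vector selects exactly its set `E`, so every schedule that fits the current vector
      -- has the weight just computed.
      total≡W : ∀ {E x e} → Schedule E x → Good E x (dig v) → Indicates e E → total e ≡ W cs
      total≡W S good ind = total-cong (Indicates-unique ind (Complete.selected S good))

      by-case : RecordRun cs 1≤n → ∃[ v′ ] CheckResult v v′
      by-case (inj₁ (e , why)) = record cs { best = best v ; out = out v } , record
        { ran      = run-check s 1≤n L≤n e
        ; same     = refl
        ; better   = ≤-refl
        ; achieved = ach
        ; covers   = λ E x e S good ind → ≤-trans (≤-reflexive (total≡W S good ind)) (bound S good why)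
        }
        where
        bound : ∀ {E x} → Schedule E x → Good E x (dig v) → ok cs ≡ 0 ⊎ W cs ≤ best v → W cs ≤ best v
        -- A vector that fits a schedule passes the check, so a cleared flag cannot occur here.
        bound S good (inj₁ z) = contradiction (trans (sym z) (Complete.accepts S good)) 0≢1+n
        bound S good (inj₂ h) = h
      by-case (inj₂ (e , ok≢0 , h)) = improved cs 1≤n , record
        { ran      = run-check s 1≤n L≤n e
        ; same     = refl
        ; better   = h
        ; achieved = record
          { binary   = binary
          ; times    = S.x
          ; schedule = Schedule-anti (λ j j<n o≡1 → trans (sym (out≡ j j<n)) o≡1) S.schedule
          ; value    = total-cong (λ j j<n → sym (out≡ j j<n))
          }
        ; covers   = λ E x e S good ind → ≤-reflexive (total≡W S good ind)
        }
        where
        module S = R.Soundness (zeroed (sel v)) codes ok≢0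
        out≡ : ∀ j → j < n b → fill (out v) 0 (sel cs) (n b) j ≡ sel cs j
        out≡ j j<n = fill-in (out v) 0 (sel cs) (n b) j<n
        binary : ∀ j → j < n b → fill (out v) 0 (sel cs) (n b) j ≡ 0 ⊎ fill (out v) 0 (sel cs) (n b) j ≡ 1
        binary j j<n with Word.accepted (n b) (rank b) (dig v) W₀ (zeroed (sel v)) (L b) j j<n
        ... | inj₁ z       = inj₁ (trans (out≡ j j<n) z)
        ... | inj₂ (z , _) = inj₂ (trans (out≡ j j<n) z)

    vectors : ℕ
    vectors = Π< (K b) (rad b)

    iterationCost : ℕ
    iterationCost = checkCost M * n b + 150 * (suc (M ∸ 1) * n b)

    record Inv (N : ℕ) (v : Mem) : Set₁ where
      field
        going    : go v ≡ 1
        achieved : Achieved (best v) (out v)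
        covered  : Covered N (best v)
        valid    : Valid (rad b) (K b) (dig v)
        position : val (rad b) (K b) (dig v) ≡ N

    record Finished (P : Code) (v : Mem) (c : ℕ) : Set₁ where
      field
        final    : Mem
        ran      : Exec P ⟪ pin v ⟫ ⟪ pin final ⟫ c
        achieved : Achieved (best final) (out final)
        covered  : Covered vectors (best final)

    K≤ : K b ≤ suc (M ∸ 1) * n b
    K≤ = subst (_≤ suc (M ∸ 1) * n b) (sym K≡) (*-monoʳ-≤ (suc (M ∸ 1)) L≤n)

    body : Code
    body = check ⨟ increment

    -- Induction on the number `k` of vectors after the current one, whose numeral is `N`. The 3 in
    -- the cost is one evaluation of the loop test.
    scan : ∀ k N v → suc N + k ≡ vectors → Inv N v →
      Finished (While var vgo loop body) v (suc k * (3 + iterationCost) + 3)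
    scan k N v count I with check-result v (valid-codes (Inv.valid I)) (Inv.achieved I)
    ... | v₁ , R = next (inc (rad b) (dig v₁) (K b)) refl
      where
      open CheckResult R

      incSpec : Inc (rad b) (dig v₁) (K b) (inc (rad b) (dig v₁) (K b))
      incSpec = inc-spec (rad b) (dig v₁) (K b) (subst (Valid (rad b) (K b)) (sym same) (Inv.valid I)) (K b) ≤-refl

      v₁-position : val (rad b) (K b) (dig v₁) ≡ N
      v₁-position = trans (cong (val (rad b) (K b)) same) (Inv.position I)

      covered₁ : Covered (suc N) (best v₁)
      covered₁ E x δ e S good va lt′ ind with <-suc-split lt′
      ... | inj₁ h = ≤-trans (Inv.covered I E x δ e S good va h ind) better
      ... | inj₂ h = covers E x e S (Good-cong (val-injective (rad b) (K b) {dig v} {δ} (Inv.valid I) va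
                       (trans (Inv.position I) (sym h))) good) ind

      1≤K′ : 1 ≤ suc (M ∸ 1) * n b
      1≤K′ = *-mono-≤ (s≤s {n = M ∸ 1} z≤n) 1≤n

      once : ∀ R → inc (rad b) (dig v₁) (K b) ≡ R →
        Exec body ⟪ pin v ⟫ ⟪ pin (record v₁ { dig = proj₁ R ; go = 1 ∸ proj₂ R }) ⟫ iterationCost
      once R refl = ran ▷ run-increment (pin v₁) 1≤K′ K≤

      arith : ∀ {c c′} → c ≤ c′ → 3 + (iterationCost + c) ≤ (3 + iterationCost) + c′
      arith {c} h = +-monoʳ-≤ (3 + iterationCost) h

      next : ∀ R → inc (rad b) (dig v₁) (K b) ≡ R → Finished (While var vgo loop body) v (suc k * (3 + iterationCost) + 3)
      next (D , zero) eq with subst (Inc (rad b) (dig v₁) (K b)) eq incSpec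
      ... | spec = continue k count
        where
        position′ : val (rad b) (K b) D ≡ suc N
        position′ = trans (sym (+-identityʳ _)) (trans (Inc.value spec) (cong suc v₁-position))
        continue : ∀ k → suc N + k ≡ vectors → Finished (While var vgo loop body) v (suc k * (3 + iterationCost) + 3)
        -- Without a carry the new numeral is `suc N`, which must be below `vectors`; with no vector
        -- left it would equal `vectors`.
        continue zero count = contradiction (val< (rad b) (K b) (Inc.valid spec))
          (<-irrefl (trans position′ (trans (sym (+-identityʳ _)) count)))
        continue (suc k) count with scan k (suc N) (record v₁ { dig = D ; go = 1 }) (trans (sym (+-suc (suc N) k)) count) (record
          { going    = refl
          ; achieved = achieved
          ; covered  = covered₁
          ; valid    = Inc.valid spec
          ; position = position′
          })
        ... | F = record
          { final    = Finished.final F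
          ; ran      = weaken (≤-trans (arith ≤-refl) (≤-reflexive (sym (+-assoc (3 + iterationCost) _ 3))))
              (Exec-step (Inv.going I) (once (D , 0) eq) (Finished.ran F))
          ; achieved = Finished.achieved F
          ; covered  = Finished.covered F
          }
      next (D , suc (suc _)) eq = contradiction (subst (λ R → proj₂ R ≤ 1) eq (Inc.carry≤ incSpec)) (λ { (s≤s ()) })
      next (D , suc zero) eq with subst (Inc (rad b) (dig v₁) (K b)) eq incSpec
      ... | spec = record
        { final    = record v₁ { dig = D ; go = 0 }
        ; ran      = weaken (≤-trans (arith {3} (m≤n+m 3 (k * (3 + iterationCost))))
              (≤-reflexive (sym (+-assoc (3 + iterationCost) _ 3))))
              (Exec-step (Inv.going I) (once (D , 1) eq) (Exec-stop refl))
        ; achieved = achieved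
        ; covered  = λ E x δ e S good va lt′ → covered₁ E x δ e S good va (<-≤-trans lt′ vectors≤)
        }
        where
        -- The carry is worth `vectors`, and the numeral it completes is `suc N`.
        vectors≤ : vectors ≤ suc N
        vectors≤ = ≤-trans (m≤n+m vectors (val (rad b) (K b) D)) (≤-reflexive
          (trans (cong (val (rad b) (K b) D +_) (sym (*-identityˡ vectors)))
            (trans (Inc.value spec) (cong suc v₁-position))))

-- Preparation and the complete run

val-zero : ∀ r k → val r k (const 0) ≡ 0
val-zero r zero    = refl
val-zero r (suc k) = trans (+-identityʳ _) (val-zero r k)

module Running (M : ℕ) (input : ℕ → ℕ → ℕ) (o : ℕ → ℕ) where
  open Algorithm M
  open Phases input
  open Specifications M input
  open Searching M input
  open Mem

  initial prepared : Mem
  initial = record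
    { n = 0 ; L = 0 ; W = 0 ; ok = 0 ; best = 0 ; ptr = 0 ; K = 0 ; go = 0
    ; out = o ; rank = const 0 ; slot = const 0 ; sel = const 0 ; q = const 0
    ; C = const 0 ; dig = const 0 ; rad = const 0 }

  N : ℕ
  N = o 0

  words : ℕ
  words = distinctUpTo N

  prepared = record initial
    { n    = N
    ; L    = words
    ; ptr  = suc (M ∸ 1) * words
    ; K    = suc (M ∸ 1) * words
    -- Cell 0 of the output array contained `n`; once it is cleared, the output represents the empty
    -- set, the first candidate for the optimum.
    ; out  = upd o 0 0
    ; rank = fill (const 0) 0 (Rank.rank N d) N
    ; rad  = radicesFrom words words (fill (const 0) 0 (λ _ → N + 1) words) (M ∸ 1)
    }

  module _ (1≤N : 1 ≤ N) where

    private
      1≤N² : 1 ≤ N * N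
      1≤N² = *-mono-≤ 1≤N 1≤N

      N≤N² : N ≤ N * N
      N≤N² = ≤-trans (≤-reflexive (sym (*-identityʳ N))) (*-monoʳ-≤ N 1≤N)

    run-radices : Exec radices ⟪ record initial { n = N ; L = words ; out = upd o 0 0 ; rank = rank prepared } ⟫
      ⟪ record prepared { K = 0 } ⟫ ((121 + (10 + radixCost (M ∸ 1))) * N)
    run-radices = _▸_ 1≤N {c = 121} {10 + radixCost (M ∸ 1)}
      (For-linear {c = 100} (λ i → ⟪ record s { rad = fill (const 0) 0 (λ _ → N + 1) i } ⟫)
        (distinctUpTo≤ N) 1≤N (λ _ _ → refl) (λ i _ → within 100 Exec-[]≔))
      (_▸_ 1≤N {c = 10} {radixCost (M ∸ 1)} (scale 1≤N (within 10 Exec-≔))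
        (run-codeRadices (record s { rad = fill (const 0) 0 (λ _ → N + 1) words ; ptr = words })
          1≤N (distinctUpTo≤ N) (M ∸ 1)))
      where
      s : Mem
      s = record initial { n = N ; L = words ; out = upd o 0 0 ; rank = rank prepared }

    run-prepare : Exec prepare ⟪ initial ⟫ ⟪ prepared ⟫ (prepareCost M * (N * N))
    run-prepare =
      _▸_ 1≤N² {c = 4} {4 + (200 + (200 + ((121 + (10 + radixCost (M ∸ 1))) + 4)))} (scale 1≤N² (within 4 Exec-≔))
      (_▸_ 1≤N² {c = 4} {200 + (200 + ((121 + (10 + radixCost (M ∸ 1))) + 4))} (scale 1≤N² (within 4 Exec-[]≔))
      (_▸_ 1≤N² {c = 200} {200 + ((121 + (10 + radixCost (M ∸ 1))) + 4)}
        (run-ranks (record initial { n = N ; out = upd o 0 0 }) 1≤N)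
      (_▸_ 1≤N² {c = 200} {(121 + (10 + radixCost (M ∸ 1))) + 4}
        (run-distinct (record initial { n = N ; out = upd o 0 0 ; rank = rank prepared }) 1≤N refl)
      (_▸_ 1≤N² {c = 121 + (10 + radixCost (M ∸ 1))} {4}
        (weaken (*-monoʳ-≤ (121 + (10 + radixCost (M ∸ 1))) N≤N²) run-radices)
        (scale 1≤N² (within 4 Exec-≔))))))

  radicesFrom-before : ∀ l at a r {x} → x < at → radicesFrom l at a r x ≡ a x
  radicesFrom-before l at a zero    x<at = refl
  radicesFrom-before l at a (suc r) x<at = trans
    (fill-out (radicesFrom l at a r) (at + r * l) (λ k → l ∸ k) l (<-≤-trans x<at (m≤m+n at _)))
    (radicesFrom-before l at a r x<at)

  radicesFrom-at : ∀ l at a r i s → i < r → s < l → radicesFrom l at a r (at + i * l + s) ≡ l ∸ s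
  radicesFrom-at l at a (suc r) i s i< s<l with <-suc-split i<
  ... | inj₂ refl = fill-in (radicesFrom l at a r) (at + r * l) (λ k → l ∸ k) l s<l
  ... | inj₁ i<r  = trans
    (fill-out (radicesFrom l at a r) (at + r * l) (λ k → l ∸ k) l (begin-strict
      at + i * l + s   <⟨ +-monoʳ-< (at + i * l) s<l ⟩
      at + i * l + l   ≡⟨ trans (+-assoc at (i * l) l) (cong (at +_) (+-comm (i * l) l)) ⟩
      at + suc i * l   ≤⟨ +-monoʳ-≤ at (*-monoˡ-≤ l i<r) ⟩
      at + r * l       ∎))
    (radicesFrom-at l at a r i s i<r s<l)
    where open ≤-Reasoning

  module Result (1≤N : 1 ≤ N) (1≤L : 1 ≤ words) (o≡0 : ∀ j → o (suc j) ≡ 0)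
    (positive : ∀ i j → i ≤ M → j < N → 0 < p i j) where

    rad-word : ∀ s → s < words → rad prepared s ≡ suc N
    rad-word s s<L = trans (radicesFrom-before words words _ (M ∸ 1) s<L)
      (trans (fill-in (const 0) 0 (λ _ → N + 1) words s<L) (+-comm N 1))

    rad-code : ∀ i s → suc i < M → s < words → rad prepared (suc i * words + s) ≡ words ∸ s
    rad-code i s i<M s<L = radicesFrom-at words words _ (M ∸ 1) i s (∸-monoˡ-≤ 1 i<M) s<L

    open Loop prepared 1≤N (distinctUpTo≤ N) 1≤L
      (isRank N d (λ j j<n → fill-in (const 0) 0 (Rank.rank N d) N j<n))
      refl rad-word rad-code positive public

    vectors≡ : vectors ≡ suc N ^ words * (words !) ^ (M ∸ 1)
    vectors≡ = trans (Π<-+ words ((M ∸ 1) * words) (rad prepared)) (cong₂ _*_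
      (trans (Π<-cong words rad-word) (Π<-const words (suc N)))
      (trans (Π<-sections words (λ s → words ∸ s) (M ∸ 1) _
               (λ i s i<r s<L → trans (cong (rad prepared) (sym (+-assoc words (i * words) s)))
                                      (radicesFrom-at words words _ (M ∸ 1) i s i<r s<L)))
             (cong (_^ (M ∸ 1)) (Π<-falling words))))

    out≡0 : ∀ j → out prepared j ≡ 0
    out≡0 zero    = refl
    out≡0 (suc j) = o≡0 j

    not-out : ∀ {j} → out prepared j ≢ 1
    not-out {j} e = 0≢1+n (trans (sym (out≡0 j)) e)

    start-valid : Valid (rad prepared) (K prepared) (const 0)
    start-valid = codes-valid (λ _ _ → z≤n) (λ _ _ _ s<L → m<n⇒0<n∸m s<L)

    inv₀ : Inv 0 (record prepared { go = 1 })
    inv₀ = record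
      { going    = refl
      ; achieved = record
        { binary   = λ j _ → inj₁ (out≡0 j)
        ; times    = λ _ _ → 0
        ; schedule = record
          { flow     = λ i j _ _ e → contradiction e (not-out {j})
          ; disjoint = λ i j k _ _ _ e → contradiction e (not-out {j})
          ; jit      = λ j _ e → contradiction e (not-out {j})
          }
        ; value    = sym (trans (total-cong {out prepared} {const 0} (λ j _ → out≡0 j))
                       (trans (Σ<-const N 0) (*-zeroʳ N)))
        }
      ; covered  = λ _ _ _ _ _ _ _ ()
      ; valid    = start-valid
      ; position = val-zero (rad prepared) (K prepared)
      }

    count : suc 0 + (vectors ∸ 1) ≡ vectors
    count = m+[n∸m]≡n (≤-trans (s≤s z≤n) (val< (rad prepared) (K prepared) start-valid))

    -- Keeps the recursion over all vectors from being unfolded when the final memory is mentioned.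
    abstract
      finished : Finished (While var vgo loop body) (record prepared { go = 1 })
                          (suc (vectors ∸ 1) * (3 + iterationCost) + 3)
      finished = scan (vectors ∸ 1) 0 (record prepared { go = 1 }) count inv₀

    final : Mem
    final = Finished.final finished

    totalCost : ℕ
    totalCost = prepareCost M * (N * N) + (3 + (vectors * (3 + iterationCost) + 3))

    run-algorithm : Exec algorithm ⟪ initial ⟫ ⟪ pin final ⟫ totalCost
    run-algorithm = run-prepare 1≤N ▷ Exec-≔ ▷
      subst (λ v → Exec (While var vgo loop body) ⟪ record prepared { go = 1 } ⟫ ⟪ pin final ⟫ (v * (3 + iterationCost) + 3)) count (Finished.ran finished)

module ℚGroup = GroupProperties ℚ.+-0-group

-- Rounding start times down. Processing times and due dates are integers,
-- so rounding preserves every constraint.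

fromℕ : ℕ → ℚ
fromℕ k = pos k ℚ./ 1

whole : ℕ → ℚ
whole k = mkℚ (pos k) 0 (coprime-sym (1-coprimeTo k))

fromℕ≡ : ∀ k → fromℕ k ≡ whole k
fromℕ≡ k = ℚ.normalize-coprime (coprime-sym (1-coprimeTo k))

fromℕ-+ : ∀ a b → fromℕ (a + b) ≡ fromℕ a ℚ.+ fromℕ b
fromℕ-+ a b rewrite fromℕ≡ (a + b) | fromℕ≡ a | fromℕ≡ b =
  ℚ.toℚᵘ-injective (ℚᵘ.≃-trans (ℚᵘ.*≡* integers) (ℚᵘ.≃-sym (ℚ.toℚᵘ-homo-+ (whole a) (whole b))))
  where
  integers : pos (a + b) ℤ.* pos 1 ≡ (pos a ℤ.* pos 1 ℤ.+ pos b ℤ.* pos 1) ℤ.* pos 1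
  integers = cong (ℤ._* pos 1) (cong₂ ℤ._+_ (sym (ℤ.*-identityʳ (pos a))) (sym (ℤ.*-identityʳ (pos b))))

fromℕ-mono : ∀ {a b} → a ≤ b → fromℕ a ℚ.≤ fromℕ b
fromℕ-mono {a} {b} a≤b rewrite fromℕ≡ a | fromℕ≡ b =
  *≤* (subst₂ ℤ._≤_ (sym (ℤ.*-identityʳ (pos a))) (sym (ℤ.*-identityʳ (pos b))) (+≤+ a≤b))

fromℕ-cancel : ∀ {a b} → fromℕ a ℚ.≤ fromℕ b → a ≤ b
fromℕ-cancel {a} {b} le rewrite fromℕ≡ a | fromℕ≡ b =
  ℤ.drop‿+≤+ (subst₂ ℤ._≤_ (ℤ.*-identityʳ (pos a)) (ℤ.*-identityʳ (pos b)) (ℚ.drop-*≤* le))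

-- This is the floor on nonnegative rationals, the only ones that occur as start times of scheduled
-- jobs.
⌊_⌋ : ℚ → ℕ
⌊ mkℚ k d-1 _ ⌋ = ℤ.∣ k ∣ / suc d-1

⌊⌋-greatest : ∀ k x → fromℕ k ℚ.≤ x → k ≤ ⌊ x ⌋
⌊⌋-greatest k (mkℚ (pos a) d-1 c) le rewrite fromℕ≡ k =
  subst (_≤ a / suc d-1) (m*n/n≡m k (suc d-1)) (/-monoˡ-≤ (suc d-1)
    (ℤ.drop‿+≤+ (subst₂ ℤ._≤_ (sym (ℤ.pos-* k (suc d-1))) (ℤ.*-identityʳ (pos a)) (ℚ.drop-*≤* le))))
⌊⌋-greatest k (mkℚ -[1+ a ] d-1 c) le rewrite fromℕ≡ k
  with subst₂ ℤ._≤_ (sym (ℤ.pos-* k (suc d-1))) (ℤ.*-identityʳ -[1+ a ]) (ℚ.drop-*≤* le)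
... | ()

⌊⌋-lower : ∀ x → 0ℚ ℚ.≤ x → fromℕ ⌊ x ⌋ ℚ.≤ x
⌊⌋-lower (mkℚ (pos a) d-1 c) 0≤x rewrite fromℕ≡ (a / suc d-1) =
  *≤* (subst₂ ℤ._≤_ (ℤ.pos-* (a / suc d-1) (suc d-1)) (sym (ℤ.*-identityʳ (pos a))) (+≤+ (m/n*n≤m a (suc d-1))))
⌊⌋-lower (mkℚ -[1+ a ] d-1 c) (*≤* le) with subst₂ ℤ._≤_ refl (ℤ.*-identityʳ -[1+ a ]) le
... | ()

-- The left-hand side is an integer not exceeding `y`, and the floor of `y` is the greatest such
-- integer.
⌊⌋-+-≤ : ∀ x y k → 0ℚ ℚ.≤ x → x ℚ.+ fromℕ k ℚ.≤ y → ⌊ x ⌋ + k ≤ ⌊ y ⌋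
⌊⌋-+-≤ x y k 0≤x le = ⌊⌋-greatest (⌊ x ⌋ + k) y (ℚ.≤-trans
  (ℚ.≤-trans (ℚ.≤-reflexive (fromℕ-+ ⌊ x ⌋ k)) (ℚ.+-monoˡ-≤ (fromℕ k) (⌊⌋-lower x 0≤x))) le)

⌊⌋-+-≡ : ∀ x k d → 0ℚ ℚ.≤ x → x ℚ.+ fromℕ k ≡ fromℕ d → ⌊ x ⌋ + k ≡ d
⌊⌋-+-≡ x k d 0≤x eq = ≤-antisym
  (fromℕ-cancel (ℚ.≤-trans
    (ℚ.≤-trans (ℚ.≤-reflexive (fromℕ-+ ⌊ x ⌋ k)) (ℚ.+-monoˡ-≤ (fromℕ k) (⌊⌋-lower x 0≤x)))
    (ℚ.≤-reflexive eq)))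
  (≤-trans (≤-reflexive (sym (m∸n+n≡m k≤d)))
    (+-monoˡ-≤ k (⌊⌋-greatest (d ∸ k) x (ℚ.≤-reflexive
      (ℚGroup.∙-cancelʳ (fromℕ k) _ _ (trans (sym (fromℕ-+ (d ∸ k) k)) (trans (cong fromℕ (m∸n+n≡m k≤d)) (sym eq))))))))
  where
  k≤d : k ≤ d
  k≤d = fromℕ-cancel (ℚ.≤-trans (ℚ.≤-reflexive (sym (ℚ.+-identityˡ (fromℕ k))))
    (ℚ.≤-trans (ℚ.+-monoˡ-≤ (fromℕ k) 0≤x) (ℚ.≤-reflexive eq)))

-- Counting distinct values

-- Deleting one occurrence of the head from `ys` preserves the inclusion of the tail, in which the
-- head does not recur.
unique-⊆-length : ∀ {A : Set} {xs ys : List A} → Unique xs → (∀ {z} → z ∈ xs → z ∈ ys) → length xs ≤ length ys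
unique-⊆-length {xs = []} [] sub = z≤n
unique-⊆-length {xs = x ∷ xs} (x∉ ∷ uniq) sub with ∈-∃++ (sub (here refl))
... | as , bs , refl = ≤-trans (s≤s (unique-⊆-length uniq sub′)) (≤-reflexive (begin
    suc (length (as ++ bs))        ≡⟨ cong suc (length-++ as) ⟩
    suc (length as + length bs)    ≡⟨ +-suc (length as) (length bs) ⟨
    length as + suc (length bs)    ≡⟨ length-++ as ⟨
    length (as ++ x ∷ bs)          ∎))
  where
  open ≡-Reasoning
  sub′ : ∀ {z} → z ∈ xs → z ∈ as ++ bs
  sub′ z∈xs with ∈-++⁻ as (sub (there z∈xs))
  ... | inj₁ z∈as         = ∈-++⁺ˡ z∈as
  ... | inj₂ (here refl)  = contradiction refl (All.lookup x∉ z∈xs)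
  ... | inj₂ (there z∈bs) = ∈-++⁺ʳ as z∈bs

Σ<≡0 : ∀ n {f : ℕ → ℕ} → Σ< n f ≡ 0 → ∀ k → k < n → f k ≡ 0
Σ<≡0 (suc n) {f} eq k k< with <-suc-split k<
... | inj₁ k<n  = Σ<≡0 n (m+n≡0⇒m≡0 (Σ< n f) eq) k k<n
... | inj₂ refl = m+n≡0⇒n≡0 (Σ< n f) eq

Σ<≢0 : ∀ n {f : ℕ → ℕ} → Σ< n f ≢ 0 → ∃[ k ] k < n × f k ≢ 0
Σ<≢0 zero        ne = contradiction refl ne
Σ<≢0 (suc n) {f} ne with f n ≟ 0
... | no  f≢0 = n , ≤-refl , f≢0
... | yes f≡0 with Σ<≢0 n (λ z → ne (cong₂ _+_ z f≡0))
...   | k , k<n , g = k , m<n⇒m<1+n k<n , g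

module Values (d : ℕ → ℕ) where

  repeats : ℕ → ℕ
  repeats j = Σ< j λ k → eqᵢ (d j) (d k)

  cons : ℕ → ℕ → List ℕ → List ℕ
  cons zero    v vs = v ∷ vs
  cons (suc _) v vs = vs

  -- Mediates between the count made by the program and `#d`: the length of this list is the
  -- computed sum, while its elements are those of the deduplicated due dates.
  values : ℕ → List ℕ
  values zero    = []
  values (suc j) = cons (repeats j) (d j) (values j)

  length-values : ∀ j → length (values j) ≡ Σ< j (λ i → 1 ∸ repeats i)
  length-values zero = refl
  length-values (suc j) with repeats j
  ... | zero  = trans (cong suc (length-values j)) (+-comm 1 _)
  ... | suc r rewrite 0∸n≡0 r = trans (length-values j) (sym (+-identityʳ _))

  values-⊆ : ∀ j {v} → v ∈ values j → ∃[ k ] k < j × v ≡ d k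
  values-⊆ (suc j) v∈ with repeats j
  values-⊆ (suc j) v∈          | suc _ with values-⊆ j v∈
  ... | k , k<j , eq = k , m<n⇒m<1+n k<j , eq
  values-⊆ (suc j) (here refl) | zero  = j , ≤-refl , refl
  values-⊆ (suc j) (there v∈)  | zero  with values-⊆ j v∈
  ... | k , k<j , eq = k , m<n⇒m<1+n k<j , eq

  values-∋ : ∀ j k → k < j → d k ∈ values j
  values-∋ (suc j) k k< with <-suc-split k< | repeats j in eq
  ... | inj₁ k<j  | suc _ = values-∋ j k k<j
  ... | inj₁ k<j  | zero  = there (values-∋ j k k<j)
  ... | inj₂ refl | zero  = here refl
  ... | inj₂ refl | suc r with Σ<≢0 j (λ z → 0≢1+n (trans (sym z) eq))
  ...   | l , l<j , same with d j ≟ d l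
  ...     | yes e = subst (_∈ values j) (sym e) (values-∋ j l l<j)
  ...     | no ne = contradiction (eqᵢ-false ne) same

  values-unique : ∀ j → Unique (values j)
  values-unique zero = []
  values-unique (suc j) with repeats j in eq
  ... | suc _ = values-unique j
  ... | zero  = All.tabulate fresh ∷ values-unique j
    where
    fresh : ∀ {v} → v ∈ values j → d j ≢ v
    fresh v∈ refl with values-⊆ j v∈
    ... | k , k<j , e = contradiction (trans (sym (Σ<≡0 j eq k k<j))
            (subst (λ z → eqᵢ (d j) z ≡ 1) e (eqᵢ-true (d j)))) 0≢1+n

-- Reads a list as a word: jobs are shifted by 1, and blanks follow the end of the list.
nth : List ℕ → ℕ → ℕ
nth []       _       = 0
nth (x ∷ xs) zero    = suc x
nth (x ∷ xs) (suc k) = nth xs k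

nth-∈ : ∀ xs k {j} → nth xs k ≡ suc j → j ∈ xs
nth-∈ (x ∷ xs) zero    refl = here refl
nth-∈ (x ∷ xs) (suc k) eq   = there (nth-∈ xs k eq)

∈-nth : ∀ {xs j} → j ∈ xs → ∃[ k ] k < length xs × nth xs k ≡ suc j
∈-nth (here refl) = 0 , z<s , refl
∈-nth (there j∈) with ∈-nth j∈
... | k , k< , eq = suc k , s<s k< , eq

nth-injective : ∀ {xs} → Unique xs → ∀ k l {j} → nth xs k ≡ suc j → nth xs l ≡ suc j → k ≡ l
nth-injective {x ∷ xs} (x∉ ∷ u) zero    zero    p q = refl
nth-injective {x ∷ xs} (x∉ ∷ u) zero    (suc l) p q =
  contradiction (suc-injective p) (All.lookup x∉ (nth-∈ xs l q))
nth-injective {x ∷ xs} (x∉ ∷ u) (suc k) zero    p q =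
  contradiction (suc-injective q) (All.lookup x∉ (nth-∈ xs k p))
nth-injective {x ∷ xs} (x∉ ∷ u) (suc k) (suc l) p q = cong suc (nth-injective u k l p q)

-- Jobs with pairwise distinct due dates fill at most one position per value.
module Enumerate (d e : ℕ → ℕ) (n : ℕ)
  (d-injective : ∀ j k → j < n → k < n → e j ≡ 1 → e k ≡ 1 → d j ≡ d k → j ≡ k) where
  open Values d

  jobs : ℕ → List ℕ
  jobs zero    = []
  jobs (suc j) with e j ≟ 1
  ... | yes _ = j ∷ jobs j
  ... | no  _ = jobs j

  jobs-⊆ : ∀ i {j} → j ∈ jobs i → j < i × e j ≡ 1
  jobs-⊆ (suc i) j∈ with e i ≟ 1
  jobs-⊆ (suc i) j∈          | no  _ = let j<i , e≡1 = jobs-⊆ i j∈ in m<n⇒m<1+n j<i , e≡1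
  jobs-⊆ (suc i) (here refl) | yes h = ≤-refl , h
  jobs-⊆ (suc i) (there j∈)  | yes _ = let j<i , e≡1 = jobs-⊆ i j∈ in m<n⇒m<1+n j<i , e≡1

  jobs-∋ : ∀ i j → j < i → e j ≡ 1 → j ∈ jobs i
  jobs-∋ (suc i) j j< h with <-suc-split j< | e i ≟ 1
  ... | inj₁ j<i  | yes _ = there (jobs-∋ i j j<i h)
  ... | inj₁ j<i  | no  _ = jobs-∋ i j j<i h
  ... | inj₂ refl | yes _ = here refl
  ... | inj₂ refl | no ne = contradiction h ne

  jobs-unique : ∀ i → i ≤ n → Unique (map d (jobs i)) × Unique (jobs i)
  jobs-unique zero    i≤n = [] , []
  jobs-unique (suc i) i<n with e i ≟ 1
  ... | no  _ = jobs-unique i (<⇒≤ i<n)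
  ... | yes h = (fresh-d ∷ proj₁ ih) , (All.tabulate fresh ∷ proj₂ ih)
    where
    ih = jobs-unique i (<⇒≤ i<n)
    fresh : ∀ {j} → j ∈ jobs i → i ≢ j
    fresh j∈ refl = <-irrefl refl (proj₁ (jobs-⊆ i j∈))
    fresh-d : All (d i ≢_) (map d (jobs i))
    fresh-d = map⁺ (All.tabulate (λ {j} j∈ eq → let j<i , e≡1 = jobs-⊆ i j∈ in
      <⇒≢ j<i (sym (d-injective i j i<n (<-trans j<i i<n) h e≡1 eq))))

  jobs-length : length (jobs n) ≤ length (values n)
  jobs-length = subst (_≤ length (values n)) (length-map d (jobs n))
    (unique-⊆-length (proj₁ (jobs-unique n ≤-refl)) sub)
    where
    sub : ∀ {v} → v ∈ map d (jobs n) → v ∈ values n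
    sub v∈ with ∈-map⁻ d v∈
    ... | j , j∈ , refl = values-∋ n j (proj₁ (jobs-⊆ n j∈))

  listing : ∀ {L} → length (values n) ≤ L → Listing n (λ j → e j ≡ 1) L (nth (jobs n))
  listing ≤L = record
    { listed   = λ s _ j eq → jobs-⊆ n (nth-∈ (jobs n) s eq)
    ; occurs   = λ j j<n h → let k , k< , eq = ∈-nth (jobs-∋ n j j<n h) in
        k , <-≤-trans k< (≤-trans jobs-length ≤L) , eq
    ; distinct = λ s s′ _ _ j p q → nth-injective (proj₂ (jobs-unique n ≤-refl)) s s′ p q
    }

-- Numerical bounds

-- Bernoulli's inequality (1 - 1/(n+1))^a ≥ 1 - a/(n+1) with denominators cleared.
falling-power : ∀ n a → a ≤ n → suc n ^ a * (suc n ∸ a) ≤ suc n * n ^ a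
falling-power n zero    a≤n = ≤-reflexive (trans (*-identityˡ (suc n)) (sym (*-identityʳ (suc n))))
falling-power n (suc a) a<n = begin
  suc n * suc n ^ a * c          ≡⟨ cong (_* c) (*-comm (suc n) (suc n ^ a)) ⟩
  suc n ^ a * suc n * c          ≡⟨ *-assoc (suc n ^ a) (suc n) c ⟩
  suc n ^ a * (c + n * c)        ≤⟨ *-monoʳ-≤ (suc n ^ a) (+-monoˡ-≤ (n * c) (m∸n≤m n a)) ⟩
  suc n ^ a * (n + n * c)        ≡⟨ cong (suc n ^ a *_) (sym (*-suc n c)) ⟩
  suc n ^ a * (n * suc c)        ≡⟨ cong (suc n ^ a *_) (*-comm n (suc c)) ⟩
  suc n ^ a * (suc c * n)        ≡⟨ *-assoc (suc n ^ a) (suc c) n ⟨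
  suc n ^ a * suc c * n          ≡⟨ cong (λ z → suc n ^ a * z * n) (sym (+-∸-assoc 1 (<⇒≤ a<n))) ⟩
  suc n ^ a * (suc n ∸ a) * n    ≤⟨ *-monoˡ-≤ n (falling-power n a (<⇒≤ a<n)) ⟩
  suc n * n ^ a * n              ≡⟨ *-assoc (suc n) (n ^ a) n ⟩
  suc n * (n ^ a * n)            ≡⟨ cong (suc n *_) (*-comm (n ^ a) n) ⟩
  suc n * (n * n ^ a)            ∎
  where
  open ≤-Reasoning
  c = n ∸ a

-- For such `a` the factor `suc n ∸ a` is at least half of `suc n`, so cancelling it in
-- `falling-power` costs a factor 2.
suc-power-half : ∀ n a → a ≤ n → a + a ≤ suc n → suc n ^ a ≤ 2 * n ^ a
suc-power-half n a a≤n 2a≤ = *-cancelʳ-≤ _ _ (suc n) (begin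
  suc n ^ a * suc n                                ≤⟨ *-monoʳ-≤ (suc n ^ a) double ⟩
  suc n ^ a * ((suc n ∸ a) + (suc n ∸ a))          ≡⟨ *-distribˡ-+ (suc n ^ a) (suc n ∸ a) (suc n ∸ a) ⟩
  x + x                                            ≤⟨ +-mono-≤ (falling-power n a a≤n) (falling-power n a a≤n) ⟩
  suc n * n ^ a + suc n * n ^ a                    ≡⟨ *-distribˡ-+ (suc n) (n ^ a) (n ^ a) ⟨
  suc n * (n ^ a + n ^ a)                          ≡⟨ cong (λ z → suc n * (n ^ a + z)) (+-identityʳ (n ^ a)) ⟨
  suc n * (2 * n ^ a)                              ≡⟨ *-comm (suc n) (2 * n ^ a) ⟩
  2 * n ^ a * suc n                                ∎)
  where
  open ≤-Reasoning
  x = suc n ^ a * (suc n ∸ a)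
  double : suc n ≤ (suc n ∸ a) + (suc n ∸ a)
  double = begin
    suc n                      ≡⟨ m∸n+n≡m (m≤n⇒m≤1+n a≤n) ⟨
    (suc n ∸ a) + a            ≤⟨ +-monoʳ-≤ (suc n ∸ a) (m+n≤o⇒m≤o∸n a 2a≤) ⟩
    (suc n ∸ a) + (suc n ∸ a)  ∎

-- (1 + 1/n)^k is bounded for k ≤ n: each half of the exponent costs a factor 2.
suc-power : ∀ n k → k ≤ n → suc n ^ k ≤ 4 * n ^ k
suc-power n k k≤n = begin
  suc n ^ k                          ≡⟨ cong (suc n ^_) (⌊n/2⌋+⌈n/2⌉≡n k) ⟨
  suc n ^ (⌊ k /2⌋ + ⌈ k /2⌉)        ≡⟨ ^-distribˡ-+-* (suc n) ⌊ k /2⌋ ⌈ k /2⌉ ⟩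
  suc n ^ ⌊ k /2⌋ * suc n ^ ⌈ k /2⌉  ≤⟨ *-mono-≤ (suc-power-half n ⌊ k /2⌋ (≤-trans (⌊n/2⌋≤n k) k≤n) floor)
                                                 (suc-power-half n ⌈ k /2⌉ (≤-trans (⌈n/2⌉≤n k) k≤n) ceiling) ⟩
  2 * n ^ ⌊ k /2⌋ * (2 * n ^ ⌈ k /2⌉) ≡⟨ [m*n]*[o*p]≡[m*o]*[n*p] 2 (n ^ ⌊ k /2⌋) 2 (n ^ ⌈ k /2⌉) ⟩
  4 * (n ^ ⌊ k /2⌋ * n ^ ⌈ k /2⌉)    ≡⟨ cong (4 *_) (^-distribˡ-+-* n ⌊ k /2⌋ ⌈ k /2⌉) ⟨
  4 * n ^ (⌊ k /2⌋ + ⌈ k /2⌉)        ≡⟨ cong (λ z → 4 * n ^ z) (⌊n/2⌋+⌈n/2⌉≡n k) ⟩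
  4 * n ^ k                          ∎
  where
  open ≤-Reasoning
  halves : ⌊ k /2⌋ + ⌈ k /2⌉ ≤ n
  halves = subst (_≤ n) (sym (⌊n/2⌋+⌈n/2⌉≡n k)) k≤n
  floor : ⌊ k /2⌋ + ⌊ k /2⌋ ≤ suc n
  floor = ≤-trans (+-monoʳ-≤ ⌊ k /2⌋ (⌊n/2⌋≤⌈n/2⌉ k)) (m≤n⇒m≤1+n halves)
  -- For odd `k = n` the two upper halves add up to `n + 1`, which is why `suc-power-half` allows
  -- `suc n`.
  ceiling : ⌈ k /2⌉ + ⌈ k /2⌉ ≤ suc n
  ceiling = ≤-trans (+-monoˡ-≤ ⌈ k /2⌉ (⌊n/2⌋-mono (n≤1+n (suc k))))
    (s≤s halves)

factorial≤power : ∀ {n} k → k ≤ n → k ! ≤ n ^ k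
factorial≤power zero    k≤n = ≤-refl
factorial≤power (suc k) k<n = *-mono-≤ k<n (factorial≤power k (<⇒≤ k<n))

1≤factorial : ∀ k → 1 ≤ k !
1≤factorial zero    = ≤-refl
1≤factorial (suc k) = *-mono-≤ (s≤s {n = k} z≤n) (1≤factorial k)

1≤power : ∀ {a} k → 1 ≤ a → 1 ≤ a ^ k
1≤power zero    1≤a = ≤-refl
1≤power (suc k) 1≤a = *-mono-≤ 1≤a (1≤power k 1≤a)

-- Serves to move the constant factor of the running time into the exponent.
n≤power : ∀ {s} n → 2 ≤ s → n ≤ s ^ n
n≤power zero    2≤s = z≤n
n≤power {s} (suc n) 2≤s = begin
  suc n            ≡⟨ +-comm 1 n ⟩
  n + 1            ≤⟨ +-mono-≤ (n≤power n 2≤s) (1≤power n (<⇒≤ 2≤s)) ⟩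
  s ^ n + s ^ n    ≡⟨ cong (s ^ n +_) (+-identityʳ (s ^ n)) ⟨
  2 * s ^ n        ≤⟨ *-monoˡ-≤ (s ^ n) 2≤s ⟩
  s * s ^ n        ∎
  where open ≤-Reasoning

-- Tables indexed by Fin n, read as functions on ℕ

extend-toℕ : ∀ {A : Set} {n} (z : A) (f : Fin n → A) j → extend z f (toℕ j) ≡ f j
extend-toℕ z f zero    = refl
extend-toℕ z f (suc j) = extend-toℕ z (λ i → f (suc i)) j

extend-const : ∀ {A : Set} n (z : A) i → extend {n = n} z (λ _ → z) i ≡ z
extend-const zero    z i       = refl
extend-const (suc n) z zero    = refl
extend-const (suc n) z (suc i) = extend-const n z i

extend-beyond : ∀ {A : Set} {n} (z : A) (f : Fin n → A) k → extend z f (n + k) ≡ z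
extend-beyond {n = zero}  z f k = refl
extend-beyond {n = suc n} z f k = extend-beyond z (λ i → f (suc i)) k

at : ∀ {n j} → j < n → Σ[ i ∈ Fin n ] toℕ i ≡ j
at j<n = fromℕ< j<n , toℕ-fromℕ< j<n

Σ<-front : ∀ n f → Σ< (suc n) f ≡ f 0 + Σ< n (f ∘ suc)
Σ<-front zero    f = sym (+-identityʳ (f 0))
Σ<-front (suc n) f = trans (cong (_+ f (suc n)) (Σ<-front n f)) (+-assoc (f 0) _ _)

∑≡Σ< : ∀ {n} (g : Fin n → ℕ) (f : ℕ → ℕ) → (∀ j → g j ≡ f (toℕ j)) → ∑ g ≡ Σ< n f
∑≡Σ< {zero}  g f eq = refl
∑≡Σ< {suc n} g f eq = trans (cong₂ _+_ (eq zero) (∑≡Σ< (g ∘ suc) (f ∘ suc) (eq ∘ suc))) (sym (Σ<-front n f))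

n≤∑ : ∀ {n} (g : Fin n → ℕ) → (∀ j → 1 ≤ g j) → n ≤ ∑ g
n≤∑ {zero}  g 1≤g = z≤n
n≤∑ {suc n} g 1≤g = +-mono-≤ (1≤g zero) (n≤∑ (g ∘ suc) (1≤g ∘ suc))

zeros : ∀ {A} → A → ∀ k → Tup A k
zeros a zero    = tt
zeros a (suc k) = a , zeros a k

get-zeros : ∀ {A} (a : A) {k} (i : Fin k) → get i (zeros a k) ≡ a
get-zeros a zero    = refl
get-zeros a (suc i) = get-zeros a i

-- Translation between instances and tables on natural numbers

module Instance {M : ℕ} (I : FlowShop (suc M)) where
  open FlowShop I using (n; n>0; p>0) renaming (p to pᶠ; d to dᶠ; w to wᶠ)

  input : ℕ → ℕ → ℕ
  input k = encodeFlowShop I (suc k)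

  o : ℕ → ℕ
  o = encodeFlowShop I 0

  open Algorithm M using (algorithm; program; base; name)
  open Algorithm.Phases M input using (_∼_; d; w; p; run)
  open Running M input o public
  open Values d using (values; length-values; values-⊆; values-∋; values-unique)

  -- Arrays from `base`, which is `4 + M` here, lie past the input, so the scalars and work arrays
  -- start at 0.
  beyond : ∀ k j → encodeFlowShop I (4 + (M + k)) j ≡ 0
  beyond k j = trans (cong (λ f → extend 0 f j) (extend-beyond (λ _ → 0) pᶠ k)) (extend-const n 0 j)

  encoded : encodeFlowShop I ∼ ⟪ initial ⟫
  encoded = record
    { ∼V = λ v → trans (subst (λ k → encodeFlowShop I (4 + k) (toℕ v) ≡ 0) (+-identityʳ M) (beyond 0 (toℕ v)))
                       (sym (get-zeros 0 v))
    ; ∼A = λ { zero    j → refl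
             ; (suc a) j → trans (subst (λ k → encodeFlowShop I (4 + k) j ≡ 0) (+-suc M (toℕ a)) (beyond (suc (toℕ a)) j))
                                 (cong (λ f → f j) (sym (get-zeros (const 0) a))) }
    ; ∼I = λ _ _ _ → refl
    }

  d-at : ∀ j → d (toℕ j) ≡ dᶠ j
  d-at = extend-toℕ 0 dᶠ

  w-at : ∀ j → w (toℕ j) ≡ wᶠ j
  w-at = extend-toℕ 0 wᶠ

  p-at : ∀ i j → p (toℕ i) (toℕ j) ≡ pᶠ i j
  p-at i j = trans (cong (λ f → extend 0 f (toℕ j)) (extend-toℕ (λ _ → 0) pᶠ i)) (extend-toℕ 0 (pᶠ i) j)

  -- Two duplicate-free lists with the same elements have the same length.
  words≡ : words ≡ #d I
  words≡ = trans (sym (length-values n)) (≤-antisym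
    (unique-⊆-length (values-unique n) (λ v∈ → ∈-deduplicate⁺ _≟_ (in-table v∈)))
    (unique-⊆-length (deduplicate-! (tabulate dᶠ)) (λ v∈ → in-values (∈-tabulate⁻ (∈-deduplicate⁻ _≟_ (tabulate dᶠ) v∈)))))
    where
    in-table : ∀ {v} → v ∈ values n → v ∈ tabulate dᶠ
    in-table v∈ with values-⊆ n v∈
    ... | k , k<n , refl with at k<n
    ...   | i , refl = subst (_∈ tabulate dᶠ) (sym (d-at i)) (∈-tabulate⁺ i)
    in-values : ∀ {v} → ∃[ i ] v ≡ dᶠ i → v ∈ values n
    in-values (i , refl) = subst (_∈ values n) (d-at i) (values-∋ n (toℕ i) (toℕ<n i))

  1≤words : 1 ≤ words
  1≤words = subst (1 ≤_) (length-values n) (nonempty (values-∋ n 0 n>0))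
    where
    nonempty : ∀ {v} {vs} → v ∈ vs → 1 ≤ length vs
    nonempty (here _)  = s≤s z≤n
    nonempty (there _) = s≤s z≤n

  positive : ∀ i j → i ≤ M → j < n → 0 < p i j
  positive i j i≤M j<n with at (s≤s i≤M) | at j<n
  ... | i′ , refl | j′ , refl = subst (0 <_) (sym (p-at i′ j′)) (p>0 i′ j′)

  open Result n>0 1≤words (λ _ → refl) positive public

  indicator : Subset n → ℕ → ℕ
  indicator E = extend 0 λ j → if lookup E j then 1 else 0

  indicator-∈ : ∀ E j → indicator E (toℕ j) ≡ 1 → j ∈ₛ E
  indicator-∈ E j eq rewrite extend-toℕ 0 (λ j → if lookup E j then 1 else 0) j with lookup E j in l
  ... | true = lookup⇒[]= j E l

  indicator-total : ∀ E → weight I E ≡ total (indicator E)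
  indicator-total E = ∑≡Σ< _ _ same
    where
    same : ∀ j → (if lookup E j then wᶠ j else 0) ≡ weightIf (indicator E (toℕ j)) (w (toℕ j))
    same j rewrite extend-toℕ 0 (λ j → if lookup E j then 1 else 0) j with lookup E j
    ... | true  = sym (w-at j)
    ... | false = refl

  indicates : ∀ E → Indicates (indicator E) (λ j → indicator E j ≡ 1)
  indicates E j j<n with at j<n
  ... | j′ , refl rewrite extend-toℕ 0 (λ j → if lookup E j then 1 else 0) j′ with lookup E j′
  ...   | true  = inj₂ (refl , refl)
  ...   | false = inj₁ (refl , λ ())

  module Feasible⇒ (E : Subset n) (S : JITSchedule I E) where
    open JITSchedule S

    times : ℕ → ℕ → ℕ
    times = extend (λ _ → 0) λ i → extend 0 λ j → ⌊ start i j ⌋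

    times-at : ∀ i j → times (toℕ i) (toℕ j) ≡ ⌊ start i j ⌋
    times-at i j = trans (cong (λ f → f (toℕ j)) (extend-toℕ (λ _ → 0) _ i)) (extend-toℕ 0 _ j)

    follows : ∀ i i′ j k → j ∈ₛ E → completion i j ℚ.≤ start i′ k →
      times (toℕ i) (toℕ j) + p (toℕ i) (toℕ j) ≤ times (toℕ i′) (toℕ k)
    follows i i′ j k j∈ le = subst₂ _≤_
      (cong₂ _+_ (sym (times-at i j)) (sym (p-at i j))) (sym (times-at i′ k))
      (⌊⌋-+-≤ (start i j) (start i′ k) (pᶠ i j) (nonneg i j j∈) le)

    schedule : Schedule (λ j → indicator E j ≡ 1) times
    schedule = record { flow = flow′ ; disjoint = disjoint′ ; jit = jit′ }
      where
      flow′ : ∀ i j → i < M → j < n → indicator E j ≡ 1 → times i j + p i j ≤ times (suc i) j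
      flow′ i j i<M j<n e with at (m<n⇒m<1+n i<M) | at (s<s i<M) | at j<n
      ... | i₁ , refl | i₂ , eq | j′ , refl = subst (λ k → _ ≤ times k (toℕ j′)) eq
        (follows i₁ i₂ j′ j′ (indicator-∈ E j′ e) (flow i₁ i₂ j′ (indicator-∈ E j′ e) eq))

      disjoint′ : ∀ i j k → i ≤ M → j < n → k < n → indicator E j ≡ 1 → indicator E k ≡ 1 → j ≢ k →
        times i j + p i j ≤ times i k ⊎ times i k + p i k ≤ times i j
      disjoint′ i j k i≤M j<n k<n e f j≢k with at (s≤s i≤M) | at j<n | at k<n
      ... | i′ , refl | j′ , refl | k′ , refl with disjoint i′ j′ k′ (indicator-∈ E j′ e) (indicator-∈ E k′ f) (j≢k ∘ cong toℕ)
      ...   | inj₁ le = inj₁ (follows i′ i′ j′ k′ (indicator-∈ E j′ e) le)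
      ...   | inj₂ le = inj₂ (follows i′ i′ k′ j′ (indicator-∈ E k′ f) le)

      jit′ : ∀ j → j < n → indicator E j ≡ 1 → times M j + p M j ≡ d j
      jit′ j j<n e with at {suc M} {M} ≤-refl | at j<n
      ... | i , eq | j′ , refl = subst (λ k → times k (toℕ j′) + p k (toℕ j′) ≡ d (toℕ j′)) eq
        (subst₂ _≡_ (cong₂ _+_ (sym (times-at i j′)) (sym (p-at i j′))) (sym (d-at j′))
          (⌊⌋-+-≡ (start i j′) (pᶠ i j′) (dᶠ j′) (nonneg i j′ (indicator-∈ E j′ e))
            (jit i j′ (indicator-∈ E j′ e) (cong suc eq))))

    module Codes = Existence times 1≤words _
      (Enumerate.listing d (indicator E) n (Due.d-injective positive schedule)
        (≤-reflexive (length-values n)))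

    -- The rounded schedule yields a valid vector. Its numeral is below `vectors`, so the finished
    -- search covers it.
    bound : weight I E ≤ Mem.best final
    bound = ≤-trans (≤-reflexive (indicator-total E))
      (Finished.covered finished _ times Codes.δ (indicator E) schedule Codes.good
        valid (val< (Mem.rad prepared) (Mem.K prepared) valid) (indicates E))
      where
      valid : Valid (Mem.rad prepared) (Mem.K prepared) Codes.δ
      valid = codes-valid Codes.δ≤n Codes.δ-codes

  open Achieved (Finished.achieved finished)

  chosen : Subset n
  chosen = Vec.tabulate λ j → Mem.out final (toℕ j) ≡ᵇ 1

  output : ∀ j → Mem.out final (toℕ j) ≡ (if lookup chosen j then 1 else 0)
  output j rewrite lookup∘tabulate (λ j → Mem.out final (toℕ j) ≡ᵇ 1) j with binary (toℕ j) (toℕ<n j)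
  ... | inj₁ e rewrite e = refl
  ... | inj₂ e rewrite e = refl

  selected : ∀ {j} → j ∈ₛ chosen → Mem.out final (toℕ j) ≡ 1
  selected {j} j∈ = trans (output j) (cong (if_then 1 else 0) ([]=⇒lookup j∈))

  chosen-weight : weight I chosen ≡ Mem.best final
  chosen-weight = trans (∑≡Σ< _ _ same) (sym value)
    where
    same : ∀ j → (if lookup chosen j then wᶠ j else 0) ≡ weightIf (Mem.out final (toℕ j)) (w (toℕ j))
    same j rewrite output j with lookup chosen j
    ... | true  = sym (w-at j)
    ... | false = refl

  feasible : Feasible I chosen
  feasible = record
    { start    = λ i j → fromℕ (times (toℕ i) (toℕ j))
    ; nonneg   = λ i j _ → fromℕ-mono {0} {times (toℕ i) (toℕ j)} z≤n
    ; flow     = λ i i′ j j∈ eq → embed i i′ j j (subst (λ k → times (toℕ i) (toℕ j) + p (toℕ i) (toℕ j) ≤ times k (toℕ j)) (sym eq)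
        (flow (toℕ i) (toℕ j) (s<s⁻¹ (subst (_< suc M) eq (toℕ<n i′))) (toℕ<n j) (selected j∈)))
    ; disjoint = λ i j k j∈ k∈ j≢k → [ inj₁ ∘ embed i i j k , inj₂ ∘ embed i i k j ]′
        (disjoint (toℕ i) (toℕ j) (toℕ k) (s≤s⁻¹ (toℕ<n i)) (toℕ<n j) (toℕ<n k) (selected j∈) (selected k∈)
          (j≢k ∘ toℕ-injective))
    ; jit      = λ i j j∈ eq → trans (sum i j) (cong fromℕ (trans
        (subst (λ k → times k (toℕ j) + p k (toℕ j) ≡ d (toℕ j)) (sym (suc-injective eq)) (jit (toℕ j) (toℕ<n j) (selected j∈)))
        (d-at j)))
    }
    where
    open Schedule schedule
    sum : ∀ i j → fromℕ (times (toℕ i) (toℕ j)) ℚ.+ fromℕ (pᶠ i j) ≡ fromℕ (times (toℕ i) (toℕ j) + p (toℕ i) (toℕ j))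
    sum i j = trans (sym (fromℕ-+ (times (toℕ i) (toℕ j)) (pᶠ i j)))
      (cong (λ z → fromℕ (times (toℕ i) (toℕ j) + z)) (sym (p-at i j)))
    embed : ∀ i i′ j k → times (toℕ i) (toℕ j) + p (toℕ i) (toℕ j) ≤ times (toℕ i′) (toℕ k) →
      fromℕ (times (toℕ i) (toℕ j)) ℚ.+ fromℕ (pᶠ i j) ℚ.≤ fromℕ (times (toℕ i′) (toℕ k))
    embed i i′ j k le = ℚ.≤-trans (ℚ.≤-reflexive (sum i j)) (fromℕ-mono le)

  optimal : Optimal I chosen
  optimal = feasible , λ E S → ≤-trans (Feasible⇒.bound E S) (≤-reflexive (sym chosen-weight))

  solves : SolvesWithin (JITFlowShop (suc M)) (program algorithm) I totalCost
  solves = let t , τ , π , t≤ , r = run run-algorithm (encodeFlowShop I) encoded in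
    t , τ , π , (chosen , optimal , λ j → trans (_∼_.∼A r zero (toℕ j)) (output j)) , t≤

-- Running time and size bounds

perVector : ℕ → ℕ
perVector M = 3 + (checkCost M + 150 * suc (M ∸ 1))

-- Abstract, since constant M * t would unfold to thousands of additions.
abstract
  constant : ℕ → ℕ
  constant M = prepareCost M + (3 + (4 * perVector M + 3))

  constant-def : ∀ M → constant M ≡ prepareCost M + (3 + (4 * perVector M + 3))
  constant-def M = refl

module Bounds {M : ℕ} (I : FlowShop (suc M)) where
  open FlowShop I using (n; n>0; p; d; w)
  open Instance I

  instance
    n≢0 : NonZero n
    n≢0 = >-nonZero n>0

  time : ℕ
  time = n ^ (#d I + 1) * (#d I !) ^ (M ∸ 1)

  1≤F : 1 ≤ (#d I !) ^ (M ∸ 1)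
  1≤F = 1≤power (M ∸ 1) (1≤factorial (#d I))

  -- There is a job and hence a due date, so the exponent `#d + 1` is at least 2 and the quadratic
  -- preparation is absorbed.
  n²≤time : n * n ≤ time
  n²≤time = begin
    n * n                                 ≡⟨ cong (n *_) (*-identityʳ n) ⟨
    n ^ 2                                 ≤⟨ ^-monoʳ-≤ n (+-monoˡ-≤ 1 (subst (1 ≤_) words≡ 1≤words)) ⟩
    n ^ (#d I + 1)                        ≡⟨ *-identityʳ _ ⟨
    n ^ (#d I + 1) * 1                    ≤⟨ *-monoʳ-≤ (n ^ (#d I + 1)) 1≤F ⟩
    time                                     ∎
    where open ≤-Reasoning

  1≤time : 1 ≤ time
  1≤time = ≤-trans (*-mono-≤ n>0 n>0) n²≤time

  iteration≤ : 3 + iterationCost ≤ perVector M * n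
  iteration≤ = begin
    3 + (checkCost M * n + 150 * (suc (M ∸ 1) * n))
      ≤⟨ +-mono-≤ (≤-trans (≤-reflexive (sym (*-identityʳ 3))) (*-monoʳ-≤ 3 n>0))
           (≤-reflexive (cong (checkCost M * n +_) (sym (*-assoc 150 (suc (M ∸ 1)) n)))) ⟩
    3 * n + (checkCost M * n + 150 * suc (M ∸ 1) * n)
      ≡⟨ cong (3 * n +_) (*-distribʳ-+ n (checkCost M) (150 * suc (M ∸ 1))) ⟨
    3 * n + (checkCost M + 150 * suc (M ∸ 1)) * n
      ≡⟨ *-distribʳ-+ n 3 (checkCost M + 150 * suc (M ∸ 1)) ⟨
    perVector M * n ∎
    where open ≤-Reasoning

  #d≤n : #d I ≤ n
  #d≤n = subst (_≤ n) words≡ (Specifications.distinctUpTo≤ M input n)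

  -- The surplus factor `n` in `time` pays for one iteration of the search; the 4 is the price of
  -- admitting blanks in words.
  search≤ : vectors * (3 + iterationCost) ≤ 4 * perVector M * time
  search≤ = begin
    vectors * (3 + iterationCost)           ≤⟨ *-mono-≤ (≤-reflexive vectors≡′) iteration≤ ⟩
    (suc n ^ D * F) * (c * n)               ≤⟨ *-monoˡ-≤ (c * n) (*-monoˡ-≤ F (suc-power n D #d≤n)) ⟩
    (4 * n ^ D * F) * (c * n)               ≡⟨ [m*n]*[o*p]≡[m*o]*[n*p] (4 * n ^ D) F c n ⟩
    (4 * n ^ D * c) * (F * n)               ≡⟨ cong₂ _*_ (trans (*-assoc 4 (n ^ D) c) (trans (cong (4 *_) (*-comm (n ^ D) c)) (sym (*-assoc 4 c (n ^ D))))) (*-comm F n) ⟩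
    (4 * c * n ^ D) * (n * F)               ≡⟨ *-assoc (4 * c) (n ^ D) (n * F) ⟩
    4 * c * (n ^ D * (n * F))               ≡⟨ cong (4 * c *_) (*-assoc (n ^ D) n F) ⟨
    4 * c * (n ^ D * n * F)                 ≡⟨ cong (λ z → 4 * c * (z * F)) (trans (*-comm (n ^ D) n) (cong (n ^_) (+-comm 1 D))) ⟩
    4 * c * (n ^ (D + 1) * F)               ∎
    where
    open ≤-Reasoning
    c = perVector M
    D = #d I
    F = (#d I !) ^ (M ∸ 1)
    vectors≡′ : vectors ≡ suc n ^ D * F
    vectors≡′ = trans vectors≡ (cong (λ L → suc n ^ L * (L !) ^ (M ∸ 1)) words≡)

  total≤ : totalCost ≤ constant M * time
  total≤ = begin
    prepareCost M * (n * n) + (3 + (vectors * (3 + iterationCost) + 3))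
      ≤⟨ +-mono-≤ (*-monoʳ-≤ (prepareCost M) n²≤time) (+-mono-≤ three (+-mono-≤ search≤ three)) ⟩
    prepareCost M * time + (3 * time + (4 * perVector M * time + 3 * time))
      ≡⟨ cong (λ z → prepareCost M * time + (3 * time + z)) (*-distribʳ-+ time (4 * perVector M) 3) ⟨
    prepareCost M * time + (3 * time + (4 * perVector M + 3) * time)
      ≡⟨ cong (prepareCost M * time +_) (*-distribʳ-+ time 3 (4 * perVector M + 3)) ⟨
    prepareCost M * time + (3 + (4 * perVector M + 3)) * time
      ≡⟨ *-distribʳ-+ time (prepareCost M) (3 + (4 * perVector M + 3)) ⟨
    (prepareCost M + (3 + (4 * perVector M + 3))) * time
      ≡⟨ cong (_* time) (constant-def M) ⟨
    constant M * time ∎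
    where
    open ≤-Reasoning
    three : 3 ≤ 3 * time
    three = ≤-trans (≤-reflexive (sym (*-identityʳ 3))) (*-monoʳ-≤ 3 1≤time)

  size : ℕ
  size = totalBits I

  n<size : n < size
  n<size = +-mono-≤ (s≤s {n = ⌊log₂ n ⌋} z≤n) (n≤∑ _ (λ j → ≤-trans (s≤s z≤n) (m≤n+m (bits (w j)) ((∑ λ i → bits (p i j)) + bits (d j)))))

  2≤size : 2 ≤ size
  2≤size = ≤-trans (s≤s n>0) n<size

  -- Every factor becomes a power of the size: `C ≤ size ^ C`, `n ≤ size`, and `D ! ≤ n ^ D` because
  -- `D ≤ n`. For fixed `M` the exponent is affine in the parameter.
  power-bound : ∀ C → C * time ≤ size ^ (C + ((#d I + 1) + (M ∸ 1) * #d I))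
  power-bound C = begin
    C * (n ^ (D + 1) * (D !) ^ R)
      ≤⟨ *-mono-≤ (n≤power C 2≤size) (*-mono-≤ (^-monoˡ-≤ (D + 1) (<⇒≤ n<size))
           (^-monoˡ-≤ R (≤-trans (factorial≤power D #d≤n) (^-monoˡ-≤ D (<⇒≤ n<size))))) ⟩
    size ^ C * (size ^ (D + 1) * (size ^ D) ^ R)
      ≡⟨ cong (λ z → size ^ C * (size ^ (D + 1) * z)) (trans (^-*-assoc size D R) (cong (size ^_) (*-comm D R))) ⟩
    size ^ C * (size ^ (D + 1) * size ^ (R * D))
      ≡⟨ cong (size ^ C *_) (^-distribˡ-+-* size (D + 1) (R * D)) ⟨
    size ^ C * size ^ ((D + 1) + R * D)
      ≡⟨ ^-distribˡ-+-* size C ((D + 1) + R * D) ⟨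
    size ^ (C + ((D + 1) + R * D)) ∎
    where
    open ≤-Reasoning
    D = #d I
    R = M ∸ 1

weaken-SolvesWithin : ∀ Π P I {b b′} → b ≤ b′ → SolvesWithin Π P I b → SolvesWithin Π P I b′
weaken-SolvesWithin Π P I b≤ (t , τ , π , correct , t≤) = t , τ , π , correct , ≤-trans t≤ b≤

-- Computability of the exponent and the theorem

-- The machine cannot multiply, but the factor is a constant of the program, so repeated addition is
-- a single expression.
multiple : ℕ → Expr → Expr
multiple zero    e = con 0
multiple (suc r) e = e ⊕ multiple r e

eval-multiple : ∀ σ r e → eval σ (multiple r e) ≡ r * eval σ e
eval-multiple σ zero    e = refl
eval-multiple σ (suc r) e = cong (eval σ e +_) (eval-multiple σ r e)

linear-computable : ∀ C R → Computable (λ k → C + ((k + 1) + R * k))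
linear-computable C R =
  0 ⟦ con 0 ⟧≔ con C ⊕ (input ⊕ con 1 ⊕ multiple R input) , λ k →
  _ , _ , assign , cong (λ z → C + (k + 1 + z)) (eval-multiple _ R input)
  where input = 0 ⟦ con 0 ⟧

corollary1 : (m : ℕ) → 1 ≤ m →
    SolvableInO (JITFlowShop m)
    (λ I → FlowShop.n I ^ (#d I + 1) * (#d I !) ^ (m ∸ 2))
    × XP (JITFlowShop m)
-- With `m = suc M` the exponent `m ∸ 2` computes to `M ∸ 1`; for one machine both are 0.
corollary1 (suc M) _ =
  (P , C , solves′) ,
  (λ k → C + ((k + 1) + (M ∸ 1) * k)) , linear-computable C (M ∸ 1) , P ,
  λ I → weaken-SolvesWithin (JITFlowShop (suc M)) P I (Bounds.power-bound I C) (solves′ I)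
  where
  P : Program
  P = Algorithm.program M (Algorithm.algorithm M)
  C : ℕ
  C = constant M
  solves′ : ∀ I → SolvesWithin (JITFlowShop (suc M)) P I
    (C * (FlowShop.n I ^ (#d I + 1) * (#d I !) ^ (M ∸ 1)))
  solves′ I = weaken-SolvesWithin (JITFlowShop (suc M)) P I (Bounds.total≤ I) (Instance.solves I)
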